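{- Let $(\mathbb T,v)\in\mathrm{Tab}_\lambda\times\mathbb N_0^N$. Then there is a nonzero $c\in K$ and vectors $u_{v'}\in V_\lambda$ such that $$P_{v,\mathbb T}=c\,x^v\otimes(\mathbb TR_v)+\sum_{v'\lhd v}x^{v'}\otimes u_{v'},$$ i.e. the leading term of $P_{v,\mathbb T}$, up to a constant multiple, is $x^{v,\mathbb T}:=x^v\otimes \mathbb TR_v$.
   Context: $N\ge2$, $q,s$ indeterminates, $K=\mathbb C(q,s)$. Operators act on the right, composed left to right. $\mathcal H_N(s)$ is generated by $T_1,\dots,T_{N-1}$ with $(T_i+1)(T_i-s)=0$ and braid relations. $\lambda$ a partition of $N$ (French convention, rows numbered bottom to top); $\mathrm{Tab}_\lambda$ = reverse standard tableaux (bijective fillings by $1,\dots,N$ strictly decreasing left to right in rows and bottom to top in columns); $\mathrm{CT}_{\mathbb T}[i]$ = column minus row of the cell of $i$; $\mathbb T^{(i,j)}$ exchanges $i,j$. $V_\lambda$ has basis $\mathrm{Tab}_\lambda$, right action $\mathbb TT_i=s\mathbb T$ if $i,i+1$ share a row, $-\mathbb T$ if they share a column, and if $i$ is in a higher row than $i+1$, with $m=\mathrm{CT}_{\mathbb T}[i+1]-\mathrm{CT}_{\mathbb T}[i]>0$, $\mathbb TT_i=\frac{s-1}{1-s^m}\mathbb T+\frac{s(1-s^{m+1})(1-s^{m-1})}{(1-s^m)^2}\mathbb T^{(i,i+1)}$; remaining case determined by this formula for $\mathbb T^{(i,i+1)}$ and the quadratic relation. Permutations act on the right of $\{1,\dots,N\}$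 ($i.(\sigma\tau)=(i.\sigma).\tau$); for reduced $\sigma=s_{i_1}\cdots s_{i_k}$, $\widetilde T_\sigma=T_{i_1}\cdots T_{i_k}$. For $v\in\mathbb N_0^N$, $r_v$ is the permutation with $i.r_v=r_v[i]=\#\{j\le i:v_j\ge v_i\}+\#\{j>i:v_j>v_i\}$, and $R_v=\widetilde T_{r_v}^{ -1}$. $\mathcal M_\lambda=K[x_1,\dots,x_N]\otimes V_\lambda$, $x^v=x_1^{v_1}\cdots x_N^{v_N}$; $(p\otimes u)\mathbf T_i=(1-s)\frac{x_{i+1}(p-p^{s_i})}{x_i-x_{i+1}}\otimes u+p^{s_i}\otimes uT_i$, $(p\otimes u)\mathbf w=p(qx_N,x_1,\dots,x_{N-1})\otimes uT_1\cdots T_{N-1}$, $\mathbf T_i^{ -1}=s^{ -1}(\mathbf T_i+1-s)$, $\Xi_i=s^{i-N}\mathbf T_{i-1}^{ -1}\cdots\mathbf T_1^{ -1}\mathbf w\mathbf T_{N-1}\cdots\mathbf T_i$. $P_{v,\mathbb T}$ is the unique (up to the normalization fixed by the Yang–Baxter recursion) simultaneous eigenfunction of $\Xi_1,\dots,\Xi_N$ in $\mathcal M_\lambda$ with eigenvalues $P_{v,\mathbb T}\Xi_i=q^{v_i}s^{\mathrm{CT}_{\mathbb T}[r_v[i]]}P_{v,\mathbb T}$ (the nonsymmetric vector-valued Macdonald polynomial; these form a basis of $\mathcal M_\lambda$). Orders: $v^+$ = decreasing rearrangement; $v\preceq v'$ iff all partial sums $\sum_{k\le i}v_k\le\sum_{k\le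 i}v'_k$; $v\trianglelefteq v'$ iff ($v^+\ne v'^+$ and $v^+\preceq v'^+$) or ($v^+=v'^+$ and $v\preceq v'$); $v'\lhd v$ iff $v'\trianglelefteq v$, $v'\ne v$. -}

module Defs where

open import Level using (Level; _⊔_) renaming (suc to lsuc)
open import Algebra.Apartness.Bundles using (HeytingField; HeytingCommutativeRing)
open import Algebra.Bundles using (CommutativeRing; Semiring)
open import Algebra.Morphism.Structures using (IsRingHomomorphism)
import Algebra.Apartness.Properties.HeytingCommutativeRing as HeytingProperties
import Algebra.Definitions.RawSemiring as RawSemiringOps
open import Data.Bool.Base using (true; false; if_then_else_)
open import Data.Empty using (⊥-elim)
open import Data.Fin.Base using (Fin; zero; suc; toℕ; fromℕ<; inject₁)
import Data.Fin.Base as Fin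
import Data.Fin.Permutation as Perm
import Data.Fin.Permutation.Components as PC
import Data.Fin.Properties as Fin
open import Data.Integer.Base as ℤ using (ℤ; +_; -[1+_]; _⊖_; ∣_∣)
import Data.Integer.Properties as ℤ
open import Data.List.Base
  using (List; []; _∷_; _++_; map; concatMap; foldl; foldr; reverse; filter; length; lookup; take; allFin; applyUpTo)
open import Data.List.Properties using (length-filter; length-tabulate)
open import Data.List.Relation.Unary.All using (All)
open import Data.List.Relation.Unary.Linked using (Linked)
import Data.List.Sort as Sort
open import Data.Nat.Base as ℕ using (ℕ; zero; suc; pred; _∸_; _≤_; _<_; _≥_; s≤s; NonZero; ≢-nonZero)
open import Data.Nat.ListAction using (sum)
import Data.Nat.Properties as ℕ
open import Data.Product.Base using (Σ-syntax; ∃-syntax; ∃₂; _×_; _,_; proj₁; proj₂)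
import Data.Product.Properties as Product
open import Data.Product.Relation.Binary.Pointwise.NonDependent using (×-decSetoid)
open import Data.Sum.Base using (_⊎_; inj₁; inj₂)
open import Data.Vec.Base as Vec using (Vec; []; _∷_; _∷ʳ_; toList; _[_]%=_; _[_]≔_)
import Data.Vec.Properties as Vec
open import Function.Base using (id; _∘_; flip)
open import Function.Bundles using (_↔_; Inverse)
open import Function.Construct.Composition using (_↔-∘_)
open import Relation.Binary.Bundles using (DecSetoid)
open import Relation.Binary.Core using (Rel)
import Relation.Binary.Construct.Flip.EqAndOrd as Flip
open import Relation.Binary.Definitions using (tri<; tri≈; tri>)
open import Relation.Binary.PropositionalEquality
  using (_≡_; _≢_; refl; sym; trans; cong; cong₂; subst; subst₂)
import Relation.Binary.PropositionalEquality.Properties as ≡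
import Relation.Binary.Reasoning.Setoid as SetoidReasoning
open import Relation.Binary.Structures using (IsStrictPartialOrder)
open import Relation.Nullary using (¬_; Dec; yes; no; does)
open import Relation.Nullary.Decidable using (_×-dec_; _⊎-dec_)

------------------------------------------------------------------------
-- Free modules

-- An element of the free R-module on a set is a list of (coefficient, basis
-- element) pairs; two such lists are identified (by _≋_) when every basis
-- element has the same total coefficient in both.

module FormalSums {c ℓ : Level} (R : CommutativeRing c ℓ) where

  open CommutativeRing R hiding (sym; trans; refl)

  FormalSum : ∀ {a} → Set a → Set (c ⊔ a)
  FormalSum A = List (Carrier × A)

  infixl 6 _⊕_
  infixr 7 _•_ _⊗_

  _⊕_ : ∀ {a} {A : Set a} → FormalSum A → FormalSum A → FormalSum A
  _⊕_ = _++_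

  _•_ : ∀ {a} {A : Set a} → Carrier → FormalSum A → FormalSum A
  k • x = map (λ t → k * proj₁ t , proj₂ t) x

  [_] : ∀ {a} {A : Set a} → A → FormalSum A
  [ b ] = (1# , b) ∷ []

  Sum : ∀ {a b} {A : Set a} {B : Set b} → List B → (B → FormalSum A) → FormalSum A
  Sum bs f = concatMap f bs

  linear : ∀ {a b} {A : Set a} {B : Set b} →
           (A → FormalSum B) → FormalSum A → FormalSum B
  linear f = concatMap (λ t → proj₁ t • f (proj₂ t))

  _⊗_ : ∀ {a b} {A : Set a} {B : Set b} →
        FormalSum A → FormalSum B → FormalSum (A × B)
  x ⊗ y = linear (λ a → linear (λ b → [ a , b ]) y) x

  module Equality {a ℓ′ : Level} (basis : DecSetoid a ℓ′) where

    open DecSetoid basis using (_≟_) renaming (Carrier to A)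

    coeff : A → FormalSum A → Carrier
    coeff b []            = 0#
    coeff b ((k , a) ∷ x) = (if does (b ≟ a) then k else 0#) + coeff b x

    infix 4 _≋_
    _≋_ : FormalSum A → FormalSum A → Set (a ⊔ ℓ)
    x ≋ y = ∀ b → coeff b x ≈ coeff b y

module HeytingRing {c ℓ₁ ℓ₂ : Level} (F : HeytingField c ℓ₁ ℓ₂) where
  open HeytingField F using (heytingCommutativeRing)
  open HeytingCommutativeRing heytingCommutativeRing public using (commutativeRing)
  open CommutativeRing commutativeRing public using (rawRing; semiring; setoid)
  open RawSemiringOps (Semiring.rawSemiring semiring) public using (_^_) renaming (_×_ to _·_)

------------------------------------------------------------------------
-- The field ℂ(q , s)

-- The library has no real numbers, so ℝ is characterised, up to isomorphism,
-- as a Cauchy-complete Archimedean ordered field.  Heyting fields are used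
-- because equality of reals is not decidable; x # y is "x ≠ y".

record RealNumbers (c ℓ₁ ℓ₂ : Level) : Set (lsuc (c ⊔ ℓ₁ ⊔ ℓ₂)) where
  field
    heytingField : HeytingField c ℓ₁ ℓ₂
  open HeytingField heytingField public hiding (sym; trans; refl; setoid)
  open HeytingRing heytingField public

  infix 4 _≺_
  field
    _≺_                  : Rel Carrier ℓ₂
    isStrictPartialOrder : IsStrictPartialOrder _≈_ _≺_
    #⇒≺                  : ∀ {x y} → x # y → x ≺ y ⊎ y ≺ x
    ≺⇒#                  : ∀ {x y} → x ≺ y → x # y
    +-monoˡ-≺            : ∀ z {x y} → x ≺ y → x + z ≺ y + z
    *-positive           : ∀ {x y} → 0# ≺ x → 0# ≺ y → 0# ≺ x * y
    archimedean          : ∀ x → ∃[ n ] x ≺ n · 1#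

  -- ∣ x − y ∣ < 1/(k+1)
  Within : ℕ → Carrier → Carrier → Set ℓ₂
  Within k x y = (suc k · (x - y) ≺ 1#) × (suc k · (y - x) ≺ 1#)

  Cauchy : (ℕ → Carrier) → Set ℓ₂
  Cauchy f = ∀ k → ∃[ m ] (∀ i j → m ≤ i → m ≤ j → Within k (f i) (f j))

  _ConvergesTo_ : (ℕ → Carrier) → Carrier → Set ℓ₂
  f ConvergesTo x = ∀ k → ∃[ m ] (∀ i → m ≤ i → Within k (f i) x)

  field
    complete : ∀ f → Cauchy f → ∃[ x ] f ConvergesTo x

record ComplexNumbers (c ℓ₁ ℓ₂ : Level) : Set (lsuc (c ⊔ ℓ₁ ⊔ ℓ₂)) where
  field
    ℝ            : RealNumbers c ℓ₁ ℓ₂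
    heytingField : HeytingField c ℓ₁ ℓ₂
  private module ℝ = RealNumbers ℝ
  open HeytingField heytingField public hiding (sym; trans; refl; setoid)
  open HeytingRing heytingField public
  field
    fromℝ                : ℝ.Carrier → Carrier
    fromℝ-isHomomorphism : IsRingHomomorphism ℝ.rawRing rawRing fromℝ
    i                    : Carrier
    i²≈-1                : i * i ≈ - 1#
    cartesian            : ∀ z → ∃₂ λ x y → z ≈ fromℝ x + fromℝ y * i

-- K is generated as a field over ℂ by two algebraically independent elements
-- q and s.  Polynomials in q and s are formal sums over ℂ of pairs of
-- exponents.

record RationalFunctionField (c ℓ₁ ℓ₂ : Level) : Set (lsuc (c ⊔ ℓ₁ ⊔ ℓ₂)) where
  field
    ℂ            : ComplexNumbers c ℓ₁ ℓ₂
    heytingField : HeytingField c ℓ₁ ℓ₂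
  private module ℂ = ComplexNumbers ℂ
  open HeytingField heytingField public hiding (sym; trans; refl; setoid)
  open HeytingRing heytingField public
  field
    constant                : ℂ.Carrier → Carrier
    constant-isHomomorphism : IsRingHomomorphism ℂ.rawRing rawRing constant
    q s                     : Carrier

  open FormalSums ℂ.commutativeRing using (FormalSum; module Equality)
  open Equality (≡.decSetoid (Product.≡-dec ℕ._≟_ ℕ._≟_)) using (coeff)

  Polynomial : Set c
  Polynomial = FormalSum (ℕ × ℕ)

  eval : Polynomial → Carrier
  eval = foldr (λ t x → constant (proj₁ t) * (q ^ proj₁ (proj₂ t) * s ^ proj₂ (proj₂ t)) + x) 0#

  Nonzero : Polynomial → Set ℓ₂
  Nonzero f = ∃[ e ] coeff e f ℂ.# ℂ.0#

  field
    algebraicallyIndependent : ∀ f → Nonzero f → eval f # 0#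
    fraction                 : ∀ x → ∃₂ λ f g → Nonzero g × x * eval g ≈ eval f

  private
    module KP = HeytingProperties (HeytingField.heytingCommutativeRing heytingField)
    module ℂP = HeytingProperties (HeytingField.heytingCommutativeRing ℂ.heytingField)
    module H  = IsRingHomomorphism constant-isHomomorphism
    module R  = CommutativeRing commutativeRing
    module C  = CommutativeRing ℂ.commutativeRing
    open SetoidReasoning setoid

  s#0 : s # 0#
  s#0 = KP.#-congʳ eval≈s (algebraicallyIndependent ((ℂ.1# , 0 , 1) ∷ []) ((0 , 1) , 1+0#0))
    where
    1+0#0 : (ℂ.1# ℂ.+ ℂ.0#) ℂ.# ℂ.0#
    1+0#0 = ℂP.#-congʳ (C.sym (C.+-identityʳ _)) ℂP.1#0
    eval≈s : eval ((ℂ.1# , 0 , 1) ∷ []) ≈ s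
    eval≈s = begin
      constant ℂ.1# * (1# * (s * 1#)) + 0# ≈⟨ R.+-identityʳ _ ⟩
      constant ℂ.1# * (1# * (s * 1#))      ≈⟨ R.*-congʳ H.1#-homo ⟩
      1# * (1# * (s * 1#))                 ≈⟨ R.*-identityˡ _ ⟩
      1# * (s * 1#)                        ≈⟨ R.*-identityˡ _ ⟩
      s * 1#                               ≈⟨ R.*-identityʳ _ ⟩
      s                                    ∎

  1-s^m#0 : ∀ m .{{_ : NonZero m}} → (1# - s ^ m) # 0#
  1-s^m#0 (suc m) = KP.#-congʳ eval≈ (algebraicallyIndependent f ((0 , 0) , coeff#0))
    where
    f : Polynomial
    f = (ℂ.1# , 0 , 0) ∷ (ℂ.- ℂ.1# , 0 , suc m) ∷ []
    coeff#0 : (ℂ.1# ℂ.+ (ℂ.0# ℂ.+ ℂ.0#)) ℂ.# ℂ.0#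
    coeff#0 = ℂP.#-congʳ (C.sym (C.trans (C.+-congˡ (C.+-identityʳ _)) (C.+-identityʳ _))) ℂP.1#0
    constant-1 : constant (ℂ.- ℂ.1#) ≈ - 1#
    constant-1 = R.trans (H.-‿homo _) (R.-‿cong H.1#-homo)
    open import Algebra.Properties.Ring R.ring using (-1*x≈-x)
    eval≈ : eval f ≈ 1# - s ^ suc m
    eval≈ = R.+-cong
      (R.trans (R.*-congʳ H.1#-homo) (R.trans (R.*-identityˡ _) (R.*-identityˡ _)))
      (R.trans (R.+-identityʳ _)
        (R.trans (R.*-cong constant-1 (R.*-identityˡ _)) (-1*x≈-x _)))

  inverse : ∀ {x} → x # 0# → Carrier
  inverse x#0 = proj₁ (#⇒invertible x#0)

  inverse-correct : ∀ {x} (x#0 : x # 0#) → inverse x#0 * x ≈ 1#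
  inverse-correct x#0 =
    R.trans (R.*-congˡ (R.sym (KP.x-0≈x _))) (proj₁ (proj₂ (#⇒invertible x#0)))

  infixl 7 _/1-s^_
  _/1-s^_ : Carrier → ∀ m .{{_ : NonZero m}} → Carrier
  x /1-s^ m = x * inverse (1-s^m#0 m)

  s⁻¹ : Carrier
  s⁻¹ = inverse s#0

  s^ℤ_ : ℤ → Carrier
  s^ℤ (+ m)    = s ^ m
  s^ℤ -[1+ m ] = s⁻¹ ^ suc m

------------------------------------------------------------------------
-- Partitions and reverse standard tableaux

record Partition (N : ℕ) : Set where
  field
    parts      : List ℕ
    positive   : All (0 <_) parts
    decreasing : Linked _≥_ parts
    sum≡       : sum parts ≡ N

-- Rows and columns are numbered from 0, row 0 being the bottom (longest) row.

module Tableaux {N : ℕ} (κ : Partition N) where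

  open Partition κ

  Cell : Set
  Cell = Σ[ r ∈ Fin (length parts) ] Fin (lookup parts r)

  row col : Cell → ℕ
  row = toℕ ∘ proj₁
  col = toℕ ∘ proj₂

  content : Cell → ℤ
  content a = col a ⊖ row a

  -- The labels 1 , … , N are represented by Fin N, shifted down by one.

  record Tableau : Set where
    field
      filling : Fin N ↔ Cell

    cell : Fin N → Cell
    cell = Inverse.to filling

    entry : Cell → Fin N
    entry = Inverse.from filling

    field
      rowsDecrease : ∀ a b → row a ≡ row b → col a < col b → entry b Fin.< entry a
      colsDecrease : ∀ a b → col a ≡ col b → row a < row b → entry b Fin.< entry a

    CT : Fin N → ℤ
    CT = content ∘ cell

  open Tableau public

  tableaux : DecSetoid _ _
  tableaux = record
    { Carrier = Tableau
    ; _≈_ = λ T T′ → ∀ i → cell T i ≡ cell T′ i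
    ; isDecEquivalence = record
      { isEquivalence = record
        { refl  = λ _ → refl
        ; sym   = λ e i → sym (e i)
        ; trans = λ e e′ i → trans (e i) (e′ i) }
      ; _≟_ = λ T T′ → Fin.all? (λ i → Product.≡-dec Fin._≟_ Fin._≟_ (cell T i) (cell T′ i)) } }

-- The adjacent transposition exchanging k and k + 1.

adjacent : ∀ {m} → Fin m → Fin (suc m) → Fin (suc m)
adjacent k = PC.transpose (inject₁ k) (suc k)

private

  inject₁<suc : ∀ {m} (k : Fin m) → inject₁ k Fin.< suc k
  inject₁<suc k = s≤s (ℕ.≤-reflexive (Fin.toℕ-inject₁ k))

  -- Exchanging the values k and k + 1 preserves every strict inequality but k < k + 1.
  transpose-mono : ∀ {m} (k : Fin m) {x y : Fin (suc m)} → x Fin.< y →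
                   ¬ (x ≡ inject₁ k × y ≡ suc k) →
                   PC.transpose (suc k) (inject₁ k) x Fin.< PC.transpose (suc k) (inject₁ k) y
  transpose-mono k {x} {y} x<y ¬kk with x Fin.≟ suc k
  ... | yes refl with y Fin.≟ suc k
  ...   | yes refl = ⊥-elim (ℕ.<-irrefl refl x<y)
  ...   | no _ with y Fin.≟ inject₁ k
  ...     | yes refl = ⊥-elim (ℕ.<-asym x<y (inject₁<suc k))
  ...     | no _     = ℕ.<-trans (inject₁<suc k) x<y
  transpose-mono k {x} {y} x<y ¬kk | no _ with x Fin.≟ inject₁ k
  ... | yes refl with y Fin.≟ suc k
  ...   | yes refl = ⊥-elim (¬kk (refl , refl))
  ...   | no y≢ with y Fin.≟ inject₁ k
  ...     | yes refl = ⊥-elim (ℕ.<-irrefl refl x<y)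
  ...     | no _     =
    Fin.≤∧≢⇒< {i = suc k} {j = y} (subst (ℕ._< toℕ y) (Fin.toℕ-inject₁ k) x<y) (y≢ ∘ sym)
  transpose-mono k {x} {y} x<y ¬kk | no _ | no x≢ with y Fin.≟ suc k
  ... | yes refl =
    Fin.≤∧≢⇒< {i = x} {j = inject₁ k}
      (subst (toℕ x ℕ.≤_) (sym (Fin.toℕ-inject₁ k)) (ℕ.s≤s⁻¹ x<y)) x≢
  ... | no _ with y Fin.≟ inject₁ k
  ...   | yes refl = ℕ.<-trans x<y (inject₁<suc k)
  ...   | no _     = x<y

module _ {m : ℕ} (κ : Partition (suc m)) where

  open Tableaux κ

  SameRow SameCol : Tableau → Fin m → Set
  SameRow T k = row (cell T (inject₁ k)) ≡ row (cell T (suc k))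
  SameCol T k = col (cell T (inject₁ k)) ≡ col (cell T (suc k))

  exchange : (T : Tableau) (k : Fin m) → ¬ SameRow T k → ¬ SameCol T k → Tableau
  exchange T k ¬row ¬col = record
    { filling      = filling T ↔-∘ Perm.transpose (inject₁ k) (suc k)
    ; rowsDecrease = λ a b r c →
        transpose-mono k (rowsDecrease T a b r c) λ (e , e′) → ¬row (same row e e′ (sym r))
    ; colsDecrease = λ a b c r →
        transpose-mono k (colsDecrease T a b c r) λ (e , e′) → ¬col (same col e e′ (sym c)) }
    where
    same : (f : Cell → ℕ) → ∀ {a b} → entry T b ≡ inject₁ k → entry T a ≡ suc k →
           f b ≡ f a → f (cell T (inject₁ k)) ≡ f (cell T (suc k))
    same f {a} {b} e e′ fb≡fa =
      trans (cong f (Inverse.inverseˡ (filling T) (sym e)))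
        (trans fb≡fa (cong f (sym (Inverse.inverseˡ (filling T) (sym e′)))))

  private

    -- Otherwise the cell in the row of a and the column of b has an entry
    -- strictly between those of a and b.
    corner : (T : Tableau) (a b : Cell) → row b < row a → col b < col a →
             2 ℕ.+ toℕ (entry T a) ≤ toℕ (entry T b)
    corner T a b r<r c<c = ℕ.≤-<-trans
      (rowsDecrease T c a refl (subst (_< col a) (sym col-c) c<c))
      (colsDecrease T b c (sym col-c) r<r)
      where
      c : Cell
      c = proj₁ a , fromℕ< (ℕ.<-trans c<c (Fin.toℕ<n (proj₂ a)))
      col-c : col c ≡ col b
      col-c = Fin.toℕ-fromℕ< _

    diagonal : (a b : Cell) → content a ≡ content b → row b < row a → col b < col a
    diagonal a b eq r<r = ℕ.≰⇒> λ c≤c → ℤ.<-irrefl eq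
      (ℤ.<-≤-trans (ℤ.⊖-monoʳ->-< (col a) r<r) (ℤ.⊖-monoˡ-≤ (row b) c≤c))

    entry-cell : (T : Tableau) (i : Fin (suc m)) → entry T (cell T i) ≡ i
    entry-cell T i = Inverse.inverseʳ (filling T) refl

  content-distinct : (T : Tableau) (k : Fin m) → ¬ SameRow T k →
                     CT T (suc k) ≢ CT T (inject₁ k)
  content-distinct T k ¬row eq with ℕ.<-cmp (row (cell T (inject₁ k))) (row (cell T (suc k)))
  ... | tri≈ _ r≡r _ = ¬row r≡r
  ... | tri> _ _ r>r = ℕ.<-irrefl refl (subst₂ (λ x y → 2 ℕ.+ x ≤ y)
    (trans (cong toℕ (entry-cell T (inject₁ k))) (Fin.toℕ-inject₁ k))
    (cong toℕ (entry-cell T (suc k)))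
    (corner T _ _ r>r (diagonal _ _ (sym eq) r>r)))
  ... | tri< r<r _ _ = ℕ.<⇒≱ (ℕ.m<n⇒m<1+n (ℕ.m<n⇒m<1+n (ℕ.n<1+n _))) (subst₂ (λ x y → 2 ℕ.+ x ≤ y)
    (cong toℕ (entry-cell T (suc k)))
    (trans (cong toℕ (entry-cell T (inject₁ k))) (Fin.toℕ-inject₁ k))
    (corner T _ _ r<r (diagonal _ _ eq r<r)))

  contentGap : Tableau → Fin m → ℕ
  contentGap T k = ∣ CT T (suc k) ℤ.- CT T (inject₁ k) ∣

  contentGap-nonZero : (T : Tableau) (k : Fin m) → ¬ SameRow T k → NonZero (contentGap T k)
  contentGap-nonZero T k ¬row = ≢-nonZero
    (content-distinct T k ¬row ∘ ℤ.i-j≡0⇒i≡j _ _ ∘ ℤ.∣i∣≡0⇒i≡0)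

------------------------------------------------------------------------
-- Exponent vectors and their orders

Exponent : ℕ → Set
Exponent = Vec ℕ

-- v⁺ , as a list.
decreasingRearrangement : ∀ {N} → Exponent N → List ℕ
decreasingRearrangement v = sort (toList v)
  where open Sort (Flip.decTotalOrder ℕ.≤-decTotalOrder)

infix 4 _≼_ _⊴_ _◁_

_≼_ : List ℕ → List ℕ → Set
xs ≼ ys = ∀ i → sum (take i xs) ≤ sum (take i ys)

_⊴_ : ∀ {N} → Exponent N → Exponent N → Set
v ⊴ w = (v⁺ ≢ w⁺ × v⁺ ≼ w⁺) ⊎ (v⁺ ≡ w⁺ × toList v ≼ toList w)
  where
  v⁺ = decreasingRearrangement v
  w⁺ = decreasingRearrangement w

_◁_ : ∀ {N} → Exponent N → Exponent N → Set
v ◁ w = v ⊴ w × v ≢ w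

-- The value r_v[i] ∈ {1 , … , N}.  The two conditions exclude each other, so
-- this is the sum of the two cardinalities.
rank : ∀ {N} → Exponent N → Fin N → ℕ
rank {N} v i = length (filter beats? (allFin N))
  where
  v[_] = Vec.lookup v
  beats? : (j : Fin N) → Dec ((j Fin.≤ i × v[ i ] ≤ v[ j ]) ⊎ (i Fin.< j × v[ i ] < v[ j ]))
  beats? j = ((j Fin.≤? i) ×-dec (v[ i ] ℕ.≤? v[ j ])) ⊎-dec ((i Fin.<? j) ×-dec (v[ i ] ℕ.<? v[ j ]))

rank≤N : ∀ {N} (v : Exponent N) i → rank v i ≤ N
rank≤N {N} v i = ℕ.≤-trans (length-filter _ (allFin N)) (ℕ.≤-reflexive (length-tabulate id))

-- r_v as a self-map of Fin N, i.e. of {0 , … , N - 1}.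
r : ∀ {m} → Exponent (suc m) → Fin (suc m) → Fin (suc m)
r v i = fromℕ< (s≤s (ℕ.pred-mono-≤ (rank≤N v i)))

------------------------------------------------------------------------
-- Reduced words

Word : ℕ → Set
Word m = List (Fin m)

-- The right action of s_{i₁} ⋯ s_{iₖ} on an index: s_{i₁} is applied first.
permute : ∀ {m} → Word m → Fin (suc m) → Fin (suc m)
permute w i = foldl (flip adjacent) i w

record IsReducedWordOf {m} (σ : Fin (suc m) → Fin (suc m)) (w : Word m) : Set where
  field
    represents : ∀ i → permute w i ≡ σ i
    shortest   : ∀ w′ → (∀ i → permute w′ i ≡ σ i) → length w ≤ length w′

------------------------------------------------------------------------
-- Polynomials

module Polynomials {c ℓ : Level} (R : CommutativeRing c ℓ) {m : ℕ} where

  open CommutativeRing R hiding (sym; trans; refl)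
  open FormalSums R

  exponents : DecSetoid _ _
  exponents = ≡.decSetoid (Vec.≡-dec {n = suc m} ℕ._≟_)

  open Equality exponents

  Poly : Set c
  Poly = FormalSum (Exponent (suc m))

  multiplyByX : Fin (suc m) → Poly → Poly
  multiplyByX i = linear (λ v → [ v [ i ]%= suc ])

  -- v with its entries k and k + 1 replaced by x and y.
  replace : Fin m → ℕ → ℕ → Exponent (suc m) → Exponent (suc m)
  replace k x y v = v [ inject₁ k ]≔ x [ suc k ]≔ y

  -- The exponent vector of (x^v)^{s_k}.
  swap : Fin m → Exponent (suc m) → Exponent (suc m)
  swap k v = replace k (Vec.lookup v (suc k)) (Vec.lookup v (inject₁ k)) v

  geometric : Fin m → Exponent (suc m) → ℕ → ℕ → Poly
  geometric k v a b = applyUpTo (λ j → 1# , replace k (b ℕ.+ j) (a ∸ 1 ∸ j) v) (a ∸ b)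

  -- (x^v - (x^v)^{s_k}) / (x_k - x_{k+1}), expanded as a geometric sum; the
  -- defining property is ∂-correct.
  ∂ : Fin m → Exponent (suc m) → Poly
  ∂ k v = geometric k v a b ⊕ (- 1# • geometric k v b a)
    where
    a = Vec.lookup v (inject₁ k)
    b = Vec.lookup v (suc k)

  private
    module Verification (k : Fin m) (v β : Exponent (suc m)) where

      open CommutativeRing R using () renaming (sym to ≈sym; trans to ≈trans; refl to ≈refl)
      open import Algebra.Properties.Ring ring using (-1*x≈-x; -0#≈0#)
      open import Algebra.Properties.AbelianGroup +-abelianGroup using (⁻¹-∙-comm; ⁻¹-anti-homo‿-)
      open import Algebra.Properties.CommutativeSemigroup +-commutativeSemigroup using (interchange)
      open SetoidReasoning setoid

      infix 5 _#δ_
      _#δ_ : Carrier → Exponent (suc m) → Carrier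
      c #δ w = if does (Vec.≡-dec ℕ._≟_ β w) then c else 0#

      #δ-* : ∀ c d w → (c * d) #δ w ≈ c * (d #δ w)
      #δ-* c d w with does (Vec.≡-dec ℕ._≟_ β w)
      ... | true  = ≈refl
      ... | false = ≈sym (zeroʳ c)

      coeff-⊕ : ∀ x y → coeff β (x ⊕ y) ≈ coeff β x + coeff β y
      coeff-⊕ []            y = ≈sym (+-identityˡ _)
      coeff-⊕ ((c , w) ∷ x) y = ≈trans (+-congˡ (coeff-⊕ x y)) (≈sym (+-assoc _ _ _))

      coeff-• : ∀ c x → coeff β (c • x) ≈ c * coeff β x
      coeff-• c []            = ≈sym (zeroʳ c)
      coeff-• c ((d , w) ∷ x) =
        ≈trans (+-cong (#δ-* c d w) (coeff-• c x)) (≈sym (distribˡ c _ _))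

      coeff-neg : ∀ x → coeff β (- 1# • x) ≈ - coeff β x
      coeff-neg x = ≈trans (coeff-• (- 1#) x) (-1*x≈-x _)

      multiplyByX-⊕ : ∀ i x y → coeff β (multiplyByX i (x ⊕ y)) ≈
                                coeff β (multiplyByX i x) + coeff β (multiplyByX i y)
      multiplyByX-⊕ i []            y = ≈sym (+-identityˡ _)
      multiplyByX-⊕ i ((c , w) ∷ x) y =
        ≈trans (+-congˡ (multiplyByX-⊕ i x y)) (≈sym (+-assoc _ _ _))

      multiplyByX-• : ∀ i c x → coeff β (multiplyByX i (c • x)) ≈ c * coeff β (multiplyByX i x)
      multiplyByX-• i c []            = ≈sym (zeroʳ c)
      multiplyByX-• i c ((d , w) ∷ x) =
        ≈trans (+-cong (≈trans (reassoc (w [ i ]%= suc)) (#δ-* c (d * 1#) _)) (multiplyByX-• i c x))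
          (≈sym (distribˡ c _ _))
        where
        reassoc : ∀ w′ → ((c * d) * 1#) #δ w′ ≈ (c * (d * 1#)) #δ w′
        reassoc w′ with does (Vec.≡-dec ℕ._≟_ β w′)
        ... | true  = *-assoc c d 1#
        ... | false = ≈refl

      D : Poly → Carrier
      D p = coeff β (multiplyByX (inject₁ k) p) - coeff β (multiplyByX (suc k) p)

      D-⊕ : ∀ x y → D (x ⊕ y) ≈ D x + D y
      D-⊕ x y = begin
        D (x ⊕ y)                             ≈⟨ +-cong (multiplyByX-⊕ _ x y) (-‿cong (multiplyByX-⊕ _ x y)) ⟩
        (_ + _) - (_ + _)                     ≈⟨ +-congˡ (⁻¹-∙-comm _ _) ⟨
        (_ + _) + (- _ + - _)                 ≈⟨ interchange _ _ _ _ ⟩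
        D x + D y                             ∎

      D-neg : ∀ x → D (- 1# • x) ≈ - D x
      D-neg x = ≈trans (+-cong (neg _) (-‿cong (neg _))) (⁻¹-∙-comm _ _)
        where
        neg : ∀ i → coeff β (multiplyByX i (- 1# • x)) ≈ - coeff β (multiplyByX i x)
        neg i = ≈trans (multiplyByX-• i (- 1#) x) (-1*x≈-x _)

      telescope : ∀ d (e : ℕ → Exponent (suc m)) (ψ : ℕ → Carrier) →
                  (∀ j → j < d → D [ e j ] ≈ ψ (suc j) - ψ j) →
                  D (applyUpTo (λ j → 1# , e j) d) ≈ ψ d - ψ 0
      telescope zero    e ψ step = ≈trans (-‿inverseʳ 0#) (≈sym (-‿inverseʳ (ψ 0)))
      telescope (suc d) e ψ step = begin
        D (applyUpTo (λ j → 1# , e j) (suc d))  ≈⟨ D-⊕ [ e 0 ] (applyUpTo (λ j → 1# , e (suc j)) d) ⟩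
        D [ e 0 ] + D (applyUpTo (λ j → 1# , e (suc j)) d)
          ≈⟨ +-cong (step 0 (s≤s ℕ.z≤n))
               (telescope d (e ∘ suc) (ψ ∘ suc) (λ j j<d → step (suc j) (s≤s j<d))) ⟩
        (ψ 1 - ψ 0) + (ψ (suc d) - ψ 1)         ≈⟨ +-comm _ _ ⟩
        (ψ (suc d) - ψ 1) + (ψ 1 - ψ 0)         ≈⟨ +-assoc _ _ _ ⟩
        ψ (suc d) + (- ψ 1 + (ψ 1 - ψ 0))       ≈⟨ +-congˡ (≈sym (+-assoc _ _ _)) ⟩
        ψ (suc d) + ((- ψ 1 + ψ 1) - ψ 0)       ≈⟨ +-congˡ (+-congʳ (-‿inverseˡ _)) ⟩
        ψ (suc d) + (0# - ψ 0)                  ≈⟨ +-congˡ (+-identityˡ _) ⟩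
        ψ (suc d) - ψ 0                         ∎

      φ : ℕ → ℕ → Carrier
      φ x y = coeff β [ replace k x y v ]

      bump₁ : ∀ {m} (k : Fin m) x y (v : Exponent (suc m)) →
              (v [ inject₁ k ]≔ x [ suc k ]≔ y) [ inject₁ k ]%= suc ≡ v [ inject₁ k ]≔ suc x [ suc k ]≔ y
      bump₁ zero    x y (_ ∷ _ ∷ v) = refl
      bump₁ (suc k) x y (a ∷ v)     = cong (a ∷_) (bump₁ k x y v)

      bump₂ : ∀ {m} (k : Fin m) x y (v : Exponent (suc m)) →
              (v [ inject₁ k ]≔ x [ suc k ]≔ y) [ suc k ]%= suc ≡ v [ inject₁ k ]≔ x [ suc k ]≔ suc y
      bump₂ zero    x y (_ ∷ _ ∷ v) = refl
      bump₂ (suc k) x y (a ∷ v)     = cong (a ∷_) (bump₂ k x y v)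

      replace-id : ∀ {m} (k : Fin m) (v : Exponent (suc m)) →
                   v [ inject₁ k ]≔ Vec.lookup v (inject₁ k) [ suc k ]≔ Vec.lookup v (suc k) ≡ v
      replace-id zero    (_ ∷ _ ∷ v) = refl
      replace-id (suc k) (a ∷ v)     = cong (a ∷_) (replace-id k v)

      1*1#δ : ∀ w w′ → w ≡ w′ → (1# * 1#) #δ w ≈ 1# #δ w′
      1*1#δ w .w refl with does (Vec.≡-dec ℕ._≟_ β w)
      ... | true  = *-identityˡ 1#
      ... | false = ≈refl

      D-monomial : ∀ x y → D [ replace k x y v ] ≈ φ (suc x) y - φ x (suc y)
      D-monomial x y = +-cong
        (+-congʳ (1*1#δ _ _ (bump₁ k x y v)))
        (-‿cong (+-congʳ (1*1#δ _ _ (bump₂ k x y v))))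

      D-geometric : ∀ x y → y ≤ x → D (geometric k v x y) ≈ φ x y - φ y x
      D-geometric x y y≤x = ≈trans
        (telescope (x ∸ y) _ (λ j → φ (y ℕ.+ j) (x ∸ j)) step)
        (reflexive (cong₂ _-_
          (cong₂ φ (ℕ.m+[n∸m]≡n y≤x) (ℕ.m∸[m∸n]≡n y≤x))
          (cong (λ z → φ z x) (ℕ.+-identityʳ y))))
        where
        step : ∀ j → j < x ∸ y →
               D [ replace k (y ℕ.+ j) (x ∸ 1 ∸ j) v ] ≈ φ (y ℕ.+ suc j) (x ∸ suc j) - φ (y ℕ.+ j) (x ∸ j)
        step j j<x∸y = ≈trans (D-monomial _ _) (reflexive (cong₂ _-_
          (cong₂ φ (sym (ℕ.+-suc y j)) (ℕ.∸-+-assoc x 1 j))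
          (cong (φ (y ℕ.+ j)) (trans (cong suc (ℕ.∸-+-assoc x 1 j))
            (sym (ℕ.+-∸-assoc 1 (ℕ.<-≤-trans j<x∸y (ℕ.m∸n≤m x y))))))))

      D-geometric-≥ : ∀ x y → x ≤ y → D (geometric k v x y) ≈ 0#
      D-geometric-≥ x y x≤y rewrite ℕ.m≤n⇒m∸n≡0 x≤y = -‿inverseʳ 0#

      D-∂ : D (∂ k v) ≈ coeff β [ v ] - coeff β [ swap k v ]
      D-∂ = begin
        D (∂ k v)                                            ≈⟨ D-⊕ (geometric k v a b) (- 1# • geometric k v b a) ⟩
        D (geometric k v a b) + D (- 1# • geometric k v b a) ≈⟨ +-congˡ (D-neg (geometric k v b a)) ⟩
        D (geometric k v a b) - D (geometric k v b a)        ≈⟨ cases (ℕ.≤-total b a) ⟩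
        φ a b - φ b a                                        ≈⟨ reflexive (cong (λ w → coeff β [ w ] - φ b a) (replace-id k v)) ⟩
        coeff β [ v ] - φ b a                                ∎
        where
        a = Vec.lookup v (inject₁ k)
        b = Vec.lookup v (suc k)
        cases : b ≤ a ⊎ a ≤ b → D (geometric k v a b) - D (geometric k v b a) ≈ φ a b - φ b a
        cases (inj₁ b≤a) = ≈trans
          (+-cong (D-geometric a b b≤a) (≈trans (-‿cong (D-geometric-≥ b a b≤a)) -0#≈0#))
          (+-identityʳ _)
        cases (inj₂ a≤b) = ≈trans
          (+-cong (D-geometric-≥ a b a≤b) (-‿cong (D-geometric b a a≤b)))
          (≈trans (+-identityˡ _) (⁻¹-anti-homo‿- _ _))

      correct : coeff β (multiplyByX (inject₁ k) (∂ k v) ⊕ (- 1# • multiplyByX (suc k) (∂ k v)))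
                ≈ coeff β ([ v ] ⊕ (- 1# • [ swap k v ]))
      correct = begin
        _                                    ≈⟨ coeff-⊕ (multiplyByX (inject₁ k) (∂ k v)) _ ⟩
        _                                    ≈⟨ +-congˡ (coeff-neg (multiplyByX (suc k) (∂ k v))) ⟩
        D (∂ k v)                            ≈⟨ D-∂ ⟩
        coeff β [ v ] - coeff β [ swap k v ] ≈⟨ +-congˡ (coeff-neg [ swap k v ]) ⟨
        _                                    ≈⟨ coeff-⊕ [ v ] (- 1# • [ swap k v ]) ⟨
        _                                    ∎

  ∂-correct : ∀ k v →
    multiplyByX (inject₁ k) (∂ k v) ⊕ (- 1# • multiplyByX (suc k) (∂ k v))
      ≋ [ v ] ⊕ (- 1# • [ swap k v ])
  ∂-correct = Verification.correct

------------------------------------------------------------------------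
-- Vector-valued Macdonald polynomials

-- N = n + 2.  The index k : Fin (suc n) of T_k stands for k + 1 ∈ {1 , … , N - 1}.

module VectorValuedMacdonald {c ℓ₁ ℓ₂ : Level} (K : RationalFunctionField c ℓ₁ ℓ₂)
                             {n : ℕ} (κ : Partition (suc (suc n))) where

  open RationalFunctionField K public
  open FormalSums commutativeRing public
  open Polynomials commutativeRing {suc n}
  open Tableaux κ public

  N : ℕ
  N = suc (suc n)

  V : Set c
  V = FormalSum Tableau

  -- With a and b the two coefficients of the case "k in a higher row than
  -- k + 1", applied to T′ = T^{(k,k+1)} (so T′ T_k = a T′ + b T), the quadratic
  -- relation gives  T T_k = (s - 1 - a) T + b⁻¹ (1 + a) (s - a) T′  in the last
  -- case, and b = (1 + a) (s - a).
  T-basis : Fin (suc n) → Tableau → V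
  T-basis k T with row (cell T (inject₁ k)) ℕ.≟ row (cell T (suc k))
  ... | yes _ = s • [ T ]
  ... | no ¬row with col (cell T (inject₁ k)) ℕ.≟ col (cell T (suc k))
  ...   | yes _ = - 1# • [ T ]
  ...   | no ¬col =
    if does (row (cell T (suc k)) ℕ.<? row (cell T (inject₁ k)))
    then a • [ T ] ⊕ b • [ T′ ]
    else (s - 1# - a) • [ T ] ⊕ [ T′ ]
    where
    T′ = exchange κ T k ¬row ¬col
    m  = contentGap κ T k
    instance
      _ : NonZero m
      _ = contentGap-nonZero κ T k ¬row
    a = (s - 1#) /1-s^ m
    b = s * (1# - s ^ suc m) * (1# - s ^ pred m) /1-s^ m /1-s^ m

  -- The inverses T_k⁻¹ and 𝐓_k⁻¹ are read off the quadratic relation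
  -- (T_k + 1) (T_k - s) = 0.
  T⟨_⟩ T⁻¹⟨_⟩ : Fin (suc n) → V → V
  T⟨ k ⟩   = linear (T-basis k)
  T⁻¹⟨ k ⟩ u = s⁻¹ • (T⟨ k ⟩ u ⊕ (1# - s) • u)

  M : Set c
  M = FormalSum (Exponent N × Tableau)

  open Equality (×-decSetoid exponents tableaux) public

  𝐓⟨_⟩ 𝐓⁻¹⟨_⟩ : Fin (suc n) → M → M
  𝐓⟨ k ⟩ = linear λ (v , T) →
    ((1# - s) • multiplyByX (suc k) (∂ k v)) ⊗ [ T ] ⊕ [ swap k v ] ⊗ T⟨ k ⟩ [ T ]
  𝐓⁻¹⟨ k ⟩ P = s⁻¹ • (𝐓⟨ k ⟩ P ⊕ (1# - s) • P)

  -- The right action of a product of operators: the first one is applied first.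
  applyAll : ∀ {X : Set c} → (Fin (suc n) → X → X) → Word (suc n) → X → X
  applyAll f w x = foldl (λ y k → f k y) x w

  -- p (q x_N , x₁ , … , x_{N-1}) sends x^v to q^{v₁} x^{(v₂ , … , v_N , v₁)}.
  𝐰 : M → M
  𝐰 = linear λ where
    (v₁ ∷ v , T) → q ^ v₁ • [ v ∷ʳ v₁ ] ⊗ applyAll T⟨_⟩ (allFin (suc n)) [ T ]

  -- The index i : Fin N stands for i + 1 ∈ {1 , … , N}.
  Ξ : Fin N → M → M
  Ξ i P = (s^ℤ (suc (toℕ i) ⊖ N)) •
    applyAll 𝐓⟨_⟩ (reverse (filter (λ k → toℕ i ℕ.≤? toℕ k) (allFin (suc n))))
      (𝐰 (applyAll 𝐓⁻¹⟨_⟩ (reverse (filter (λ k → toℕ k ℕ.<? toℕ i) (allFin (suc n)))) P))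

  -- The spectral vectors of distinct pairs (v , T) differ, so this determines P
  -- up to a nonzero constant multiple.
  record IsMacdonald (v : Exponent N) (T : Tableau) (P : M) : Set (c ⊔ ℓ₁ ⊔ ℓ₂) where
    field
      nonzero       : ∃[ b ] coeff b P # 0#
      eigenfunction : ∀ i → Ξ i P ≋ (q ^ Vec.lookup v i * (s^ℤ CT T (r v i))) • P

  -- u R_v for a reduced word r_v = s_{i₁} ⋯ s_{iₖ}, i.e. u T_{iₖ}⁻¹ ⋯ T_{i₁}⁻¹.  By
  -- the braid relations it does not depend on the choice of reduced word.
  R⟨_⟩ : Word (suc n) → V → V
  R⟨ w ⟩ = applyAll T⁻¹⟨_⟩ (reverse w)

{-# OPTIONS --safe #-}
-- Everything is transposed: an operator on formal sums becomes an operator on functions of the basis, and a tableau is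
-- replaced by its vector of contents, which determines it.  There T_k is a two-term operator with entries depending on
-- two contents only, so the Hecke relations become identities of rational functions, and the Jucys–Murphy elements are
-- the diagonal operators s^{CT[i]}.
--
-- Ξ_i is triangular for ◁: on x^v ⊗ u its leading term is q^{v_i} x^v ⊗ u L for a product L of T_k's and their inverses.
-- If v_k < v_{k+1} then L_{v,i} T_k = T_k L_{v s_k , i s_k}, so sorting v along a reduced word of r_v gives
-- R_v L_{v,i} = ω_{r_v[i]} R_v with ω the Jucys–Murphy elements.  In the eigenvalue equation for P, a block (v′ , T′)
-- with another spectral vector than (v , T) can be nonzero only if a block above it is.  Climbing in the finite support
-- of P from a nonzero coefficient therefore ends at v, which shows both that all other blocks lie below v and that the
-- coefficient of x^v ⊗ T R_v is nonzero.  Climbing, rather than choosing a maximal block, avoids deciding equality in K.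

module Submission where

open import Defs
open import Algebra.Apartness.Bundles using (HeytingField)
import Algebra.Apartness.Properties.HeytingCommutativeRing as HeytingProperties
open import Algebra.Bundles using (CommutativeRing; Monoid; RawRing)
open import Algebra.Morphism.Structures using (IsRingHomomorphism)
import Algebra.Solver.Ring as RingSolver
open import Algebra.Solver.Ring.AlmostCommutativeRing using (fromCommutativeRing; _-Raw-AlmostCommutative⟶_)
open import Data.Bool.Base using (Bool; true; false; if_then_else_)
open import Data.Empty using (⊥-elim)
open import Data.Fin.Base as Fin using (Fin; zero; suc; toℕ; inject₁; fromℕ; fromℕ<)
open import Data.Fin.Induction using (>-weakInduction; >-wellFounded; spo-noetherian)
import Data.Fin.Properties as Fin
open import Data.Fin.Relation.Unary.Top using (view; ‵fromℕ; ‵inject₁)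
open import Data.Integer.Base as ℤ using (ℤ; +_; -[1+_]; _⊖_; ∣_∣)
import Data.Integer.Properties as ℤ
import Data.Integer.Tactic.RingSolver as ℤ
open import Data.List.Base as List
  using (List; []; _∷_; foldr; map; filter; deduplicate; length; take; reverse; allFin; applyUpTo)
import Data.List.Membership.DecPropositional as DecMembership
open import Data.List.Membership.Propositional using (_∈_; _∉_)
open import Data.List.Membership.Propositional.Properties
  using (∈-allFin; ∈-map⁺; ∈-filter⁺; ∈-filter⁻; ∈-deduplicate⁺; ∈-deduplicate⁻)
import Data.List.Properties as List
open import Data.List.Relation.Binary.Permutation.Propositional using (_↭_)
import Data.List.Relation.Binary.Permutation.Propositional.Properties as ↭
open import Data.List.Relation.Unary.All as All using (All; []; _∷_)
import Data.List.Relation.Unary.AllPairs as AllPairs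
open import Data.List.Relation.Unary.Any as Any using (here; there)
import Data.List.Relation.Unary.Any.Properties as Any
open import Data.List.Relation.Unary.Linked using (Linked; []; [-]; _∷_)
import Data.List.Relation.Unary.Unique.DecPropositional.Properties as Unique
open import Data.List.Relation.Unary.Unique.Propositional using (Unique)
import Data.List.Sort as Sort
open import Data.Maybe.Base using (Maybe; just; nothing)
open import Data.Nat.Base as ℕ using (ℕ; zero; suc; s≤s; z≤n; NonZero; pred; _∸_; _≥_)
open import Data.Nat.Induction using (<-wellFounded)
open import Data.Nat.ListAction using (sum)
open import Data.Nat.ListAction.Properties using (sum-↭)
import Data.Nat.Properties as ℕ
import Data.Nat.Tactic.RingSolver as ℕ
open import Data.Product.Base using (Σ-syntax; ∃-syntax; ∃₂; _×_; _,_; proj₁; proj₂)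
import Data.Product.Properties as Product
open import Data.Product.Relation.Binary.Pointwise.NonDependent using (×-decSetoid)
open import Data.Sum.Base using (_⊎_; inj₁; inj₂)
open import Data.Vec.Base as Vec
  using (Vec; []; _∷_; toList; lookup; insertAt; removeAt; _[_]≔_; _[_]%=_)
import Data.Vec.Properties as Vec
open import Function.Base using (_∘_; id; flip)
open import Function.Bundles using (Inverse)
open import Induction.WellFounded using (Acc; acc; WellFounded)
open import Level using (Level; _⊔_)
open import Relation.Binary.Bundles using (DecSetoid)
import Relation.Binary.Construct.Flip.EqAndOrd as Flip
open import Relation.Binary.Definitions using (Tri; tri<; tri≈; tri>)
open import Relation.Binary.PropositionalEquality as ≡
  using (_≡_; _≢_; cong; cong₂; subst; subst₂)
import Relation.Binary.PropositionalEquality.Properties as ≡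
import Relation.Binary.Reasoning.Setoid as SetoidReasoning
open import Relation.Nullary using (¬_; Dec; yes; no; does; ofʸ; ofⁿ; contradiction)
open import Relation.Nullary.Decidable using (_×-dec_; _⊎-dec_; ¬?; map′; dec-true; dec-false)

-- Formal sums are lists with many representatives, and equality in K cannot be decided. A
-- functional is an ordinary function on the basis, so after transposition operator identities are
-- pointwise equations in K, and formal sums reappear only through `pair`. Triangularity takes a
-- dual form: a functional that vanishes on all blocks below v sees nothing of Ξ_i (x^v ⊗ u) but its
-- leading term. Neither 𝐓_k nor 𝐰 is triangular for ◁ on its own. What is followed through the word
-- Ξ_i is a single entry of v, carried from position i to 1, moved by 𝐰 to N and carried back to i;
-- only the exponent reached at the end is compared with v. The letter left on V_λ depends on how
-- the carried entry compares with each entry it passes, ties counting differently in the two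
-- halves, and this is what lets L_{v,i} pass through a sorting step. Spectral vectors are separated
-- in two ways. If v′ differs from v, some power of q differs whatever the contents are. In the
-- block of v itself some content differs, and climbing from there is impossible because no nonzero
-- block lies above v.

-- Differences of natural numbers as solver coefficients: unlike the elements of R, their equality is decidable.
module DifferenceSolver {c ℓ : Level} (R : CommutativeRing c ℓ) where

  open CommutativeRing R
  open import Algebra.Properties.Semiring.Mult semiring renaming (_×_ to _·_; ×-homo-+ to ·-homo-+; ×1-homo-* to ·1-homo-*)
  open import Algebra.Properties.Ring ring using (-‿distribˡ-*; -‿distribʳ-*; -0#≈0#; -‿involutive)
  open import Algebra.Properties.AbelianGroup +-abelianGroup using (⁻¹-∙-comm; ⁻¹-anti-homo‿-)
  open import Algebra.Properties.CommutativeSemigroup +-commutativeSemigroup using (interchange)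
  open SetoidReasoning setoid

  private

    -- Each integer has one reduced representative, so sums and products equal to 0 or 1 land on the
    -- special clauses of `⟦_⟧`.
    reduce : ℕ → ℕ → ℕ × ℕ
    reduce a b = a ℕ.∸ b , b ℕ.∸ a

    rawDifferences : RawRing _ _
    rawDifferences = record
      { Carrier = ℕ × ℕ
      ; _≈_ = _≡_
      ; _+_ = λ (a , b) (a′ , b′) → reduce (a ℕ.+ a′) (b ℕ.+ b′)
      ; _*_ = λ (a , b) (a′ , b′) → reduce (a ℕ.* a′ ℕ.+ b ℕ.* b′) (a ℕ.* b′ ℕ.+ b ℕ.* a′)
      ; -_ = λ (a , b) → b , a
      ; 0# = 0 , 0
      ; 1# = 1 , 0
      }

    -- Chosen so that (0 , 0) and (1 , 0) denote 0# and 1# on the nose.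
    ⟦_⟧ : ℕ × ℕ → Carrier
    ⟦ 0 , 0 ⟧ = 0#
    ⟦ 1 , 0 ⟧ = 1#
    ⟦ a , b ⟧ = a · 1# - b · 1#

    ⟦⟧-difference : ∀ a b → ⟦ a , b ⟧ ≈ a · 1# - b · 1#
    ⟦⟧-difference 0             0       = sym (-‿inverseʳ 0#)
    ⟦⟧-difference 1             0       = sym (trans (+-cong (+-identityʳ 1#) -0#≈0#) (+-identityʳ 1#))
    ⟦⟧-difference (suc (suc a)) 0       = refl
    ⟦⟧-difference 0             (suc b) = refl
    ⟦⟧-difference 1             (suc b) = refl
    ⟦⟧-difference (suc (suc a)) (suc b) = refl

    minus-+ : ∀ w x y z → (w - x) + (y - z) ≈ (w + y) - (x + z)
    minus-+ w x y z = trans (interchange w (- x) y (- z)) (+-congˡ (⁻¹-∙-comm x z))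

    reduce-difference : ∀ a b → ⟦ reduce a b ⟧ ≈ a · 1# - b · 1#
    reduce-difference zero    zero    = ⟦⟧-difference 0 0
    reduce-difference zero    (suc b) = ⟦⟧-difference 0 (suc b)
    reduce-difference (suc a) zero    = ⟦⟧-difference (suc a) 0
    reduce-difference (suc a) (suc b) = begin
      ⟦ reduce a b ⟧                       ≈⟨ reduce-difference a b ⟩
      a · 1# - b · 1#                      ≈⟨ +-identityˡ _ ⟨
      0# + (a · 1# - b · 1#)               ≈⟨ +-congʳ (-‿inverseʳ 1#) ⟨
      (1# - 1#) + (a · 1# - b · 1#)        ≈⟨ minus-+ _ _ _ _ ⟩
      (1# + a · 1#) - (1# + b · 1#)        ∎

    minus-* : ∀ w x y z → (w - x) * (y - z) ≈ (w * y + x * z) - (w * z + x * y)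
    minus-* w x y z = begin
      (w - x) * (y - z)                          ≈⟨ distribʳ _ _ _ ⟩
      w * (y - z) + - x * (y - z)                ≈⟨ +-cong (distribˡ _ _ _) (distribˡ _ _ _) ⟩
      (w * y + w * - z) + (- x * y + - x * - z)  ≈⟨ +-cong (+-congˡ (-‿distribʳ-* w z)) (+-cong (-‿distribˡ-* x y) neg*neg) ⟨
      (w * y - w * z) + (- (x * y) + x * z)      ≈⟨ +-congˡ (+-comm _ _) ⟩
      (w * y - w * z) + (x * z - x * y)          ≈⟨ minus-+ _ _ _ _ ⟩
      (w * y + x * z) - (w * z + x * y)          ∎
      where
      neg*neg : x * z ≈ - x * - z
      neg*neg = sym (trans (sym (-‿distribˡ-* x (- z))) (trans (-‿cong (sym (-‿distribʳ-* x z))) (-‿involutive _)))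

    morphism : rawDifferences -Raw-AlmostCommutative⟶ fromCommutativeRing R
    morphism = record
      { ⟦_⟧    = ⟦_⟧
      ; +-homo = λ (a , b) (a′ , b′) → begin
          ⟦ reduce (a ℕ.+ a′) (b ℕ.+ b′) ⟧                    ≈⟨ reduce-difference (a ℕ.+ a′) (b ℕ.+ b′) ⟩
          (a ℕ.+ a′) · 1# - (b ℕ.+ b′) · 1#                   ≈⟨ +-cong (·-homo-+ 1# a a′) (-‿cong (·-homo-+ 1# b b′)) ⟩
          (a · 1# + a′ · 1#) - (b · 1# + b′ · 1#)             ≈⟨ minus-+ _ _ _ _ ⟨
          (a · 1# - b · 1#) + (a′ · 1# - b′ · 1#)             ≈⟨ +-cong (⟦⟧-difference a b) (⟦⟧-difference a′ b′) ⟨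
          ⟦ a , b ⟧ + ⟦ a′ , b′ ⟧                             ∎
      ; *-homo = λ (a , b) (a′ , b′) → begin
          ⟦ reduce (a ℕ.* a′ ℕ.+ b ℕ.* b′) (a ℕ.* b′ ℕ.+ b ℕ.* a′) ⟧
            ≈⟨ reduce-difference (a ℕ.* a′ ℕ.+ b ℕ.* b′) (a ℕ.* b′ ℕ.+ b ℕ.* a′) ⟩
          (a ℕ.* a′ ℕ.+ b ℕ.* b′) · 1# - (a ℕ.* b′ ℕ.+ b ℕ.* a′) · 1#
            ≈⟨ +-cong (trans (·-homo-+ 1# (a ℕ.* a′) _) (+-cong (·1-homo-* a a′) (·1-homo-* b b′)))
                 (-‿cong (trans (·-homo-+ 1# (a ℕ.* b′) _) (+-cong (·1-homo-* a b′) (·1-homo-* b a′)))) ⟩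
          (a · 1# * (a′ · 1#) + b · 1# * (b′ · 1#)) - (a · 1# * (b′ · 1#) + b · 1# * (a′ · 1#))
                                                              ≈⟨ minus-* _ _ _ _ ⟨
          (a · 1# - b · 1#) * (a′ · 1# - b′ · 1#)             ≈⟨ *-cong (⟦⟧-difference a b) (⟦⟧-difference a′ b′) ⟨
          ⟦ a , b ⟧ * ⟦ a′ , b′ ⟧                             ∎
      ; -‿homo = λ (a , b) →
          trans (⟦⟧-difference b a) (trans (sym (⁻¹-anti-homo‿- _ _)) (-‿cong (sym (⟦⟧-difference a b))))
      ; 0-homo = refl
      ; 1-homo = refl
      }

    x-y≈z-w : ∀ {x y z w} → x + w ≈ z + y → x - y ≈ z - w
    x-y≈z-w {x} {y} {z} {w} eq = begin
      x - y              ≈⟨ +-identityʳ _ ⟨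
      (x - y) + 0#       ≈⟨ +-congˡ (-‿inverseʳ w) ⟨
      (x - y) + (w - w)  ≈⟨ minus-+ _ _ _ _ ⟩
      (x + w) - (y + w)  ≈⟨ +-cong eq (-‿cong (+-comm y w)) ⟩
      (z + y) - (w + y)  ≈⟨ minus-+ _ _ _ _ ⟨
      (z - w) + (y - y)  ≈⟨ +-congˡ (-‿inverseʳ y) ⟩
      (z - w) + 0#       ≈⟨ +-identityʳ _ ⟩
      z - w              ∎

    _≟_ : ∀ x y → Maybe (⟦ x ⟧ ≈ ⟦ y ⟧)
    (a , b) ≟ (a′ , b′) with a ℕ.+ b′ ℕ.≟ a′ ℕ.+ b
    ... | no _   = nothing
    ... | yes eq = just (trans (⟦⟧-difference a b) (trans
      (x-y≈z-w (trans (sym (·-homo-+ 1# a b′)) (trans (reflexive (≡.cong (_· 1#) eq)) (·-homo-+ 1# a′ b))))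
      (sym (⟦⟧-difference a′ b′))))

  private module Solver = RingSolver rawDifferences (fromCommutativeRing R) morphism _≟_

  open Solver public using (solve; _:=_; _:+_; _:*_; _:-_; :-_)

  :0 :1 : ∀ {n} → Solver.Polynomial n
  :0 = Solver.con (0 , 0)
  :1 = Solver.con (1 , 0)

-- Apartness in a Heyting field

module FieldProperties {c ℓ₁ ℓ₂ : Level} (F : HeytingField c ℓ₁ ℓ₂) where

  open HeytingField F
  open HeytingRing F using (commutativeRing)
  open DifferenceSolver commutativeRing
  open SetoidReasoning setoid

  module P = HeytingProperties heytingCommutativeRing

  leftInverse⇒#0 : ∀ {x} y → y * x ≈ 1# → x # 0#
  leftInverse⇒#0 y eq = P.invertibleˡ⇒# (y , trans (*-congˡ (P.x-0≈x _)) eq)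

  #0⇒leftInverse : ∀ {x} → x # 0# → ∃[ y ] y * x ≈ 1#
  #0⇒leftInverse x#0 with #⇒invertible x#0
  ... | y , eq , _ = y , trans (*-congˡ (sym (P.x-0≈x _))) eq

  *#0ˡ : ∀ {x y} → x * y # 0# → x # 0#
  *#0ˡ {x} {y} xy#0 with #0⇒leftInverse xy#0
  ... | z , eq = leftInverse⇒#0 (z * y) (trans (trans (*-assoc _ _ _) (*-congˡ (*-comm _ _))) eq)

  *#0ʳ : ∀ {x y} → x * y # 0# → y # 0#
  *#0ʳ xy#0 = *#0ˡ (P.#-congʳ (*-comm _ _) xy#0)

  #⇒-#0 : ∀ {x y} → x # y → x - y # 0#
  #⇒-#0 x#y with #⇒invertible x#y
  ... | z , eq , _ = leftInverse⇒#0 z eq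

  -- Cotransitivity at `y`: either `x + y` is apart from `y`, or `y` is apart from zero. This finds
  -- a nonzero summand without deciding equality.
  +#0 : ∀ {x y} → x + y # 0# → x # 0# ⊎ y # 0#
  +#0 {x} {y} x+y#0 with #-cotrans x+y#0 y
  ... | inj₂ y#0   = inj₂ y#0
  ... | inj₁ x+y#y = inj₁ (P.#-congʳ (solve 2 (λ x y → x :+ y :- y := x) refl x y) (#⇒-#0 x+y#y))

  ≈⇒¬# : ∀ {x y} → x ≈ y → ¬ x # y
  ≈⇒¬# = #-irrefl

  ¬#⇒≈ : ∀ {x y} → ¬ x # y → x ≈ y
  ¬#⇒≈ {x} {y} = proj₁ (tight x y)

  *-cancelˡ : ∀ {x y z} → x # 0# → x * y ≈ x * z → y ≈ z
  *-cancelˡ {x} {y} {z} x#0 eq with #0⇒leftInverse x#0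
  ... | u , ux = begin
    y           ≈⟨ *-identityˡ y ⟨
    1# * y      ≈⟨ *-congʳ ux ⟨
    u * x * y   ≈⟨ *-assoc _ _ _ ⟩
    u * (x * y) ≈⟨ *-congˡ eq ⟩
    u * (x * z) ≈⟨ *-assoc _ _ _ ⟨
    u * x * z   ≈⟨ *-congʳ ux ⟩
    1# * z      ≈⟨ *-identityˡ z ⟩
    z           ∎

-- Linear functionals on formal sums

module Pairing {c ℓ₁ ℓ₂ : Level} (F : HeytingField c ℓ₁ ℓ₂) where

  open HeytingField F
  open HeytingRing F using (commutativeRing)
  open FormalSums commutativeRing
  open FieldProperties F
  open DifferenceSolver commutativeRing
  open SetoidReasoning setoid

  -- The linear extension of `f` to formal sums, and the only access to formal sums that the
  -- operator calculus uses.
  pair : ∀ {a} {A : Set a} → (A → Carrier) → FormalSum A → Carrier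
  pair f []            = 0#
  pair f ((k , a) ∷ x) = k * f a + pair f x

  module _ {a} {A : Set a} where

    pair-cong : {f g : A → Carrier} → (∀ b → f b ≈ g b) → ∀ x → pair f x ≈ pair g x
    pair-cong eq []            = refl
    pair-cong eq ((k , b) ∷ x) = +-cong (*-congˡ (eq b)) (pair-cong eq x)

    pair-⊕ : (f : A → Carrier) → ∀ x y → pair f (x ⊕ y) ≈ pair f x + pair f y
    pair-⊕ f []            y = sym (+-identityˡ _)
    pair-⊕ f ((k , b) ∷ x) y = trans (+-congˡ (pair-⊕ f x y)) (sym (+-assoc _ _ _))

    pair-• : (f : A → Carrier) → ∀ k x → pair f (k • x) ≈ k * pair f x
    pair-• f k []            = sym (zeroʳ k)
    pair-• f k ((l , b) ∷ x) = trans (+-cong (*-assoc k l (f b)) (pair-• f k x)) (sym (distribˡ k _ _))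

    pair-[] : (f : A → Carrier) → ∀ b → pair f [ b ] ≈ f b
    pair-[] f b = trans (+-identityʳ _) (*-identityˡ _)

    pair-+ : (f g : A → Carrier) → ∀ x → pair (λ b → f b + g b) x ≈ pair f x + pair g x
    pair-+ f g []            = sym (+-identityˡ _)
    pair-+ f g ((k , b) ∷ x) = trans (+-congˡ (pair-+ f g x))
      (solve 5 (λ k u v w z → k :* (u :+ v) :+ (w :+ z) := (k :* u :+ w) :+ (k :* v :+ z)) refl k (f b) (g b) _ _)

    pair-* : ∀ l (f : A → Carrier) x → pair (λ b → l * f b) x ≈ l * pair f x
    pair-* l f []            = sym (zeroʳ l)
    pair-* l f ((k , b) ∷ x) = trans (+-congˡ (pair-* l f x))
      (solve 4 (λ k l u v → k :* (l :* u) :+ l :* v := l :* (k :* u :+ v)) refl k l (f b) _)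

    pair-0 : {f : A → Carrier} → (∀ b → f b ≈ 0#) → ∀ x → pair f x ≈ 0#
    pair-0 eq x = trans (pair-cong {g = λ _ → 0# * 0#} (λ b → trans (eq b) (sym (zeroˡ _))) x)
      (trans (pair-* 0# (λ _ → 0#) x) (zeroˡ _))

  pair-linear : ∀ {a b} {A : Set a} {B : Set b} (f : B → Carrier) (g : A → FormalSum B) x →
                pair f (linear g x) ≈ pair (λ a → pair f (g a)) x
  pair-linear f g []            = refl
  pair-linear f g ((k , a) ∷ x) =
    trans (pair-⊕ f (k • g a) (linear g x)) (+-cong (pair-• f k (g a)) (pair-linear f g x))

  pair-⊗ : ∀ {a b} {A : Set a} {B : Set b} (f : A × B → Carrier) (x : FormalSum A) (y : FormalSum B) →
           pair f (x ⊗ y) ≈ pair (λ a → pair (λ b → f (a , b)) y) x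
  pair-⊗ f x y = trans (pair-linear f _ x) (pair-cong (λ a →
    trans (pair-linear f (λ b → [ a , b ]) y) (pair-cong (λ b → pair-[] f (a , b)) y)) x)

  module Coefficients {a ℓ′} (basis : DecSetoid a ℓ′) where

    open DecSetoid basis using (_≟_) renaming (Carrier to A; _≈_ to _~_; refl to ~refl; sym to ~sym; trans to ~trans)
    open Equality basis

    δ : A → A → Carrier
    δ b a = if does (b ≟ a) then 1# else 0#

    δ-yes : ∀ {a b} → b ~ a → δ b a ≡ 1#
    δ-yes {a} {b} b~a with b ≟ a
    ... | yes _   = ≡.refl
    ... | no b≁a = ⊥-elim (b≁a b~a)

    δ-no : ∀ {a b} → ¬ b ~ a → δ b a ≡ 0#
    δ-no {a} {b} b≁a with b ≟ a
    ... | yes b~a = ⊥-elim (b≁a b~a)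
    ... | no _     = ≡.refl

    δ-respects : ∀ b {a a′} → a ~ a′ → δ b a ≈ δ b a′
    δ-respects b {a} {a′} a~a′ with b ≟ a | b ≟ a′
    ... | yes _ | yes _ = refl
    ... | no _  | no _  = refl
    ... | yes p | no ¬p = ⊥-elim (¬p (~trans p a~a′))
    ... | no ¬p | yes p = ⊥-elim (¬p (~trans p (~sym a~a′)))

    coeff≈pair : ∀ b x → coeff b x ≈ pair (δ b) x
    coeff≈pair b []            = refl
    coeff≈pair b ((k , a) ∷ x) with does (b ≟ a)
    ... | true  = +-cong (sym (*-identityʳ k)) (coeff≈pair b x)
    ... | false = +-cong (sym (zeroʳ k)) (coeff≈pair b x)

    private

      remove : A → FormalSum A → FormalSum A
      remove a = filter (λ t → ¬? (a ≟ proj₂ t))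

      ∈-remove : ∀ {b} a x → b ∈ map proj₂ (remove a x) → b ∈ map proj₂ x
      ∈-remove a ((k , b) ∷ x) b∈ with a ≟ b
      ∈-remove a ((k , b) ∷ x) b∈          | yes _ = there (∈-remove a x b∈)
      ∈-remove a ((k , b) ∷ x) (here eq)   | no _  = here eq
      ∈-remove a ((k , b) ∷ x) (there b∈)  | no _  = there (∈-remove a x b∈)

      remove-split : ∀ (f : A → Carrier) → (∀ {a b} → a ~ b → f a ≈ f b) →
                     ∀ a x → pair f x ≈ f a * coeff a x + pair f (remove a x)
      remove-split f resp a [] = solve 1 (λ u → :0 := u :* :0 :+ :0) refl (f a)
      remove-split f resp a ((k , b) ∷ x) with a ≟ b
      ... | yes a~b = trans (+-cong (*-congˡ (sym (resp a~b))) (remove-split f resp a x))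
        (solve 4 (λ k u v w → k :* u :+ (u :* v :+ w) := u :* (k :+ v) :+ w) refl k (f a) _ _)
      ... | no _    = trans (+-congˡ (remove-split f resp a x))
        (solve 5 (λ k l u v w → k :* l :+ (u :* v :+ w) := u :* (:0 :+ v) :+ (k :* l :+ w)) refl k (f b) (f a) _ _)

      coeff-remove-~ : ∀ {a b} x → a ~ b → coeff b (remove a x) ≈ 0#
      coeff-remove-~ []            a~b = refl
      coeff-remove-~ {a} {b} ((k , d) ∷ x) a~b with a ≟ d
      ... | yes _  = coeff-remove-~ x a~b
      ... | no a≁d with b ≟ d
      ...   | yes b~d = ⊥-elim (a≁d (~trans a~b b~d))
      ...   | no _    = trans (+-identityˡ _) (coeff-remove-~ x a~b)

      coeff-remove-≁ : ∀ {a b} x → ¬ a ~ b → coeff b (remove a x) ≈ coeff b x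
      coeff-remove-≁ []            a≁b = refl
      coeff-remove-≁ {a} {b} ((k , d) ∷ x) a≁b with a ≟ d
      ... | no _    = +-congˡ (coeff-remove-≁ x a≁b)
      ... | yes a~d with b ≟ d
      ...   | yes b~d = ⊥-elim (a≁b (~trans a~d (~sym b~d)))
      ...   | no _    = trans (coeff-remove-≁ x a≁b) (sym (+-identityˡ _))

      -- The terms in the class of the first basis element contribute `f a * coeff a x`; the rest is
      -- a shorter sum, which `n` bounds. Apartness passes to one of the two parts. A `b` found in
      -- the rest is not in the class of `a`, because those coefficients have been removed, so its
      -- coefficient is the one in `x`.
      search : ∀ n x → length x ℕ.≤ n → (f : A → Carrier) → (∀ {a b} → a ~ b → f a ≈ f b) →
               pair f x # 0# → ∃[ b ] f b # 0# × coeff b x # 0# × b ∈ map proj₂ x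
      search n       []            _           f resp x#0 = ⊥-elim (≈⇒¬# refl x#0)
      search (suc n) x@((k , a) ∷ y) (s≤s len) f resp x#0
        with +#0 (P.#-congʳ (remove-split f resp a x) x#0)
      ... | inj₁ p = a , *#0ˡ p , *#0ʳ p , here ≡.refl
      ... | inj₂ p with search n (remove a y) (ℕ.≤-trans (List.length-filter _ y) len) f resp
        (P.#-congʳ (reflexive (≡.cong (pair f) remove-head)) p)
        where
        remove-head : remove a x ≡ remove a y
        remove-head with a ≟ a
        ... | yes _  = ≡.refl
        ... | no a≁a = ⊥-elim (a≁a ~refl)
      ... | b , fb#0 , coeff#0 , b∈ with a ≟ b
      ...   | yes a~b = ⊥-elim (≈⇒¬# (coeff-remove-~ y a~b) coeff#0)
      ...   | no a≁b  = b , fb#0 , P.#-congʳ (trans (coeff-remove-≁ y a≁b) head) coeff#0 , there (∈-remove a y b∈)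
        where
        head : coeff b y ≈ coeff b x
        head with b ≟ a
        ... | yes b~a = ⊥-elim (a≁b (~sym b~a))
        ... | no _    = sym (+-identityˡ _)

    pair#0⇒coeff#0 : ∀ x (f : A → Carrier) → (∀ {a b} → a ~ b → f a ≈ f b) →
                     pair f x # 0# → ∃[ b ] f b # 0# × coeff b x # 0# × b ∈ map proj₂ x
    pair#0⇒coeff#0 x = search _ x ℕ.≤-refl

    -- By tightness it suffices to refute apartness: if the two values were apart, the functional
    -- would be nonzero on `x - y`, and some coefficient of that difference would be nonzero.
    pair-≋ : ∀ x y (f : A → Carrier) → (∀ {a b} → a ~ b → f a ≈ f b) →
             x ≋ y → pair f x ≈ pair f y
    pair-≋ x y f resp x≋y = ¬#⇒≈ λ p → contradict (pair#0⇒coeff#0 (x ⊕ - 1# • y) f resp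
      (P.#-congʳ (sym (pair-difference f)) (#⇒-#0 p)))
      where
      pair-difference : ∀ g → pair g (x ⊕ - 1# • y) ≈ pair g x - pair g y
      pair-difference g = trans (pair-⊕ g x _) (trans (+-congˡ (pair-• g _ y))
        (solve 2 (λ u v → u :+ (:- :1) :* v := u :- v) refl _ _))
      contradict : ¬ (∃[ b ] f b # 0# × coeff b (x ⊕ - 1# • y) # 0# × b ∈ map proj₂ (x ⊕ - 1# • y))
      contradict (b , _ , p , _) = ≈⇒¬# (begin
        coeff b (x ⊕ - 1# • y)      ≈⟨ coeff≈pair b (x ⊕ - 1# • y) ⟩
        pair (δ b) (x ⊕ - 1# • y)   ≈⟨ pair-difference (δ b) ⟩
        pair (δ b) x - pair (δ b) y ≈⟨ +-cong (coeff≈pair b x) (-‿cong (coeff≈pair b y)) ⟨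
        coeff b x - coeff b y       ≈⟨ +-congʳ (x≋y b) ⟩
        coeff b y - coeff b y       ≈⟨ -‿inverseʳ _ ⟩
        0#                          ∎) p

swapAt : ∀ {a} {A : Set a} {m} → Fin m → Vec A (suc m) → Vec A (suc m)
swapAt k X = X [ inject₁ k ]≔ lookup X (suc k) [ suc k ]≔ lookup X (inject₁ k)

-- Powers of q and s, and the seminormal matrix entries

module Scalars {c ℓ₁ ℓ₂ : Level} (K : RationalFunctionField c ℓ₁ ℓ₂) where

  open RationalFunctionField K
  open CommutativeRing commutativeRing using (refl; sym; trans)
  open DifferenceSolver commutativeRing
  open FieldProperties heytingField
  open import Algebra.Properties.Semiring.Exp (CommutativeRing.semiring commutativeRing) using (^-homo-*)
  open SetoidReasoning setoid

  private
    module ℂ = ComplexNumbers ℂ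
    module ℂᶠ = FieldProperties ℂ.heytingField
    module ℂʳ = CommutativeRing ℂ.commutativeRing
    module H = IsRingHomomorphism constant-isHomomorphism
    open import Algebra.Properties.Ring (CommutativeRing.ring commutativeRing) using (-1*x≈-x)

  -- Algebraic independence for a two-term polynomial: since the exponents differ, the coefficient
  -- at `(a , c)` is 1.
  monomials-distinct : ∀ {a c b d} → (a , c) ≢ (b , d) → q ^ a * s ^ c - q ^ b * s ^ d # 0#
  monomials-distinct {a} {c} {b} {d} ne = P.#-congʳ eval≈ (algebraicallyIndependent f ((a , c) , coeff#0))
    where
    open FormalSums ℂ.commutativeRing using (module Equality)
    open Equality (≡.decSetoid (Product.≡-dec ℕ._≟_ ℕ._≟_)) using (coeff)
    f : Polynomial
    f = (ℂ.1# , a , c) ∷ (ℂ.- ℂ.1# , b , d) ∷ []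
    coeff#0 : coeff (a , c) f ℂ.# ℂ.0#
    coeff#0 with Product.≡-dec ℕ._≟_ ℕ._≟_ (a , c) (a , c) | Product.≡-dec ℕ._≟_ ℕ._≟_ (a , c) (b , d)
    ... | no ne′ | _      = ⊥-elim (ne′ ≡.refl)
    ... | yes _  | yes eq = ⊥-elim (ne eq)
    ... | yes _  | no _   = ℂᶠ.P.#-congʳ
      (ℂʳ.sym (ℂʳ.trans (ℂʳ.+-congˡ (ℂʳ.+-identityʳ _)) (ℂʳ.+-identityʳ _))) ℂᶠ.P.1#0
    eval≈ : eval f ≈ q ^ a * s ^ c - q ^ b * s ^ d
    eval≈ = +-cong
      (trans (*-congʳ H.1#-homo) (*-identityˡ _))
      (trans (+-identityʳ _)
        (trans (*-congʳ (trans (H.-‿homo _) (-‿cong H.1#-homo))) (-1*x≈-x _)))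

  s^m#0 : ∀ m → s ^ m # 0#
  s^m#0 zero    = P.1#0
  s^m#0 (suc m) = P.x#0y#0→xy#0 s#0 (s^m#0 m)

  s⁻¹*s : s⁻¹ * s ≈ 1#
  s⁻¹*s = inverse-correct s#0

  s⁻¹^m*s^m : ∀ m → s⁻¹ ^ m * s ^ m ≈ 1#
  s⁻¹^m*s^m zero    = *-identityˡ 1#
  s⁻¹^m*s^m (suc m) = begin
    (s⁻¹ * s⁻¹ ^ m) * (s * s ^ m)
      ≈⟨ solve 4 (λ a b c d → (a :* b) :* (c :* d) := (a :* c) :* (b :* d)) refl s⁻¹ (s⁻¹ ^ m) s (s ^ m) ⟩
    (s⁻¹ * s) * (s⁻¹ ^ m * s ^ m) ≈⟨ *-cong s⁻¹*s (s⁻¹^m*s^m m) ⟩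
    1# * 1#                       ≈⟨ *-identityˡ 1# ⟩
    1#                            ∎

  s^ℤ-⊖ : ∀ k m → s^ℤ (k ⊖ m) * s ^ m ≈ s ^ k
  s^ℤ-⊖ k       zero    = *-identityʳ _
  s^ℤ-⊖ zero    (suc m) = s⁻¹^m*s^m (suc m)
  s^ℤ-⊖ (suc k) (suc m) = begin
    s^ℤ (suc k ⊖ suc m) * (s * s ^ m) ≡⟨ ≡.cong (λ x → s^ℤ x * (s * s ^ m)) (ℤ.[1+m]⊖[1+n]≡m⊖n k m) ⟩
    s^ℤ (k ⊖ m) * (s * s ^ m)         ≈⟨ solve 3 (λ a b c → a :* (b :* c) := b :* (a :* c)) refl (s^ℤ (k ⊖ m)) s (s ^ m) ⟩
    s * (s^ℤ (k ⊖ m) * s ^ m)         ≈⟨ *-congˡ (s^ℤ-⊖ k m) ⟩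
    s * s ^ k                         ∎

  s^ℤ-+ : ∀ x m → s^ℤ (x ℤ.+ + m) ≈ s^ℤ x * s ^ m
  s^ℤ-+ (+ k)    m = ^-homo-* s k m
  s^ℤ-+ -[1+ k ] m = *-cancelˡ (s^m#0 (suc k)) (begin
    s ^ suc k * s^ℤ (m ⊖ suc k)     ≈⟨ *-comm _ _ ⟩
    s^ℤ (m ⊖ suc k) * s ^ suc k     ≈⟨ s^ℤ-⊖ m (suc k) ⟩
    s ^ m                           ≈⟨ *-identityˡ _ ⟨
    1# * s ^ m                      ≈⟨ *-congʳ (s⁻¹^m*s^m (suc k)) ⟨
    s⁻¹ ^ suc k * s ^ suc k * s ^ m
      ≈⟨ solve 3 (λ a b c → a :* b :* c := b :* (a :* c)) refl (s⁻¹ ^ suc k) (s ^ suc k) (s ^ m) ⟩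
    s ^ suc k * (s⁻¹ ^ suc k * s ^ m) ∎)

  private

    as-⊖ : ∀ x → ∃₂ λ k m → x ≡ k ⊖ m
    as-⊖ (+ k)    = k , 0 , ≡.refl
    as-⊖ -[1+ m ] = 0 , suc m , ≡.refl

    ⊖-≡ : ∀ k m k′ m′ → k ℕ.+ m′ ≡ k′ ℕ.+ m → k ⊖ m ≡ k′ ⊖ m′
    ⊖-≡ k m k′ m′ eq = ≡.trans (≡.sym (ℤ.+-cancelˡ-⊖ m′ k m))
      (≡.trans (≡.cong₂ _⊖_ (≡.trans (ℕ.+-comm m′ k) (≡.trans eq (ℕ.+-comm k′ m))) (ℕ.+-comm m′ m)) (ℤ.+-cancelˡ-⊖ m k′ m′))

  -- Multiplying by `s ^ m * s ^ m′` clears the negative powers of s and leaves the difference of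
  -- two distinct monomials.
  eigenvalues-distinct : ∀ {a b} {x y} → ¬ (a ≡ b × x ≡ y) → q ^ a * s^ℤ x - q ^ b * s^ℤ y # 0#
  eigenvalues-distinct {a} {b} {x} {y} ne with as-⊖ x | as-⊖ y
  ... | k , m , ≡.refl | k′ , m′ , ≡.refl = *#0ˡ (P.#-congʳ (sym (begin
      (q ^ a * X - q ^ b * Y) * (s ^ m * s ^ m′)
        ≈⟨ solve 6 (λ A X B Y S S′ → (A :* X :- B :* Y) :* (S :* S′) := A :* ((X :* S) :* S′) :- B :*
          ((Y :* S′) :* S)) refl (q ^ a) X (q ^ b) Y (s ^ m) (s ^ m′) ⟩
      q ^ a * (X * s ^ m * s ^ m′) - q ^ b * (Y * s ^ m′ * s ^ m)
        ≈⟨ +-cong (*-congˡ (*-congʳ (s^ℤ-⊖ k m))) (-‿cong (*-congˡ (*-congʳ (s^ℤ-⊖ k′ m′)))) ⟩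
      q ^ a * (s ^ k * s ^ m′) - q ^ b * (s ^ k′ * s ^ m)
        ≈⟨ +-cong (*-congˡ (^-homo-* s k m′)) (-‿cong (*-congˡ (^-homo-* s k′ m))) ⟨
      q ^ a * s ^ (k ℕ.+ m′) - q ^ b * s ^ (k′ ℕ.+ m) ∎))
      (monomials-distinct λ eq → ne (≡.cong proj₁ eq , ⊖-≡ k m k′ m′ (≡.cong proj₂ eq))))
    where
    X = s^ℤ (k ⊖ m)
    Y = s^ℤ (k′ ⊖ m′)

  s^ℤ-distinct : ∀ {x y} → x ≢ y → s^ℤ x - s^ℤ y # 0#
  s^ℤ-distinct ne = P.#-congʳ (+-cong (*-identityˡ _) (-‿cong (*-identityˡ _))) (eigenvalues-distinct {0} {0} (ne ∘ proj₂))

  -- The matrix entries of T_k in the seminormal form, as functions of the content difference CT[k+1] - CT[k].  The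
  -- difference 0 does not occur; at ± 1 the exchanged tableau does not exist, and offDiagonal vanishes.
  diagonal offDiagonal : ℤ → Carrier
  diagonal (+ zero)   = 0#
  diagonal (+ suc m)  = (s - 1#) /1-s^ suc m
  diagonal -[1+ m ]   = s - 1# - (s - 1#) /1-s^ suc m
  offDiagonal (+ zero)       = 0#
  offDiagonal (+ suc m)      = s * (1# - s ^ suc (suc m)) * (1# - s ^ m) /1-s^ suc m /1-s^ suc m
  offDiagonal -[1+ zero ]    = 0#
  offDiagonal -[1+ suc m ]   = 1#

  d e : ℤ → ℤ → Carrier
  d x y = diagonal (y ℤ.- x)
  e x y = offDiagonal (y ℤ.- x)

  private

    y≡x+[y-x] : ∀ x y → y ≡ x ℤ.+ (y ℤ.- x)
    y≡x+[y-x] x y = ≡.trans (≡.sym (ℤ.+-identityˡ y)) (≡.trans (≡.cong (λ z → z ℤ.+ y) (≡.sym (ℤ.+-inverseʳ x)))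
      (≡.trans (ℤ.+-assoc x (ℤ.- x) y) (≡.cong (λ z → x ℤ.+ z) (ℤ.+-comm (ℤ.- x) y))))

    -[y-x] : ∀ x y → x ℤ.- y ≡ ℤ.- (y ℤ.- x)
    -[y-x] x y = ≡.sym (≡.trans (ℤ.neg-distrib-+ y (ℤ.- x)) (≡.trans (ℤ.+-comm (ℤ.- y) _)
      (≡.cong (λ z → z ℤ.- y) (ℤ.neg-involutive x))))

    inv : ℕ → Carrier
    inv m = inverse (1-s^m#0 (suc m))

    inv-correct : ∀ m → inv m * (1# - s ^ suc m) ≈ 1#
    inv-correct m = inverse-correct (1-s^m#0 (suc m))

  -- The diagonal entry is (s - 1) s^x / (s^x - s^y) for either sign of y - x. The other identities
  -- between diagonal entries follow from this form by cancelling the nonzero differences of powers.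
  d-correct : ∀ {x y} → x ≢ y → d x y * (s^ℤ x - s^ℤ y) ≈ (s - 1#) * s^ℤ x
  d-correct {x} {y} x≢y with y ℤ.- x in eq
  ... | + zero   = ⊥-elim (x≢y (≡.sym (ℤ.i-j≡0⇒i≡j y x eq)))
  ... | + suc m  = begin
    (s - 1#) * inv m * (X - s^ℤ y)      ≈⟨ *-congˡ (+-congˡ (-‿cong Y≈)) ⟩
    (s - 1#) * inv m * (X - X * S)
      ≈⟨ solve 4 (λ s i X S → (s :- :1) :* i :* (X :- X :* S) := (s :- :1) :* X :* (i :* (:1 :- S))) refl s (inv m) X S ⟩
    (s - 1#) * X * (inv m * (1# - S))   ≈⟨ *-congˡ (inv-correct m) ⟩
    (s - 1#) * X * 1#                   ≈⟨ *-identityʳ _ ⟩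
    (s - 1#) * X                        ∎
    where
    X = s^ℤ x
    S = s ^ suc m
    Y≈ : s^ℤ y ≈ X * S
    Y≈ = trans (reflexive (≡.cong s^ℤ_ (≡.trans (y≡x+[y-x] x y) (≡.cong (λ z → x ℤ.+ z) eq)))) (s^ℤ-+ x (suc m))
  ... | -[1+ m ] = begin
    (s - 1# - (s - 1#) * inv m) * (s^ℤ x - Y)      ≈⟨ *-congˡ (+-congʳ X≈) ⟩
    (s - 1# - (s - 1#) * inv m) * (Y * S - Y)
      ≈⟨ solve 4 (λ s i Y S → (s :- :1 :- (s :- :1) :* i) :* (Y :* S :- Y) := (s :- :1) :* Y :*
        (i :* (:1 :- S) :- (:1 :- S))) refl s (inv m) Y S ⟩
    (s - 1#) * Y * (inv m * (1# - S) - (1# - S))   ≈⟨ *-congˡ (+-congʳ (inv-correct m)) ⟩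
    (s - 1#) * Y * (1# - (1# - S))
      ≈⟨ solve 3 (λ s Y S → (s :- :1) :* Y :* (:1 :- (:1 :- S)) := (s :- :1) :* (Y :* S)) refl s Y S ⟩
    (s - 1#) * (Y * S)                             ≈⟨ *-congˡ X≈ ⟨
    (s - 1#) * s^ℤ x                               ∎
    where
    Y = s^ℤ y
    S = s ^ suc m
    X≈ : s^ℤ x ≈ Y * S
    X≈ = trans (reflexive (≡.cong s^ℤ_ (≡.trans (y≡x+[y-x] y x)
      (≡.cong (λ z → y ℤ.+ z) (≡.trans (-[y-x] x y) (≡.cong ℤ.-_ eq)))))) (s^ℤ-+ y (suc m))

  -- The trace of the two-by-two block of T_k on a pair of exchanged content vectors, whose
  -- eigenvalues are s and -1.
  d-swap : ∀ {x y} → x ≢ y → d y x ≈ s - 1# - d x y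
  d-swap {x} {y} x≢y = *-cancelˡ (s^ℤ-distinct x≢y) (begin
    (X - Y) * d y x                        ≈⟨ solve 3 (λ X Y d → (X :- Y) :* d := :- (d :* (Y :- X))) refl X Y (d y x) ⟩
    - (d y x * (Y - X))                    ≈⟨ -‿cong (d-correct (x≢y ∘ ≡.sym)) ⟩
    - ((s - 1#) * Y)
      ≈⟨ solve 3 (λ s X Y → :- ((s :- :1) :* Y) := (s :- :1) :* (X :- Y) :- (s :- :1) :* X) refl s X Y ⟩
    (s - 1#) * (X - Y) - (s - 1#) * X      ≈⟨ +-congˡ (-‿cong (d-correct x≢y)) ⟨
    (s - 1#) * (X - Y) - d x y * (X - Y)
      ≈⟨ solve 3 (λ s d D → (s :- :1) :* D :- d :* D := D :* (s :- :1 :- d)) refl s (d x y) (X - Y) ⟩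
    (X - Y) * (s - 1# - d x y)             ∎)
    where
    X = s^ℤ x
    Y = s^ℤ y

  private

    offDiagonal-numerator : ∀ m → (1# - s ^ suc m) * (1# - s ^ suc m) * offDiagonal (+ suc m) ≈
                            s * (1# - s ^ suc (suc m)) * (1# - s ^ m)
    offDiagonal-numerator m = begin
      W * W * (u * i * i)      ≈⟨ solve 3 (λ W u i → W :* W :* (u :* i :* i) := u :* ((i :* W) :* (i :* W))) refl W u i ⟩
      u * ((i * W) * (i * W))  ≈⟨ *-congˡ (*-cong (inv-correct m) (inv-correct m)) ⟩
      u * (1# * 1#)            ≈⟨ solve 1 (λ u → u :* (:1 :* :1) := u) refl u ⟩
      u                        ∎
      where
      W = 1# - s ^ suc m
      i = inv m
      u = s * (1# - s ^ suc (suc m)) * (1# - s ^ m)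

    offDiagonal-product : ∀ m → offDiagonal (+ suc m) * offDiagonal -[1+ m ] ≈
                          (1# + diagonal (+ suc m)) * (s - diagonal (+ suc m))
    offDiagonal-product m = *-cancelˡ (P.x#0y#0→xy#0 (1-s^m#0 (suc m)) (1-s^m#0 (suc m))) (trans (lhs m) (sym rhs))
      where
      S = s ^ suc m
      W = 1# - S
      i = inv m
      lhs : ∀ m → (1# - s ^ suc m) * (1# - s ^ suc m) * (offDiagonal (+ suc m) * offDiagonal -[1+ m ])
        ≈ s * (1# - s ^ suc (suc m)) * (1# - s ^ m)
      -- At gap one both sides vanish: `offDiagonal -[1+ zero ]` is 0, and so is the factor 1 - s^0.
      lhs zero = solve 3 (λ w b u → w :* (b :* :0) := u :* (:1 :- :1)) refl _ _ _
      lhs (suc m) = trans (*-congˡ (*-identityʳ _)) (offDiagonal-numerator (suc m))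
      rhs : W * W * ((1# + diagonal (+ suc m)) * (s - diagonal (+ suc m))) ≈ s * (1# - s ^ suc (suc m)) * (1# - s ^ m)
      rhs = begin
        W * W * ((1# + (s - 1#) * i) * (s - (s - 1#) * i))
          ≈⟨ solve 3 (λ W s i → W :* W :* ((:1 :+ (s :- :1) :* i) :* (s :- (s :- :1) :* i)) :=
                                (W :+ (s :- :1) :* (i :* W)) :* (s :* W :- (s :- :1) :* (i :* W))) refl W s i ⟩
        (W + (s - 1#) * (i * W)) * (s * W - (s - 1#) * (i * W))
          ≈⟨ *-cong (+-congˡ (*-congˡ (inv-correct m))) (+-congˡ (-‿cong (*-congˡ (inv-correct m)))) ⟩
        (W + (s - 1#) * 1#) * (s * W - (s - 1#) * 1#)
          ≈⟨ solve 2 (λ s S′ → ((:1 :- s :* S′) :+ (s :- :1) :* :1) :* (s :* (:1 :- s :* S′) :- (s :- :1) :* :1) :=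
                               s :* (:1 :- s :* (s :* S′)) :* (:1 :- S′)) refl s (s ^ m) ⟩
        s * (1# - s ^ suc (suc m)) * (1# - s ^ m) ∎

  -- Together with `d-swap` this says that the same two-by-two block has determinant -s.
  e-product : ∀ {x y} → x ≢ y → e x y * e y x ≈ (1# + d x y) * (s - d x y)
  e-product {x} {y} x≢y with y ℤ.- x in eq
  ... | + zero   = ⊥-elim (x≢y (≡.sym (ℤ.i-j≡0⇒i≡j y x eq)))
  ... | + suc m  = trans (*-congˡ (reflexive (≡.cong offDiagonal (≡.trans (-[y-x] x y) (≡.cong ℤ.-_ eq)))))
    (offDiagonal-product m)
  ... | -[1+ m ] = begin
    offDiagonal -[1+ m ] * e y x
      ≡⟨ ≡.cong (λ z → offDiagonal -[1+ m ] * offDiagonal z) (≡.trans (-[y-x] x y) (≡.cong ℤ.-_ eq)) ⟩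
    offDiagonal -[1+ m ] * offDiagonal (+ suc m) ≈⟨ *-comm _ _ ⟩
    offDiagonal (+ suc m) * offDiagonal -[1+ m ] ≈⟨ offDiagonal-product m ⟩
    (1# + a) * (s - a)
      ≈⟨ solve 2 (λ s a → (:1 :+ a) :* (s :- a) := (:1 :+ (s :- :1 :- a)) :* (s :- (s :- :1 :- a))) refl s a ⟩
    (1# + (s - 1# - a)) * (s - (s - 1# - a))     ∎
    where a = diagonal (+ suc m)

  -- The rational identity behind the braid relation. Multiplied by the three differences of powers
  -- it becomes a polynomial identity.
  d-braid : ∀ {x y z} → x ≢ y → y ≢ z → x ≢ z →
            d x y * d y z + (s - 1#) * d x z ≈ d x z * (d x y + d y z)
  d-braid {x} {y} {z} x≢y y≢z x≢z = *-cancelˡ (P.x#0y#0→xy#0 (P.x#0y#0→xy#0 (s^ℤ-distinct x≢y) (s^ℤ-distinct y≢z))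
    (s^ℤ-distinct x≢z)) (begin
    (X - Y) * (Y - Z) * (X - Z) * (d x y * d y z + (s - 1#) * d x z)
      ≈⟨ solve 7 (λ X Y Z p r t s → (X :- Y) :* (Y :- Z) :* (X :- Z) :* (p :* r :+ (s :- :1) :* t) :=
           (p :* (X :- Y)) :* (r :* (Y :- Z)) :* (X :- Z) :+ (s :- :1) :* (t :* (X :- Z)) :* ((X :- Y) :* (Y :- Z))) refl
           X Y Z (d x y) (d y z) (d x z) s ⟩
    (d x y * (X - Y)) * (d y z * (Y - Z)) * (X - Z) + (s - 1#) * (d x z * (X - Z)) * ((X - Y) * (Y - Z))
      ≈⟨ +-cong (*-congʳ (*-cong (d-correct x≢y) (d-correct y≢z))) (*-congʳ (*-congˡ (d-correct x≢z))) ⟩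
    ((s - 1#) * X) * ((s - 1#) * Y) * (X - Z) + (s - 1#) * ((s - 1#) * X) * ((X - Y) * (Y - Z))
      ≈⟨ solve 4 (λ X Y Z s →
           ((s :- :1) :* X) :* ((s :- :1) :* Y) :* (X :- Z) :+ (s :- :1) :* ((s :- :1) :* X) :* ((X :- Y) :* (Y :- Z)) :=
           ((s :- :1) :* X) :* (((s :- :1) :* X) :* (Y :- Z) :+ ((s :- :1) :* Y) :* (X :- Y))) refl X Y Z s ⟩
    ((s - 1#) * X) * (((s - 1#) * X) * (Y - Z) + ((s - 1#) * Y) * (X - Y))
      ≈⟨ *-cong (d-correct x≢z) (+-cong (*-congʳ (d-correct x≢y)) (*-congʳ (d-correct y≢z))) ⟨
    (d x z * (X - Z)) * ((d x y * (X - Y)) * (Y - Z) + (d y z * (Y - Z)) * (X - Y))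
      ≈⟨ solve 6 (λ X Y Z p r t →
           (t :* (X :- Z)) :* ((p :* (X :- Y)) :* (Y :- Z) :+ (r :* (Y :- Z)) :* (X :- Y)) :=
           (X :- Y) :* (Y :- Z) :* (X :- Z) :* (t :* (p :+ r))) refl X Y Z (d x y) (d y z) (d x z) ⟩
    (X - Y) * (Y - Z) * (X - Z) * (d x z * (d x y + d y z)) ∎)
    where
    X = s^ℤ x
    Y = s^ℤ y
    Z = s^ℤ z

  -- The transpose of T_k, acting on functions of content vectors.
  hecke : ∀ {m} → Fin m → (Vec ℤ (suc m) → Carrier) → Vec ℤ (suc m) → Carrier
  hecke k f X = d x y * f X + e x y * f (swapAt k X)
    where
    x = lookup X (inject₁ k)
    y = lookup X (suc k)

  -- Entries before position k are spectators, so the recursion drops them. At k = 0 the trace and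
  -- the determinant of the block give the relation.
  hecke-quadratic : ∀ {m} (k : Fin m) f X → lookup X (inject₁ k) ≢ lookup X (suc k) →
                    hecke k (hecke k f) X ≈ (s - 1#) * hecke k f X + s * f X
  hecke-quadratic (suc k) f (x ∷ X) = hecke-quadratic k (f ∘ (x ∷_)) X
  hecke-quadratic zero f (x ∷ y ∷ X) x≢y = begin
    p * (p * u + o * v) + o * (d y x * v + e y x * u)
      ≈⟨ solve 6 (λ p o t w u v → p :* (p :* u :+ o :* v) :+ o :* (t :* v :+ w :* u) :=
           (p :* p) :* u :+ (o :* w) :* u :+ o :* p :* v :+ o :* t :* v) refl p o (d y x) (e y x) u v ⟩
    (p * p) * u + (o * e y x) * u + o * p * v + o * d y x * v
      ≈⟨ +-cong (+-congʳ (+-congˡ (*-congʳ (e-product x≢y)))) (*-congʳ (*-congˡ (d-swap x≢y))) ⟩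
    (p * p) * u + ((1# + p) * (s - p)) * u + o * p * v + o * (s - 1# - p) * v
      ≈⟨ solve 5 (λ s p o u v →
           (p :* p) :* u :+ ((:1 :+ p) :* (s :- p)) :* u :+ o :* p :* v :+ o :* (s :- :1 :- p) :* v :=
           (s :- :1) :* (p :* u :+ o :* v) :+ s :* u) refl s p o u v ⟩
    (s - 1#) * (p * u + o * v) + s * u ∎
    where
    p = d x y
    o = e x y
    u = f (x ∷ y ∷ X)
    v = f (y ∷ x ∷ X)

  hecke-far : ∀ {m} (k j : Fin m) f X → suc (suc (toℕ k)) ℕ.≤ toℕ j →
              hecke k (hecke j f) X ≈ hecke j (hecke k f) X
  hecke-far (suc k) (suc j) f (x ∷ X) (s≤s k≤j) = hecke-far k j (f ∘ (x ∷_)) X k≤j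
  hecke-far zero (suc zero) f X (s≤s ())
  hecke-far zero (suc (suc j)) f (x ∷ y ∷ X) _ =
    solve 8 (λ p r t w a b c g → p :* (t :* a :+ w :* b) :+ r :* (t :* c :+ w :* g) :=
      t :* (p :* a :+ r :* c) :+ w :* (p :* b :+ r :* g)) refl (d x y) (e x y)
      (d (lookup X (inject₁ j)) (lookup X (suc j))) (e (lookup X (inject₁ j)) (lookup X (suc j)))
      (f (x ∷ y ∷ X)) (f (x ∷ y ∷ swapAt j X)) (f (y ∷ x ∷ X)) (f (y ∷ x ∷ swapAt j X))

  hecke-braid : ∀ {m} (k : Fin m) f (X : Vec ℤ (suc (suc m))) →
                lookup X (inject₁ (inject₁ k)) ≢ lookup X (inject₁ (suc k)) →
                lookup X (inject₁ (suc k)) ≢ lookup X (suc (suc k)) →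
                lookup X (inject₁ (inject₁ k)) ≢ lookup X (suc (suc k)) →
                hecke (inject₁ k) (hecke (suc k) (hecke (inject₁ k) f)) X ≈
                hecke (suc k) (hecke (inject₁ k) (hecke (suc k) f)) X
  hecke-braid (suc k) f (x ∷ X) = hecke-braid k (f ∘ (x ∷_)) X
  hecke-braid zero f (x ∷ y ∷ z ∷ X) x≢y y≢z x≢z = begin
    dxy * (dyz * (dxy * f₀ + exy * f₁) + eyz * (dxz * f₂ + exz * f₃)) +
    exy * (dxz * (d y x * f₁ + e y x * f₀) + exz * (dyz * f₄ + eyz * f₅))
      ≈⟨ solve 14 (λ dxy dyz dxz dyx exy eyz exz eyx f₀ f₁ f₂ f₃ f₄ f₅ →
           dxy :* (dyz :* (dxy :* f₀ :+ exy :* f₁) :+ eyz :* (dxz :* f₂ :+ exz :* f₃)) :+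
           exy :* (dxz :* (dyx :* f₁ :+ eyx :* f₀) :+ exz :* (dyz :* f₄ :+ eyz :* f₅)) :=
           (dxy :* dxy :* dyz :+ (exy :* eyx) :* dxz) :* f₀ :+ exy :* (dxy :* dyz :+ dyx :* dxz) :* f₁ :+
           dxy :* eyz :* dxz :* f₂ :+ (dxy :* eyz :* exz :* f₃ :+ exy :* exz :* dyz :* f₄ :+ exy :* exz :* eyz :* f₅)) refl
           dxy dyz dxz (d y x) exy eyz exz (e y x) f₀ f₁ f₂ f₃ f₄ f₅ ⟩
    (dxy * dxy * dyz + (exy * e y x) * dxz) * f₀ + exy * (dxy * dyz + d y x * dxz) * f₁ +
    dxy * eyz * dxz * f₂ + rest
      -- Both sides are expanded over the six arrangements of x, y, z. The coefficients of `f₃`,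
      -- `f₄`, `f₅` agree as they stand; the other three are matched by `d-braid`.
      ≈⟨ +-congʳ (+-cong (+-cong (*-congʳ c₀) (*-congʳ (*-congˡ c₁))) (*-congʳ c₂)) ⟩
    (dyz * dyz * dxy + (eyz * e z y) * dxz) * f₀ + exy * (dxz * dyz) * f₁ +
    eyz * (dyz * dxy + d z y * dxz) * f₂ + rest
      ≈⟨ solve 14 (λ dxy dyz dxz dzy exy eyz exz ezy f₀ f₁ f₂ f₃ f₄ f₅ →
           (dyz :* dyz :* dxy :+ (eyz :* ezy) :* dxz) :* f₀ :+ exy :* (dxz :* dyz) :* f₁ :+
           eyz :* (dyz :* dxy :+ dzy :* dxz) :* f₂ :+
             (dxy :* eyz :* exz :* f₃ :+ exy :* exz :* dyz :* f₄ :+ exy :* exz :* eyz :* f₅) :=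
           dyz :* (dxy :* (dyz :* f₀ :+ eyz :* f₂) :+ exy :* (dxz :* f₁ :+ exz :* f₄)) :+
           eyz :* (dxz :* (dzy :* f₂ :+ ezy :* f₀) :+ exz :* (dxy :* f₃ :+ exy :* f₅))) refl
           dxy dyz dxz (d z y) exy eyz exz (e z y) f₀ f₁ f₂ f₃ f₄ f₅ ⟩
    dyz * (dxy * (dyz * f₀ + eyz * f₂) + exy * (dxz * f₁ + exz * f₄)) +
    eyz * (dxz * (d z y * f₂ + e z y * f₀) + exz * (dxy * f₃ + exy * f₅)) ∎
    where
    dxy = d x y
    dyz = d y z
    dxz = d x z
    exy = e x y
    eyz = e y z
    exz = e x z
    f₀ = f (x ∷ y ∷ z ∷ X)
    f₁ = f (y ∷ x ∷ z ∷ X)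
    f₂ = f (x ∷ z ∷ y ∷ X)
    f₃ = f (z ∷ x ∷ y ∷ X)
    f₄ = f (y ∷ z ∷ x ∷ X)
    f₅ = f (z ∷ y ∷ x ∷ X)
    rest = dxy * eyz * exz * f₃ + exy * exz * dyz * f₄ + exy * exz * eyz * f₅
    key : dxy * dyz + (s - 1#) * dxz ≈ dxz * (dxy + dyz)
    key = d-braid x≢y y≢z x≢z
    c₁ : dxy * dyz + d y x * dxz ≈ dxz * dyz
    c₁ = begin
      dxy * dyz + d y x * dxz                    ≈⟨ +-congˡ (*-congʳ (d-swap x≢y)) ⟩
      dxy * dyz + (s - 1# - dxy) * dxz
        ≈⟨ solve 4 (λ s p r t → p :* r :+ (s :- :1 :- p) :* t := (p :* r :+ (s :- :1) :* t) :- p :* t) refl s dxy dyz dxz ⟩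
      (dxy * dyz + (s - 1#) * dxz) - dxy * dxz   ≈⟨ +-congʳ key ⟩
      dxz * (dxy + dyz) - dxy * dxz              ≈⟨ solve 3 (λ p r t → t :* (p :+ r) :- p :* t := t :* r) refl dxy dyz dxz ⟩
      dxz * dyz                                  ∎
    c₂ : dxy * eyz * dxz ≈ eyz * (dyz * dxy + d z y * dxz)
    c₂ = sym (begin
      eyz * (dyz * dxy + d z y * dxz)                  ≈⟨ *-congˡ (+-congˡ (*-congʳ (d-swap y≢z))) ⟩
      eyz * (dyz * dxy + (s - 1# - dyz) * dxz)
        ≈⟨ *-congˡ (solve 4 (λ s p r t → r :* p :+ (s :- :1 :- r) :* t :=
          (p :* r :+ (s :- :1) :* t) :- r :* t) refl s dxy dyz dxz) ⟩
      eyz * ((dxy * dyz + (s - 1#) * dxz) - dyz * dxz) ≈⟨ *-congˡ (+-congʳ key) ⟩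
      eyz * (dxz * (dxy + dyz) - dyz * dxz)
        ≈⟨ solve 4 (λ w p r t → w :* (t :* (p :+ r) :- r :* t) := p :* w :* t) refl eyz dxy dyz dxz ⟩
      dxy * eyz * dxz                                  ∎)
    c₀ : dxy * dxy * dyz + (exy * e y x) * dxz ≈ dyz * dyz * dxy + (eyz * e z y) * dxz
    c₀ = begin
      dxy * dxy * dyz + (exy * e y x) * dxz                 ≈⟨ +-congˡ (*-congʳ (e-product x≢y)) ⟩
      dxy * dxy * dyz + ((1# + dxy) * (s - dxy)) * dxz
        -- The two sides differ by `dxy - dyz` times the difference of the two sides of `d-braid`.
        ≈⟨ solve 4 (λ s p r t → p :* p :* r :+ ((:1 :+ p) :* (s :- p)) :* t :=
             (p :- r) :* ((p :* r :+ (s :- :1) :* t) :- t :* (p :+ r)) :+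
               (r :* r :* p :+ ((:1 :+ r) :* (s :- r)) :* t)) refl s dxy dyz dxz ⟩
      (dxy - dyz) * ((dxy * dyz + (s - 1#) * dxz) - dxz * (dxy + dyz)) + (dyz * dyz * dxy + ((1# + dyz) * (s - dyz)) * dxz)
        ≈⟨ +-congʳ (*-congˡ (trans (+-congʳ key) (-‿inverseʳ _))) ⟩
      (dxy - dyz) * 0# + (dyz * dyz * dxy + ((1# + dyz) * (s - dyz)) * dxz)
        ≈⟨ trans (+-congʳ (zeroʳ _)) (+-identityˡ _) ⟩
      dyz * dyz * dxy + ((1# + dyz) * (s - dyz)) * dxz      ≈⟨ +-congˡ (*-congʳ (e-product y≢z)) ⟨
      dyz * dyz * dxy + (eyz * e z y) * dxz                 ∎

  murphy : ∀ {m} → Fin m → (Vec ℤ m → Carrier) → Vec ℤ m → Carrier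
  murphy i f X = s^ℤ lookup X i * f X

  -- The recursion T_k ω_{k+1} T_k = s ω_k of the Jucys-Murphy elements. The error term is
  -- `hecke k f X` times the difference of the two sides of `d-correct`.
  hecke-murphy : ∀ {m} (k : Fin m) f X → lookup X (inject₁ k) ≢ lookup X (suc k) →
                 hecke k (murphy (suc k) (hecke k f)) X ≈ s * murphy (inject₁ k) f X
  hecke-murphy (suc k) f (x ∷ X) = hecke-murphy k (f ∘ (x ∷_)) X
  hecke-murphy zero f (x ∷ y ∷ X) x≢y = begin
    p * (Y * (p * u + o * v)) + o * (X′ * (d y x * v + e y x * u))
      ≈⟨ solve 8 (λ p o t w u v X Y → p :* (Y :* (p :* u :+ o :* v)) :+ o :* (X :* (t :* v :+ w :* u)) :=
           (Y :* p :* p :+ X :* (o :* w)) :* u :+ o :* (Y :* p :+ X :* t) :* v) refl p o (d y x) (e y x) u v X′ Y ⟩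
    (Y * p * p + X′ * (o * e y x)) * u + o * (Y * p + X′ * d y x) * v
      ≈⟨ +-cong (*-congʳ (+-congˡ (*-congˡ (e-product x≢y)))) (*-congʳ (*-congˡ (+-congˡ (*-congˡ (d-swap x≢y))))) ⟩
    (Y * p * p + X′ * ((1# + p) * (s - p))) * u + o * (Y * p + X′ * (s - 1# - p)) * v
      ≈⟨ solve 7 (λ p o s u v X Y → (Y :* p :* p :+ X :* ((:1 :+ p) :* (s :- p))) :* u :+ o :*
        (Y :* p :+ X :* (s :- :1 :- p)) :* v :=
           s :* (X :* u) :+ (p :* u :+ o :* v) :* ((s :- :1) :* X :- p :* (X :- Y))) refl p o s u v X′ Y ⟩
    s * (X′ * u) + (p * u + o * v) * ((s - 1#) * X′ - p * (X′ - Y))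
      ≈⟨ +-congˡ (*-congˡ (trans (+-congˡ (-‿cong (d-correct x≢y))) (-‿inverseʳ _))) ⟩
    s * (X′ * u) + (p * u + o * v) * 0#
      ≈⟨ trans (+-congˡ (zeroʳ _)) (+-identityʳ _) ⟩
    s * (X′ * u) ∎
    where
    X′ = s^ℤ x
    Y = s^ℤ y
    p = d x y
    o = e x y
    u = f (x ∷ y ∷ X)
    v = f (y ∷ x ∷ X)

-- Positions, tableaux and their content vectors

module _ where

  open import Relation.Binary.PropositionalEquality using (refl; sym; trans)

  lookup-antitone : ∀ {xs} → Linked _≥_ xs → ∀ i j → toℕ i ℕ.≤ toℕ j → List.lookup xs j ℕ.≤ List.lookup xs i
  lookup-antitone {x ∷ xs}     L        zero    zero    _  = ℕ.≤-refl
  lookup-antitone {x ∷ y ∷ xs} (x≥y ∷ L) zero    (suc j) _  = ℕ.≤-trans (lookup-antitone L zero j z≤n) x≥y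
  lookup-antitone {x ∷ y ∷ xs} (x≥y ∷ L) (suc i) (suc j) (s≤s i≤j) = lookup-antitone L i j i≤j

  inject₁<suc : ∀ {m} (k : Fin m) → inject₁ k Fin.< suc k
  inject₁<suc k = s≤s (ℕ.≤-reflexive (Fin.toℕ-inject₁ k))

  inject₁≢suc : ∀ {m} (k : Fin m) → inject₁ k ≢ suc k
  inject₁≢suc k eq = Fin.<⇒≢ (inject₁<suc k) eq

  adjacent-inject₁ : ∀ {m} (k : Fin m) → adjacent k (inject₁ k) ≡ suc k
  adjacent-inject₁ k with inject₁ k Fin.≟ inject₁ k
  ... | yes _ = refl
  ... | no ne = ⊥-elim (ne refl)

  adjacent-suc : ∀ {m} (k : Fin m) → adjacent k (suc k) ≡ inject₁ k
  adjacent-suc k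
    rewrite dec-false (suc k Fin.≟ inject₁ k) (inject₁≢suc k ∘ sym) | dec-true (suc k Fin.≟ suc k) refl = refl

  adjacent-other : ∀ {m} (k : Fin m) {i} → i ≢ inject₁ k → i ≢ suc k → adjacent k i ≡ i
  adjacent-other k {i} i≢k i≢k+1 with i Fin.≟ inject₁ k
  ... | yes eq = ⊥-elim (i≢k eq)
  ... | no _ with i Fin.≟ suc k
  ...   | yes eq = ⊥-elim (i≢k+1 eq)
  ...   | no _   = refl

  data AdjacentView {m} (k : Fin m) : Fin (suc m) → Set where
    left  : AdjacentView k (inject₁ k)
    right : AdjacentView k (suc k)
    other : ∀ {i} → i ≢ inject₁ k → i ≢ suc k → AdjacentView k i

  adjacentView : ∀ {m} (k : Fin m) i → AdjacentView k i
  adjacentView k i with i Fin.≟ inject₁ k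
  ... | yes refl = left
  ... | no i≢k with i Fin.≟ suc k
  ...   | yes refl = right
  ...   | no i≢k+1 = other i≢k i≢k+1

  adjacent-involutive : ∀ {m} (k : Fin m) i → adjacent k (adjacent k i) ≡ i
  adjacent-involutive k i with adjacentView k i
  ... | left        = trans (cong (adjacent k) (adjacent-inject₁ k)) (adjacent-suc k)
  ... | right       = trans (cong (adjacent k) (adjacent-suc k)) (adjacent-inject₁ k)
  ... | other p q   = trans (cong (adjacent k) (adjacent-other k p q)) (adjacent-other k p q)

  lookup-swapAt : ∀ {a} {A : Set a} {m} (k : Fin m) (X : Vec A (suc m)) i →
                  lookup (swapAt k X) i ≡ lookup X (adjacent k i)
  lookup-swapAt k X i with adjacentView k i
  ... | left      = trans (Vec.lookup∘update′ (inject₁≢suc k) (X [ inject₁ k ]≔ _) _)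
    (trans (Vec.lookup∘update (inject₁ k) X _) (cong (lookup X) (sym (adjacent-inject₁ k))))
  ... | right     = trans (Vec.lookup∘update (suc k) (X [ inject₁ k ]≔ _) _) (cong (lookup X) (sym (adjacent-suc k)))
  ... | other p q = trans (Vec.lookup∘update′ q (X [ inject₁ k ]≔ _) _)
    (trans (Vec.lookup∘update′ p X _) (cong (lookup X) (sym (adjacent-other k p q))))

  lookup-injective : ∀ {a} {A : Set a} {m} {X Y : Vec A m} → (∀ i → lookup X i ≡ lookup Y i) → X ≡ Y
  lookup-injective {X = X} {Y} eq = trans (sym (Vec.tabulate∘lookup X))
    (trans (Vec.tabulate-cong eq) (Vec.tabulate∘lookup Y))

  module TableauContents {m : ℕ} (κ : Partition (suc m)) where

    open Partition κ
    open Tableaux κ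

    cell-entry : ∀ T a → cell T (entry T a) ≡ a
    cell-entry T a = Inverse.inverseˡ (filling T) refl

    entry-cell : ∀ T i → entry T (cell T i) ≡ i
    entry-cell T i = Inverse.inverseʳ (filling T) refl

    cell-injective : ∀ T {i j} → cell T i ≡ cell T j → i ≡ j
    cell-injective T eq = trans (sym (entry-cell T _)) (trans (cong (entry T) eq) (entry-cell T _))

    entry-injective : ∀ T {a b} → entry T a ≡ entry T b → a ≡ b
    entry-injective T eq = trans (sym (cell-entry T _)) (trans (cong (cell T) eq) (cell-entry T _))

    row,col-injective : ∀ {a b : Cell} → row a ≡ row b → col a ≡ col b → a ≡ b
    row,col-injective {r , c} {r′ , c′} eqr eqc with Fin.toℕ-injective eqr
    ... | refl = cong (r ,_) (Fin.toℕ-injective eqc)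

    cellLeft : ∀ a c → c ℕ.≤ col a → Σ[ x ∈ Cell ] row x ≡ row a × col x ≡ c
    cellLeft a c c≤ = (proj₁ a , fromℕ< (ℕ.≤-<-trans c≤ (Fin.toℕ<n (proj₂ a)))) , refl , Fin.toℕ-fromℕ< _

    cellBelow : ∀ a r → r ℕ.≤ row a → Σ[ x ∈ Cell ] row x ≡ r × col x ≡ col a
    cellBelow a r r≤ = (ρ , fromℕ< (ℕ.<-≤-trans (Fin.toℕ<n (proj₂ a))
      (lookup-antitone decreasing ρ (proj₁ a) (subst (ℕ._≤ row a) (sym ρ≡) r≤)))) , ρ≡ , Fin.toℕ-fromℕ< _
      where
      r< : r ℕ.< length parts
      r< = ℕ.≤-<-trans r≤ (Fin.toℕ<n (proj₁ a))
      ρ : Fin (length parts)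
      ρ = fromℕ< r<
      ρ≡ : toℕ ρ ≡ r
      ρ≡ = Fin.toℕ-fromℕ< r<

    -- The cell in the row of `b` and the column of `a` carries an entry strictly between the two.
    entry-upperLeft : ∀ T a b → row a ℕ.< row b → col a ℕ.< col b → 2 ℕ.+ toℕ (entry T b) ℕ.≤ toℕ (entry T a)
    entry-upperLeft T a b r<r c<c with cellLeft b (col a) (ℕ.<⇒≤ c<c)
    ... | c , rc , cc = ℕ.≤-<-trans (rowsDecrease T c b rc (subst (ℕ._< col b) (sym cc) c<c))
                          (colsDecrease T a c (sym cc) (subst (row a ℕ.<_) (sym rc) r<r))

    -- Both remaining corners of the rectangle spanned by `a` and `b` carry entries strictly
    -- between, and these two entries differ.
    entry-rectangle : ∀ T a b → row a ℕ.< row b → col a ℕ.< col b → 3 ℕ.+ toℕ (entry T b) ℕ.≤ toℕ (entry T a)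
    entry-rectangle T a b r<r c<c with cellLeft b (col a) (ℕ.<⇒≤ c<c) | cellBelow b (row a) (ℕ.<⇒≤ r<r)
    ... | c , rc , cc | c′ , rc′ , cc′ = three (toℕ (entry T b)) (toℕ (entry T c)) (toℕ (entry T c′)) (toℕ (entry T a))
      (rowsDecrease T c b rc (subst (ℕ._< col b) (sym cc) c<c))
      (colsDecrease T a c (sym cc) (subst (row a ℕ.<_) (sym rc) r<r))
      (colsDecrease T c′ b cc′ (subst (ℕ._< row b) (sym rc′) r<r))
      (rowsDecrease T a c′ (sym rc′) (subst (col a ℕ.<_) (sym cc′) c<c))
      λ eq → ℕ.<-irrefl (trans (sym rc′) (trans (sym (cong row (entry-injective T (Fin.toℕ-injective eq)))) rc)) r<r
      where
      three : ∀ i j j′ k → i ℕ.< j → j ℕ.< k → i ℕ.< j′ → j′ ℕ.< k → j ≢ j′ → 3 ℕ.+ i ℕ.≤ k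
      three i j j′ k i<j j<k i<j′ j′<k j≢j′ with ℕ.<-cmp j j′
      ... | tri< j<j′ _ _ = ℕ.≤-trans (s≤s (ℕ.≤-<-trans i<j j<j′)) j′<k
      ... | tri≈ _ j≡j′ _ = ⊥-elim (j≢j′ j≡j′)
      ... | tri> _ _ j>j′ = ℕ.≤-trans (s≤s (ℕ.≤-<-trans i<j′ j>j′)) j<k

    diagonal-< : (a b : Cell) → content a ≡ content b → row b ℕ.< row a → col b ℕ.< col a
    diagonal-< a b eq r<r = ℕ.≰⇒> λ c≤c → ℤ.<-irrefl eq
      (ℤ.<-≤-trans (ℤ.⊖-monoʳ->-< (col a) r<r) (ℤ.⊖-monoˡ-≤ (row b) c≤c))

    content-injective : (a b : Cell) → content a ≡ content b → row a ≡ row b → a ≡ b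
    content-injective a b eq r≡r = row,col-injective r≡r (case (ℕ.<-cmp (col a) (col b)))
      where
      open import Relation.Binary.Definitions using (Tri)
      case : Tri (col a ℕ.< col b) (col a ≡ col b) (col b ℕ.< col a) → col a ≡ col b
      case (tri≈ _ c≡c _) = c≡c
      case (tri< c<c _ _) = ⊥-elim (ℤ.<-irrefl (trans eq (cong (col b ⊖_) (sym r≡r))) (ℤ.⊖-monoˡ-< (row a) c<c))
      case (tri> _ _ c>c) = ⊥-elim (ℤ.<-irrefl (trans (sym eq) (cong (col a ⊖_) r≡r)) (ℤ.⊖-monoˡ-< (row b) c>c))

    -- Cells of equal content lie on one diagonal and span a rectangle. The bound 3 makes the
    -- contents of k, k + 1, k + 2 pairwise distinct, as the braid relation requires.
    equal-contents-apart : ∀ T {i j} → i Fin.< j → CT T i ≡ CT T j → 3 ℕ.+ toℕ i ℕ.≤ toℕ j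
    equal-contents-apart T {i} {j} i<j eq with ℕ.<-cmp (row (cell T j)) (row (cell T i))
    ... | tri≈ _ r≡r _ = ⊥-elim (Fin.<-irrefl (sym (cell-injective T (content-injective _ _ (sym eq) r≡r))) i<j)
    ... | tri< r<r _ _ = subst₂ (λ x y → 3 ℕ.+ toℕ x ℕ.≤ toℕ y) (entry-cell T i) (entry-cell T j)
      (entry-rectangle T _ _ r<r (diagonal-< _ _ eq r<r))
    ... | tri> _ _ r>r = ⊥-elim (ℕ.<-asym i<j (ℕ.<⇒≤ (subst₂ (λ x y → 2 ℕ.+ toℕ x ℕ.≤ toℕ y) (entry-cell T j)
      (entry-cell T i)
      (entry-upperLeft T _ _ r>r (diagonal-< _ _ (sym eq) r>r)))))

    contents : Tableau → Vec ℤ (suc m)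
    contents T = Vec.tabulate (CT T)

    lookup-contents : ∀ T i → lookup (contents T) i ≡ CT T i
    lookup-contents T i = Vec.lookup∘tabulate (CT T) i

    contents-cong : ∀ T T′ → (∀ i → cell T i ≡ cell T′ i) → contents T ≡ contents T′
    contents-cong T T′ eq = Vec.tabulate-cong (cong content ∘ eq)

    -- Going down from N, every label takes the first free cell of the diagonal given by its content.
    contents-injective : ∀ T T′ → contents T ≡ contents T′ → ∀ i → cell T i ≡ cell T′ i
    contents-injective T T′ eq i = go i (>-wellFounded i)
      where
      CT≡ : ∀ i → CT T i ≡ CT T′ i
      CT≡ i = trans (sym (lookup-contents T i)) (trans (cong (λ X → lookup X i) eq) (lookup-contents T′ i))
      -- If T placed `i` lower on the diagonal than T′ does, that cell would carry a label j > i in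
      -- T′. The tableaux agree on j already, so T would have both labels in one cell.
      earlier : ∀ T T′ i → CT T i ≡ CT T′ i → (∀ j → i Fin.< j → cell T j ≡ cell T′ j) →
                ¬ row (cell T i) ℕ.< row (cell T′ i)
      earlier T T′ i ct ih r<r = Fin.<⇒≢ i<j (cell-injective T (trans (sym (cell-entry T′ (cell T i))) (sym (ih j i<j))))
        where
        j = entry T′ (cell T i)
        i<j : i Fin.< j
        i<j = ℕ.<⇒≤ (subst (λ x → 2 ℕ.+ toℕ x ℕ.≤ toℕ j) (entry-cell T′ i)
          (entry-upperLeft T′ _ _ r<r (diagonal-< _ _ (sym ct) r<r)))
      go : ∀ i → Acc Fin._>_ i → cell T i ≡ cell T′ i
      go i (acc rec) with ℕ.<-cmp (row (cell T i)) (row (cell T′ i))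
      ... | tri< r<r _ _ = ⊥-elim (earlier T T′ i (CT≡ i) (λ j i<j → go j (rec i<j)) r<r)
      ... | tri≈ _ r≡r _ = content-injective _ _ (CT≡ i) r≡r
      ... | tri> _ _ r>r = ⊥-elim (earlier T′ T i (sym (CT≡ i)) (λ j i<j → sym (go j (rec i<j))) r>r)

    contents-inject₁≢suc : ∀ T (k : Fin m) → lookup (contents T) (inject₁ k) ≢ lookup (contents T) (suc k)
    contents-inject₁≢suc T k eq = ℕ.1+n≰n (ℕ.≤-trans (ℕ.n≤1+n (2 ℕ.+ toℕ k))
      (subst (λ x → 3 ℕ.+ x ℕ.≤ suc (toℕ k)) (Fin.toℕ-inject₁ k)
      (equal-contents-apart T (inject₁<suc k) (trans (sym (lookup-contents T _)) (trans eq (lookup-contents T _))))))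

    -- The largest label occupies the corner cell, since a cell to its left or below it would carry
    -- a larger one.
    CT-last : ∀ T → CT T (fromℕ m) ≡ + 0
    CT-last T = cong₂ _⊖_ col≡0 row≡0
      where
      a = cell T (fromℕ m)
      largest : ∀ b → ¬ fromℕ m Fin.< entry T b
      largest b lt = ℕ.<⇒≱ lt (Fin.≤fromℕ (entry T b))
      col≡0 : col a ≡ 0
      col≡0 with col a in eq | cellLeft a 0 z≤n
      ... | zero  | _ = refl
      ... | suc c | b , rb , cb = ⊥-elim (largest b (subst (Fin._< entry T b) (entry-cell T (fromℕ m))
          (rowsDecrease T b a rb (subst₂ ℕ._<_ (sym cb) (sym eq) (s≤s z≤n)))))
      row≡0 : row a ≡ 0
      row≡0 with row a in eq | cellBelow a 0 z≤n
      ... | zero  | _ = refl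
      ... | suc r | b , rb , cb = ⊥-elim (largest b (subst (Fin._< entry T b) (entry-cell T (fromℕ m))
          (colsDecrease T b a cb (subst₂ ℕ._<_ (sym rb) (sym eq) (s≤s z≤n)))))

    contents-exchange : ∀ T k ¬row ¬col → contents (exchange κ T k ¬row ¬col) ≡ swapAt k (contents T)
    contents-exchange T k ¬row ¬col = lookup-injective λ i →
      trans (lookup-contents (exchange κ T k ¬row ¬col) i)
        (sym (trans (lookup-swapAt k (contents T) i) (lookup-contents T (adjacent k i))))

  module TableauContents₂ {m : ℕ} (κ : Partition (suc (suc m))) where

    open TableauContents κ

    contents-inject₁≢suc-suc : ∀ T (k : Fin m) →
      lookup (contents T) (inject₁ (inject₁ k)) ≢ lookup (contents T) (suc (suc k))
    contents-inject₁≢suc-suc T k eq = ℕ.<-irrefl refl (subst (λ x → 3 ℕ.+ x ℕ.≤ suc (suc (toℕ k)))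
      (trans (Fin.toℕ-inject₁ (inject₁ k)) (Fin.toℕ-inject₁ k))
      (equal-contents-apart T lt (trans (sym (lookup-contents T _)) (trans eq (lookup-contents T _)))))
      where
      lt : inject₁ (inject₁ k) Fin.< suc (suc k)
      lt = s≤s (ℕ.≤-trans (ℕ.≤-reflexive (trans (Fin.toℕ-inject₁ (inject₁ k)) (Fin.toℕ-inject₁ k))) (ℕ.n≤1+n _))

-- Descending words

module _ where

  open import Data.List.Base using (_∷ʳ_)
  open import Relation.Binary.PropositionalEquality using (refl; sym; trans)

  -- The word k , k - 1 , … , e that carries an entry from position k + 1 down to position e.
  data Descends {m} : Fin (suc m) → Fin (suc m) → Word m → Set where
    []  : ∀ {e} → Descends e e []
    _∷_ : ∀ {e w} k → Descends (inject₁ k) e w → Descends (suc k) e (k ∷ w)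

  descends-≤ : ∀ {m} {p e : Fin (suc m)} {w} → Descends p e w → toℕ e ℕ.≤ toℕ p
  descends-≤ []      = ℕ.≤-refl
  descends-≤ (k ∷ D) = ℕ.≤-trans (descends-≤ D) (ℕ.≤-trans (ℕ.≤-reflexive (Fin.toℕ-inject₁ k)) (ℕ.n≤1+n _))

  descends-bounds : ∀ {m} {p e : Fin (suc m)} {w} → Descends p e w → All (λ k → toℕ e ℕ.≤ toℕ k × toℕ k ℕ.< toℕ p) w
  descends-bounds [] = []
  descends-bounds (k ∷ D) =
    (subst (_ ℕ.≤_) (Fin.toℕ-inject₁ k) (descends-≤ D) , ℕ.≤-refl) ∷
    All.map (λ (l , u) → l , ℕ.m≤n⇒m≤1+n (subst (_ ℕ.<_) (Fin.toℕ-inject₁ k) u)) (descends-bounds D)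

  -- With this, identities between the filtered lists in Ξ_i reduce to exhibiting two derivations
  -- with the same ends.
  descends-unique : ∀ {m} {p e : Fin (suc m)} {w w′} → Descends p e w → Descends p e w′ → w ≡ w′
  descends-unique []      []       = refl
  descends-unique []      (k ∷ D′) = ⊥-elim (ℕ.<⇒≱ (ℕ.≤-reflexive (cong suc (Fin.toℕ-inject₁ k))) (descends-≤ D′))
  descends-unique (k ∷ D) []       = ⊥-elim (ℕ.<⇒≱ (ℕ.≤-reflexive (cong suc (Fin.toℕ-inject₁ k))) (descends-≤ D))
  descends-unique (k ∷ D) (.k ∷ D′) = cong (k ∷_) (descends-unique D D′)

  descends-∷ʳ : ∀ {m} {p : Fin (suc m)} {k w} → Descends p (suc k) w → Descends p (inject₁ k) (w ∷ʳ k)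
  descends-∷ʳ {k = k} [] = k ∷ []
  descends-∷ʳ (j ∷ D)    = j ∷ descends-∷ʳ D

  descends-suc : ∀ {m} {p e : Fin (suc m)} {w} → Descends p e w → Descends (suc p) (suc e) (map suc w)
  descends-suc []      = []
  descends-suc (k ∷ D) = suc k ∷ descends-suc D

  -- The two words in the definition of Ξ_i: `before` holds the indices of the inverse operators,
  -- `after` those of the operators following 𝐰.
  before after : ∀ {m} → Fin (suc m) → Word m
  before i = reverse (filter (λ k → toℕ k ℕ.<? toℕ i) (allFin _))
  after  i = reverse (filter (λ k → toℕ i ℕ.≤? toℕ k) (allFin _))

  private

    filter-allFin-suc : ∀ {m} {P : Fin (suc m) → Set} (P? : ∀ k → Dec (P k)) →
                        filter P? (List.tabulate {n = m} suc) ≡ map suc (filter (P? ∘ suc) (allFin m))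
    filter-allFin-suc P? = trans (cong (filter P?) (sym (List.map-tabulate id suc))) (filter-map (allFin _))
      where
      filter-map : ∀ xs → filter P? (map suc xs) ≡ map suc (filter (P? ∘ suc) xs)
      filter-map [] = refl
      filter-map (x ∷ xs) with does (P? (suc x))
      ... | true  = cong (suc x ∷_) (filter-map xs)
      ... | false = filter-map xs

    filter-cong : ∀ {a} {A : Set a} {P Q : A → Set} (P? : ∀ x → Dec (P x)) (Q? : ∀ x → Dec (Q x)) →
                  (∀ x → P x → Q x) → (∀ x → Q x → P x) → ∀ xs → filter P? xs ≡ filter Q? xs
    filter-cong P? Q? pq qp = List.filter-≐ P? Q? ((λ {x} → pq x) , (λ {x} → qp x))

  reverse-map-suc : ∀ {m} (xs : List (Fin m)) → reverse (Fin.zero ∷ map Fin.suc xs) ≡ map Fin.suc (reverse xs) ∷ʳ Fin.zero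
  reverse-map-suc xs = trans (List.unfold-reverse Fin.zero (map Fin.suc xs))
    (cong (_∷ʳ Fin.zero) (sym (List.reverse-map Fin.suc xs)))

  descends-after : ∀ {m} (i : Fin (suc m)) → Descends (fromℕ m) i (after i)
  descends-after {zero}  zero    = []
  descends-after {suc m} zero    = subst (Descends _ zero) eq (descends-∷ʳ (descends-suc (descends-after {m} zero)))
    where
    eq : map suc (after zero) ∷ʳ zero ≡ after zero
    eq = trans (cong (λ xs → map suc (reverse xs) ∷ʳ zero) (trans
        (List.filter-all (λ k → 0 ℕ.≤? toℕ k) (All.universal (λ _ → z≤n) (allFin m))) refl))
      (trans (sym (reverse-map-suc (allFin m))) (cong reverse (trans (cong (zero ∷_) (List.map-tabulate id suc))
        (sym (List.filter-all (λ k → 0 ℕ.≤? toℕ k) (All.universal (λ _ → z≤n) (allFin (suc m))))))))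
  descends-after {suc m} (suc i) = subst (Descends _ (suc i)) eq (descends-suc (descends-after i))
    where
    eq : map suc (after i) ≡ after (suc i)
    eq = trans (List.reverse-map suc (filter (λ k → toℕ i ℕ.≤? toℕ k) (allFin m))) (cong reverse
      (trans (cong (map suc) (filter-cong (λ k → toℕ i ℕ.≤? toℕ k) (λ k → suc (toℕ i) ℕ.≤? suc (toℕ k)) (λ _ → s≤s)
        (λ _ → ℕ.s≤s⁻¹) (allFin m)))
        (sym (filter-allFin-suc (λ k → suc (toℕ i) ℕ.≤? toℕ k)))))

  descends-before : ∀ {m} (i : Fin (suc m)) → Descends i zero (before i)
  descends-before {m} zero = subst (Descends zero zero) (cong reverse
    (sym (List.filter-none (λ k → toℕ k ℕ.<? 0) (All.universal (λ _ ()) (allFin m))))) []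
  descends-before {suc m} (suc i) = subst (Descends (suc i) zero) eq (descends-∷ʳ (descends-suc (descends-before i)))
    where
    eq : map suc (before i) ∷ʳ zero ≡ before (suc i)
    eq = trans (sym (reverse-map-suc (filter (λ k → toℕ k ℕ.<? toℕ i) (allFin m)))) (cong (λ xs → reverse (zero ∷ xs))
      (trans (cong (map suc) (filter-cong (λ k → toℕ k ℕ.<? toℕ i) (λ k → suc (toℕ k) ℕ.<? suc (toℕ i)) (λ _ → s≤s)
        (λ _ → ℕ.s≤s⁻¹) (allFin m)))
        (sym (filter-allFin-suc (λ k → toℕ k ℕ.<? suc (toℕ i))))))

  before-suc : ∀ {m} (k : Fin m) → before (suc k) ≡ k ∷ before (inject₁ k)
  before-suc k = descends-unique (descends-before (suc k)) (k ∷ descends-before (inject₁ k))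

  after-inject₁ : ∀ {m} (k : Fin m) → after (inject₁ k) ≡ after (suc k) ∷ʳ k
  after-inject₁ k = descends-unique (descends-after (inject₁ k)) (descends-∷ʳ (descends-after (suc k)))

  after-last : ∀ {m} → after (fromℕ m) ≡ []
  after-last = descends-unique (descends-after _) []

  before-last : ∀ {m} → before (fromℕ m) ≡ reverse (allFin m)
  before-last {m} = cong reverse (List.filter-all (λ k → toℕ k ℕ.<? toℕ (fromℕ m))
    (All.universal (λ k → subst (toℕ k ℕ.<_) (sym (Fin.toℕ-fromℕ m)) (Fin.toℕ<n k)) (allFin m)))

-- Every letter exchanges a strict ascent, so equal entries are never exchanged. The reduced words
-- of `r v` are of this kind by `reduced⇒sorts`.
data Sorts {m} : Vec ℕ (suc m) → Word m → Set where
  []  : ∀ {v} → (∀ k → lookup v (suc k) ℕ.≤ lookup v (inject₁ k)) → Sorts v []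
  _∷_ : ∀ {v k w} → lookup v (inject₁ k) ℕ.< lookup v (suc k) → Sorts (swapAt k v) w → Sorts v (k ∷ w)

does-mono : ∀ {p q} {P : Set p} {Q : Set q} (P? : Dec P) (Q? : Dec Q) → (P → Q) → does P? ≡ true → does Q? ≡ true
does-mono (yes p) Q? f _ = dec-true Q? (f p)
does-mono (no _)  Q? f ()

-- Hecke relations in an abstract monoid

module Products {c ℓ} (G : Monoid c ℓ) where

  open Monoid G
  open import Data.List.Base using (_∷ʳ_)
  open import Tactic.MonoidSolver using (solve)
  open SetoidReasoning setoid

  prod : ∀ {a} {I : Set a} → (I → Carrier) → List I → Carrier
  prod f = foldr (λ k x → f k ∙ x) ε

  Commute : Carrier → Carrier → Set ℓ
  Commute x y = x ∙ y ≈ y ∙ x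

  module _ {a} {I : Set a} where

    prod-∷ʳ : ∀ (f : I → Carrier) xs k → prod f (xs ∷ʳ k) ≈ prod f xs ∙ f k
    prod-∷ʳ f []       k = trans (identityʳ _) (sym (identityˡ _))
    prod-∷ʳ f (j ∷ xs) k = trans (∙-congˡ (prod-∷ʳ f xs k)) (sym (assoc _ _ _))

    prod-cong : ∀ {f g : I → Carrier} {xs} → All (λ k → f k ≈ g k) xs → prod f xs ≈ prod g xs
    prod-cong []         = refl
    prod-cong (eq ∷ eqs) = ∙-cong eq (prod-cong eqs)

    prod-commute : ∀ {f : I → Carrier} {x xs} → All (λ k → Commute (f k) x) xs → Commute (prod f xs) x
    prod-commute []         = trans (identityˡ _) (sym (identityʳ _))
    prod-commute {f} {x} {k ∷ xs} (eq ∷ eqs) = begin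
      (f k ∙ prod f xs) ∙ x ≈⟨ assoc _ _ _ ⟩
      f k ∙ (prod f xs ∙ x) ≈⟨ ∙-congˡ (prod-commute eqs) ⟩
      f k ∙ (x ∙ prod f xs) ≈⟨ assoc _ _ _ ⟨
      (f k ∙ x) ∙ prod f xs ≈⟨ ∙-congʳ eq ⟩
      (x ∙ f k) ∙ prod f xs ≈⟨ assoc _ _ _ ⟩
      x ∙ (f k ∙ prod f xs) ∎

    prod-inverse : ∀ (f g : I → Carrier) → (∀ k → f k ∙ g k ≈ ε) → ∀ xs → prod f (reverse xs) ∙ prod g xs ≈ ε
    prod-inverse f g fg []       = identityˡ _
    prod-inverse f g fg (k ∷ xs) = begin
      prod f (reverse (k ∷ xs)) ∙ (g k ∙ prod g xs)
        ≈⟨ ∙-congʳ (trans (reflexive (cong (prod f) (List.unfold-reverse k xs))) (prod-∷ʳ f (reverse xs) k)) ⟩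
      prod f (reverse xs) ∙ f k ∙ (g k ∙ prod g xs) ≈⟨ solve G ⟩
      prod f (reverse xs) ∙ (f k ∙ g k) ∙ prod g xs ≈⟨ ∙-congʳ (trans (∙-congˡ (fg k)) (identityʳ _)) ⟩
      prod f (reverse xs) ∙ prod g xs               ≈⟨ prod-inverse f g fg xs ⟩
      ε                                             ∎

  -- `y` moves left through the word: it commutes with the letters below k, becomes `x` on passing
  -- the block of k + 1 and k, and as `x` commutes with the letters above. Outside the block `f` and
  -- `f′` agree.
  prod-shift : ∀ {m} (k : Fin m) (x y : Carrier) (f f′ : Fin (suc m) → Carrier) →
               (∀ j → j ≢ inject₁ k → j ≢ suc k → f j ≈ f′ j) →
               (∀ j → toℕ j ℕ.< toℕ k → Commute (f′ j) y) →
               (∀ j → suc (toℕ k) ℕ.< toℕ j → Commute (f j) x) →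
               f (suc k) ∙ f (inject₁ k) ∙ y ≈ x ∙ f′ (suc k) ∙ f′ (inject₁ k) →
               ∀ {p e w} → Descends p e w → toℕ e ℕ.≤ toℕ k → suc (toℕ k) ℕ.< toℕ p →
               prod f w ∙ y ≈ x ∙ prod f′ w
  prod-shift k x y f f′ same below above local [] e≤k k<p = ⊥-elim (ℕ.<⇒≱ k<p (ℕ.≤-trans e≤k (ℕ.n≤1+n _)))
  prod-shift k x y f f′ same below above local {w = j ∷ w} (.j ∷ D) e≤k k<p with j Fin.≟ suc k
  ... | no j≢ = begin
    (f j ∙ prod f w) ∙ y   ≈⟨ assoc _ _ _ ⟩
    f j ∙ (prod f w ∙ y)
      ≈⟨ ∙-congˡ (prod-shift k x y f f′ same below above local D e≤k
        (subst (suc (toℕ k) ℕ.<_) (≡.sym (Fin.toℕ-inject₁ j)) k<j)) ⟩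
    f j ∙ (x ∙ prod f′ w)  ≈⟨ assoc _ _ _ ⟨
    (f j ∙ x) ∙ prod f′ w  ≈⟨ ∙-congʳ (above j k<j) ⟩
    (x ∙ f j) ∙ prod f′ w  ≈⟨ ∙-congʳ (∙-congˡ (same j j≢k j≢)) ⟩
    (x ∙ f′ j) ∙ prod f′ w ≈⟨ assoc _ _ _ ⟩
    x ∙ (f′ j ∙ prod f′ w) ∎
    where
    k<j : suc (toℕ k) ℕ.< toℕ j
    k<j = ℕ.≤∧≢⇒< (ℕ.s≤s⁻¹ k<p) λ eq → j≢ (Fin.toℕ-injective (≡.sym eq))
    j≢k : j ≢ inject₁ k
    j≢k ≡.refl = ℕ.<⇒≱ k<j (ℕ.≤-trans (ℕ.≤-reflexive (Fin.toℕ-inject₁ k)) (ℕ.n≤1+n _))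
  ... | yes ≡.refl with D
  ...   | [] = ⊥-elim (ℕ.<⇒≱ (s≤s (ℕ.≤-reflexive (≡.sym (Fin.toℕ-inject₁ k)))) e≤k)
  ...   | _∷_ {w = w′} _ D′ = begin
    (f (suc k) ∙ (f (inject₁ k) ∙ prod f w′)) ∙ y    ≈⟨ solve G ⟩
    (f (suc k) ∙ f (inject₁ k)) ∙ (prod f w′ ∙ y)
      ≈⟨ ∙-congˡ (trans (∙-congʳ (prod-cong same′)) (prod-commute (All.map (below _) bounds))) ⟩
    (f (suc k) ∙ f (inject₁ k)) ∙ (y ∙ prod f′ w′)   ≈⟨ assoc _ _ _ ⟨
    (f (suc k) ∙ f (inject₁ k) ∙ y) ∙ prod f′ w′     ≈⟨ ∙-congʳ local ⟩
    (x ∙ f′ (suc k) ∙ f′ (inject₁ k)) ∙ prod f′ w′   ≈⟨ solve G ⟩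
    x ∙ (f′ (suc k) ∙ (f′ (inject₁ k) ∙ prod f′ w′)) ∎
    where
    bounds : All (λ j → toℕ j ℕ.< toℕ k) w′
    bounds = All.map (λ {j} (_ , u) → subst (toℕ j ℕ.<_) (≡.trans (Fin.toℕ-inject₁ (inject₁ k))
      (Fin.toℕ-inject₁ k)) u) (descends-bounds D′)
    same′ : All (λ j → f j ≈ f′ j) w′
    same′ = All.map (λ {j} j<k → same j
      (λ { ≡.refl → ℕ.<-irrefl (Fin.toℕ-inject₁ k) j<k })
      (λ { ≡.refl → ℕ.<⇒≱ j<k (ℕ.n≤1+n _) })) bounds

-- The relations between the operators T_k (t), s (σ) and the Jucys–Murphy elements (D), with κ i = s^{i - N}.
module HeckeRelations {c ℓ} (G : Monoid c ℓ) where

  open Monoid G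
  open import Data.List.Base using (_∷ʳ_)
  open import Tactic.MonoidSolver using (solve)
  open Products G

  record IsHecke {n} (t t⁻¹ : Fin (suc n) → Carrier) (σ σ⁻¹ : Carrier)
                 (κ D : Fin (suc (suc n)) → Carrier) : Set (c ⊔ ℓ) where
    field
      inverseˡ  : ∀ k → t⁻¹ k ∙ t k ≈ ε
      inverseʳ  : ∀ k → t k ∙ t⁻¹ k ≈ ε
      far       : ∀ k j → suc (suc (toℕ k)) ℕ.≤ toℕ j → Commute (t k) (t j)
      braid     : ∀ k → t (inject₁ k) ∙ t (suc k) ∙ t (inject₁ k) ≈ t (suc k) ∙ t (inject₁ k) ∙ t (suc k)
      σ-central   : ∀ x → Commute σ x
      σ⁻¹-central : ∀ x → Commute σ⁻¹ x
      κ-central   : ∀ i x → Commute (κ i) x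
      σ⁻¹σ      : σ⁻¹ ∙ σ ≈ ε
      κ-suc     : ∀ k → κ (suc k) ≈ σ ∙ κ (inject₁ k)
      κ-last    : κ (fromℕ _) ≈ ε
      D-last    : D (fromℕ _) ≈ ε
      D-step    : ∀ k → t k ∙ D (suc k) ∙ t k ≈ σ ∙ D (inject₁ k)

  module _ {n} {t t⁻¹ : Fin (suc n) → Carrier} {σ σ⁻¹} {κ D : Fin (suc (suc n)) → Carrier}
           (isHecke : IsHecke t t⁻¹ σ σ⁻¹ κ D) where

    open IsHecke isHecke
    open SetoidReasoning setoid

    cancelʳ : ∀ k {x y} → x ∙ t k ≈ y → x ≈ y ∙ t⁻¹ k
    cancelʳ k {x} {y} eq = begin
      x                  ≈⟨ identityʳ x ⟨
      x ∙ ε              ≈⟨ ∙-congˡ (inverseʳ k) ⟨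
      x ∙ (t k ∙ t⁻¹ k)  ≈⟨ assoc _ _ _ ⟨
      (x ∙ t k) ∙ t⁻¹ k  ≈⟨ ∙-congʳ eq ⟩
      y ∙ t⁻¹ k          ∎

    cancelˡ : ∀ k {x y} → t k ∙ x ≈ y → x ≈ t⁻¹ k ∙ y
    cancelˡ k {x} {y} eq = begin
      x                  ≈⟨ identityˡ x ⟨
      ε ∙ x              ≈⟨ ∙-congʳ (inverseˡ k) ⟨
      (t⁻¹ k ∙ t k) ∙ x  ≈⟨ assoc _ _ _ ⟩
      t⁻¹ k ∙ (t k ∙ x)  ≈⟨ ∙-congˡ eq ⟩
      t⁻¹ k ∙ y          ∎

    commute-t⁻¹ : ∀ k {x} → Commute (t k) x → Commute (t⁻¹ k) x
    commute-t⁻¹ k {x} eq = sym (begin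
      x ∙ t⁻¹ k  ≈⟨ cancelˡ k (begin
        t k ∙ (x ∙ t⁻¹ k)  ≈⟨ assoc _ _ _ ⟨
        (t k ∙ x) ∙ t⁻¹ k  ≈⟨ cancelʳ k (sym eq) ⟨
        x                  ∎) ⟩
      t⁻¹ k ∙ x  ∎)

    -- T_k or its inverse, with a central factor. The Boolean records how a carried entry compares
    -- with the entry it passes.
    letter : Carrier → Carrier → Bool → Fin (suc n) → Carrier
    letter hi lo b k = if b then hi ∙ t⁻¹ k else lo ∙ t k

    Central : Carrier → Set (c ⊔ ℓ)
    Central z = ∀ x → Commute z x

    ε-central : Central ε
    ε-central x = trans (identityˡ x) (sym (identityʳ x))

    central-∙ : ∀ {z x y} → Central z → Commute x y → Commute (z ∙ x) y
    central-∙ {z} {x} {y} central eq = begin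
      (z ∙ x) ∙ y ≈⟨ assoc _ _ _ ⟩
      z ∙ (x ∙ y) ≈⟨ central _ ⟩
      (x ∙ y) ∙ z ≈⟨ ∙-congʳ eq ⟩
      (y ∙ x) ∙ z ≈⟨ assoc _ _ _ ⟩
      y ∙ (x ∙ z) ≈⟨ ∙-congˡ (central x) ⟨
      y ∙ (z ∙ x) ∎

    letter-commute : ∀ {hi lo} → Central hi → Central lo → ∀ b k {x} → Commute (t k) x → Commute (letter hi lo b k) x
    letter-commute hic loc true  k eq = central-∙ hic (commute-t⁻¹ k eq)
    letter-commute hic loc false k eq = central-∙ loc eq

    private

      scalars : ∀ {z z′ x y u x′ y′ u′} → Central z → Central z′ → x ∙ y ∙ u ≈ x′ ∙ y′ ∙ u′ →
                (z ∙ x) ∙ (z′ ∙ y) ∙ u ≈ (z ∙ z′) ∙ (x′ ∙ y′ ∙ u′)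
      scalars {z} {z′} {x} {y} {u} {x′} {y′} {u′} zc zc′ eq = begin
        (z ∙ x) ∙ (z′ ∙ y) ∙ u      ≈⟨ solve G ⟩
        z ∙ (x ∙ z′) ∙ (y ∙ u)      ≈⟨ ∙-congʳ (∙-congˡ (zc′ x)) ⟨
        z ∙ (z′ ∙ x) ∙ (y ∙ u)      ≈⟨ solve G ⟩
        (z ∙ z′) ∙ (x ∙ y ∙ u)      ≈⟨ ∙-congˡ eq ⟩
        (z ∙ z′) ∙ (x′ ∙ y′ ∙ u′)   ∎

      scalars′ : ∀ {z z′ x y u} → Central z → Central z′ → (z ∙ z′) ∙ (x ∙ y ∙ u) ≈ x ∙ (z′ ∙ y) ∙ (z ∙ u)
      scalars′ {z} {z′} {x} {y} {u} zc zc′ = begin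
        (z ∙ z′) ∙ (x ∙ y ∙ u)      ≈⟨ solve G ⟩
        z ∙ (z′ ∙ x ∙ y ∙ u)        ≈⟨ zc _ ⟩
        (z′ ∙ x ∙ y ∙ u) ∙ z        ≈⟨ solve G ⟩
        (z′ ∙ x) ∙ (y ∙ (u ∙ z))    ≈⟨ ∙-cong (sym (zc′ x)) (∙-congˡ (zc u)) ⟨
        (x ∙ z′) ∙ (y ∙ (z ∙ u))    ≈⟨ solve G ⟩
        x ∙ (z′ ∙ y) ∙ (z ∙ u)      ∎

    -- Three sign patterns follow from the braid relation by moving inverses across. The fourth
    -- would be y x⁻¹ y = x y⁻¹ x, which fails in the braid group; the implication between `b` and
    -- `b′` excludes it.
    letter-braid : ∀ {hi lo} → Central hi → Central lo → ∀ {b b′} → (b ≡ true → b′ ≡ true) → ∀ k →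
                   letter hi lo b′ (suc k) ∙ letter hi lo b (inject₁ k) ∙ t (suc k) ≈
                   t (inject₁ k) ∙ letter hi lo b (suc k) ∙ letter hi lo b′ (inject₁ k)
    letter-braid hic loc {false} {false} _ k = trans (scalars loc loc (sym (braid k))) (scalars′ loc loc)
    letter-braid hic loc {true} {false} b⇒b′ k with b⇒b′ ≡.refl
    ... | ()
    letter-braid hic loc {false} {true} _ k = trans (scalars hic loc mixed) (scalars′ hic loc)
      where
      x = t (inject₁ k)
      y = t (suc k)
      X = t⁻¹ (inject₁ k)
      Y = t⁻¹ (suc k)
      mixed : Y ∙ x ∙ y ≈ x ∙ y ∙ X
      mixed = begin
        Y ∙ x ∙ y   ≈⟨ assoc _ _ _ ⟩
        Y ∙ (x ∙ y) ≈⟨ cancelˡ (suc k) (trans reassoc (sym (cancelʳ (inject₁ k) (braid k)))) ⟨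
        x ∙ y ∙ X   ∎
        where
        reassoc : y ∙ (x ∙ y ∙ X) ≈ (y ∙ x ∙ y) ∙ X
        reassoc = solve G
    letter-braid hic loc {true} {true} _ k = trans (scalars hic hic both) (scalars′ hic hic)
      where
      x = t (inject₁ k)
      y = t (suc k)
      X = t⁻¹ (inject₁ k)
      Y = t⁻¹ (suc k)
      both : Y ∙ X ∙ y ≈ x ∙ Y ∙ X
      both = begin
        Y ∙ X ∙ y         ≈⟨ assoc _ _ _ ⟩
        Y ∙ (X ∙ y)       ≈⟨ cancelˡ (suc k) (cancelˡ (inject₁ k) (begin
          x ∙ (y ∙ (x ∙ Y ∙ X))   ≈⟨ solve G ⟩
          (x ∙ y ∙ x) ∙ Y ∙ X     ≈⟨ ∙-congʳ (∙-congʳ (braid k)) ⟩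
          (y ∙ x ∙ y) ∙ Y ∙ X     ≈⟨ ∙-congʳ (cancelʳ (suc k) refl) ⟨
          (y ∙ x) ∙ X             ≈⟨ cancelʳ (inject₁ k) refl ⟨
          y                       ∎)) ⟨
        x ∙ Y ∙ X         ∎

    private

      asc : ∀ {m} → (Fin m → Carrier) → Carrier
      asc {zero}  g = ε
      asc {suc m} g = g zero ∙ asc (g ∘ suc)

      asc-commute : ∀ {m} (g : Fin m → Carrier) {x} → (∀ k → Commute (g k) x) → Commute (asc g) x
      asc-commute {zero}  g eq = ε-central _
      asc-commute {suc m} g {x} eq = begin
        (g zero ∙ asc (g ∘ suc)) ∙ x  ≈⟨ assoc _ _ _ ⟩
        g zero ∙ (asc (g ∘ suc) ∙ x)  ≈⟨ ∙-congˡ (asc-commute (g ∘ suc) (eq ∘ suc)) ⟩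
        g zero ∙ (x ∙ asc (g ∘ suc))  ≈⟨ assoc _ _ _ ⟨
        (g zero ∙ x) ∙ asc (g ∘ suc)  ≈⟨ ∙-congʳ (eq zero) ⟩
        (x ∙ g zero) ∙ asc (g ∘ suc)  ≈⟨ assoc _ _ _ ⟩
        x ∙ (g zero ∙ asc (g ∘ suc))  ∎

      -- The letter passes the tail by commutation, meets its braid partner and emerges on the left
      -- with its index raised by one.
      asc-shift : ∀ {m} (g : Fin (suc m) → Carrier) →
                  (∀ k j → suc (suc (toℕ k)) ℕ.≤ toℕ j → Commute (g k) (g j)) →
                  (∀ k → g (inject₁ k) ∙ g (suc k) ∙ g (inject₁ k) ≈ g (suc k) ∙ g (inject₁ k) ∙ g (suc k)) →
                  ∀ k → asc g ∙ g (inject₁ k) ≈ g (suc k) ∙ asc g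
      asc-shift {suc m} g gfar gbraid zero = begin
        (g zero ∙ (g (suc zero) ∙ tail)) ∙ g zero      ≈⟨ solve G ⟩
        (g zero ∙ g (suc zero)) ∙ (tail ∙ g zero)
          ≈⟨ ∙-congˡ (asc-commute (λ k → g (suc (suc k))) (λ k → sym (gfar zero (suc (suc k)) (s≤s (s≤s z≤n))))) ⟩
        (g zero ∙ g (suc zero)) ∙ (g zero ∙ tail)      ≈⟨ assoc _ _ _ ⟨
        (g zero ∙ g (suc zero) ∙ g zero) ∙ tail        ≈⟨ ∙-congʳ (gbraid zero) ⟩
        (g (suc zero) ∙ g zero ∙ g (suc zero)) ∙ tail  ≈⟨ solve G ⟩
        g (suc zero) ∙ (g zero ∙ (g (suc zero) ∙ tail)) ∎
        where tail = asc {m} (λ k → g (suc (suc k)))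
      asc-shift g gfar gbraid (suc k) = begin
        (g zero ∙ tail) ∙ g (inject₁ (suc k))  ≈⟨ assoc _ _ _ ⟩
        g zero ∙ (tail ∙ g (inject₁ (suc k)))
          ≈⟨ ∙-congˡ (asc-shift (g ∘ suc) (λ i j i≤j → gfar (suc i) (suc j) (s≤s i≤j)) (gbraid ∘ suc) k) ⟩
        g zero ∙ (g (suc (suc k)) ∙ tail)      ≈⟨ assoc _ _ _ ⟨
        (g zero ∙ g (suc (suc k))) ∙ tail      ≈⟨ ∙-congʳ (gfar zero (suc (suc k)) (s≤s (s≤s z≤n))) ⟩
        (g (suc (suc k)) ∙ g zero) ∙ tail      ≈⟨ assoc _ _ _ ⟩
        g (suc (suc k)) ∙ (g zero ∙ tail)      ∎
        where tail = asc (g ∘ suc)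

      prod-tabulate : ∀ {m} {I : Set} (f : I → Carrier) (g : Fin m → I) → prod f (List.tabulate g) ≡ asc (f ∘ g)
      prod-tabulate {zero}  f g = ≡.refl
      prod-tabulate {suc m} f g = cong (f (g zero) ∙_) (prod-tabulate f (g ∘ suc))

    cycle : Carrier
    cycle = prod t (allFin (suc n))

    cycle-shift : ∀ k → cycle ∙ t (inject₁ k) ≈ t (suc k) ∙ cycle
    cycle-shift k = begin
      cycle ∙ t (inject₁ k) ≡⟨ cong (_∙ t (inject₁ k)) (prod-tabulate t id) ⟩
      asc t ∙ t (inject₁ k) ≈⟨ asc-shift t far braid k ⟩
      t (suc k) ∙ asc t     ≡⟨ cong (t (suc k) ∙_) (prod-tabulate t id) ⟨
      t (suc k) ∙ cycle     ∎

    -- The factor on V_λ left in the leading term when an entry `c` is carried past an entry `a`, by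
    -- an inverse operator in `upLetter` and by 𝐓_k in `downLetter`. On a tie the letter is T_k⁻¹ in
    -- the first and T_k in the second, hence the weak and the strict comparison.
    upLetter downLetter : ℕ → ℕ → Fin (suc n) → Carrier
    upLetter   c a k = letter ε σ⁻¹ (does (c ℕ.≤? a)) k
    downLetter c a k = letter σ ε (does (c ℕ.<? a)) k

    up down : Vec ℕ (suc (suc n)) → Fin (suc (suc n)) → Fin (suc n) → Carrier
    up   v i k = upLetter (lookup v i) (lookup v (inject₁ k)) k
    down v i k = downLetter (lookup v i) (lookup v (suc k)) k

    -- The operator on V_λ by which Ξ_i / q^{v_i} acts on the leading term x^v ⊗ u.
    loop : Vec ℕ (suc (suc n)) → Fin (suc (suc n)) → Carrier
    loop v i = κ i ∙ (prod (up v i) (before i) ∙ (cycle ∙ prod (down v i) (after i)))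

    private

      module Swap (v : Vec ℕ (suc (suc n))) (k : Fin (suc n)) (ascent : lookup v (inject₁ k) ℕ.< lookup v (suc k)) where

        v′ : Vec ℕ (suc (suc n))
        v′ = swapAt k v

        v′-left : lookup v′ (inject₁ k) ≡ lookup v (suc k)
        v′-left = ≡.trans (lookup-swapAt k v _) (cong (lookup v) (adjacent-inject₁ k))

        v′-right : lookup v′ (suc k) ≡ lookup v (inject₁ k)
        v′-right = ≡.trans (lookup-swapAt k v _) (cong (lookup v) (adjacent-suc k))

        v′-other : ∀ {i} → i ≢ inject₁ k → i ≢ suc k → lookup v i ≡ lookup v′ i
        v′-other p q = ≡.sym (≡.trans (lookup-swapAt k v _) (cong (lookup v) (adjacent-other k p q)))

        up-≡ : ∀ {i i′ j j′} l → lookup v i ≡ lookup v′ i′ → lookup v j ≡ lookup v′ j′ →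
               letter ε σ⁻¹ (does (lookup v i ℕ.≤? lookup v j)) l ≈ letter ε σ⁻¹ (does (lookup v′ i′ ℕ.≤? lookup v′ j′)) l
        up-≡ l p q = reflexive (cong₂ (λ a b → letter ε σ⁻¹ (does (a ℕ.≤? b)) l) p q)

        down-≡ : ∀ {i i′ j j′} l → lookup v i ≡ lookup v′ i′ → lookup v j ≡ lookup v′ j′ →
                 letter σ ε (does (lookup v i ℕ.<? lookup v j)) l ≈ letter σ ε (does (lookup v′ i′ ℕ.<? lookup v′ j′)) l
        down-≡ l p q = reflexive (cong₂ (λ a b → letter σ ε (does (a ℕ.<? b)) l) p q)

        <⇒≢ : ∀ {i j : Fin (suc (suc n))} → toℕ i ℕ.< toℕ j → i ≢ j
        <⇒≢ i<j ≡.refl = ℕ.<-irrefl ≡.refl i<j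

        ups : ∀ {i i′ e} → lookup v i ≡ lookup v′ i′ → toℕ e ℕ.≤ toℕ k → All (λ l → up v i l ≈ up v′ i′ l) (before e)
        ups {e = e} p e≤k = All.map
          (λ {l} (_ , l<e) → let l<k = ≡.subst₂ ℕ._<_ (≡.sym (Fin.toℕ-inject₁ l)) (≡.sym (Fin.toℕ-inject₁ k)) (ℕ.<-≤-trans l<e e≤k) in
             up-≡ l p (v′-other (<⇒≢ l<k) (<⇒≢ (ℕ.<-trans l<k (inject₁<suc k)))))
          (descends-bounds (descends-before e))

        downs : ∀ {i i′ e} → lookup v i ≡ lookup v′ i′ → toℕ k ℕ.< toℕ e → All (λ l → down v i l ≈ down v′ i′ l) (after e)
        downs {e = e} p k<e = All.map
          (λ {l} (e≤l , _) → let k<l = s≤s (ℕ.<-≤-trans k<e e≤l) in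
             down-≡ l p (v′-other (<⇒≢ (ℕ.<-trans (inject₁<suc k) k<l) ∘ ≡.sym) (<⇒≢ k<l ∘ ≡.sym)))
          (descends-bounds (descends-after e))

        -- The ascent makes the last letter of `loop v (inject₁ k)` equal to s T_k⁻¹, which cancels
        -- T_k up to the factor s. That factor turns κ_k into κ_{k+1}, and inserting T_k T_k⁻¹
        -- supplies the first letter of the other loop.
        at-left : loop v (inject₁ k) ∙ t k ≈ t k ∙ loop v′ (suc k)
        at-left = begin
          (κ (inject₁ k) ∙ (P ∙ (cycle ∙ prod (down v (inject₁ k)) (after (inject₁ k))))) ∙ t k
            ≈⟨ ∙-congʳ (∙-congˡ (∙-cong (prod-cong (ups eq (ℕ.≤-reflexive (Fin.toℕ-inject₁ k)))) (∙-congˡ Q≈))) ⟩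
          (κ (inject₁ k) ∙ (P′ ∙ (cycle ∙ (Q′ ∙ (σ ∙ t⁻¹ k))))) ∙ t k
            ≈⟨ solve G ⟩
          (κ (inject₁ k) ∙ P′ ∙ cycle ∙ Q′) ∙ (σ ∙ (t⁻¹ k ∙ t k))
            ≈⟨ ∙-congˡ (trans (∙-congˡ (inverseˡ k)) (identityʳ σ)) ⟩
          (κ (inject₁ k) ∙ P′ ∙ cycle ∙ Q′) ∙ σ
            ≈⟨ σ-central _ ⟨
          σ ∙ (κ (inject₁ k) ∙ P′ ∙ cycle ∙ Q′)
            ≈⟨ solve G ⟩
          (σ ∙ κ (inject₁ k)) ∙ ε ∙ P′ ∙ cycle ∙ Q′
            ≈⟨ ∙-congʳ (∙-congʳ (∙-congʳ (∙-cong (κ-suc k) (inverseʳ k)))) ⟨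
          κ (suc k) ∙ (t k ∙ t⁻¹ k) ∙ P′ ∙ cycle ∙ Q′
            ≈⟨ solve G ⟩
          (κ (suc k) ∙ t k) ∙ (t⁻¹ k ∙ P′ ∙ cycle ∙ Q′)
            ≈⟨ ∙-congʳ (κ-central (suc k) (t k)) ⟩
          (t k ∙ κ (suc k)) ∙ (t⁻¹ k ∙ P′ ∙ cycle ∙ Q′)
            ≈⟨ solve G ⟩
          t k ∙ (κ (suc k) ∙ (((ε ∙ t⁻¹ k) ∙ P′) ∙ (cycle ∙ Q′)))
            ≈⟨ ∙-congˡ (∙-congˡ (∙-congʳ P≈)) ⟨
          t k ∙ loop v′ (suc k) ∎
          where
          eq : lookup v (inject₁ k) ≡ lookup v′ (suc k)
          eq = ≡.sym v′-right
          P P′ Q′ : Carrier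
          P  = prod (up v (inject₁ k)) (before (inject₁ k))
          P′ = prod (up v′ (suc k)) (before (inject₁ k))
          Q′ = prod (down v′ (suc k)) (after (suc k))
          Q≈ : prod (down v (inject₁ k)) (after (inject₁ k)) ≈ Q′ ∙ (σ ∙ t⁻¹ k)
          Q≈ = begin
            prod (down v (inject₁ k)) (after (inject₁ k))           ≡⟨ cong (prod (down v (inject₁ k))) (after-inject₁ k) ⟩
            prod (down v (inject₁ k)) (after (suc k) ∷ʳ k)          ≈⟨ prod-∷ʳ (down v (inject₁ k)) (after (suc k)) k ⟩
            prod (down v (inject₁ k)) (after (suc k)) ∙ down v (inject₁ k) k
              ≈⟨ ∙-cong (prod-cong (downs eq ℕ.≤-refl))
                   (reflexive (cong (λ b → letter σ ε b k) (dec-true (lookup v (inject₁ k) ℕ.<? lookup v (suc k)) ascent))) ⟩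
            Q′ ∙ (σ ∙ t⁻¹ k) ∎
          P≈ : prod (up v′ (suc k)) (before (suc k)) ≈ (ε ∙ t⁻¹ k) ∙ P′
          P≈ = trans (reflexive (cong (prod (up v′ (suc k))) (before-suc k)))
            (∙-congʳ (reflexive (cong (λ b → letter ε σ⁻¹ b k) (dec-true (lookup v′ (suc k) ℕ.≤? lookup v′ (inject₁ k))
              (≡.subst₂ ℕ._≤_ eq (≡.sym v′-left) (ℕ.<⇒≤ ascent))))))

        -- Here the first letter is s⁻¹ T_k. Its scalar absorbs the ratio of κ_{k+1} to κ_k and its
        -- T_k moves out to the left, while the T_k on the right becomes the last letter of the
        -- other loop.
        at-right : loop v (suc k) ∙ t k ≈ t k ∙ loop v′ (inject₁ k)
        at-right = begin
          (κ (suc k) ∙ (prod (up v (suc k)) (before (suc k)) ∙ (cycle ∙ prod (down v (suc k)) (after (suc k))))) ∙ t k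
            ≈⟨ ∙-congʳ (∙-cong (κ-suc k) (∙-cong P≈ (∙-congˡ (prod-cong (downs eq ℕ.≤-refl))))) ⟩
          ((σ ∙ κ (inject₁ k)) ∙ (((σ⁻¹ ∙ t k) ∙ P′) ∙ (cycle ∙ Q′))) ∙ t k
            ≈⟨ solve G ⟩
          (σ ∙ κ (inject₁ k)) ∙ (σ⁻¹ ∙ (t k ∙ P′ ∙ cycle ∙ Q′ ∙ t k))
            ≈⟨ ∙-cong (σ-central _) (refl) ⟩
          (κ (inject₁ k) ∙ σ) ∙ (σ⁻¹ ∙ (t k ∙ P′ ∙ cycle ∙ Q′ ∙ t k))
            ≈⟨ solve G ⟩
          κ (inject₁ k) ∙ (σ ∙ σ⁻¹) ∙ t k ∙ P′ ∙ cycle ∙ Q′ ∙ t k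
            ≈⟨ ∙-congʳ (∙-congʳ (∙-congʳ (∙-congʳ (∙-congʳ (trans (∙-congˡ (trans (σ-central _) σ⁻¹σ)) (identityʳ _)))))) ⟩
          κ (inject₁ k) ∙ t k ∙ P′ ∙ cycle ∙ Q′ ∙ t k
            ≈⟨ ∙-congʳ (∙-congʳ (∙-congʳ (∙-congʳ (κ-central (inject₁ k) (t k))))) ⟩
          t k ∙ κ (inject₁ k) ∙ P′ ∙ cycle ∙ Q′ ∙ t k
            ≈⟨ solve G ⟩
          t k ∙ (κ (inject₁ k) ∙ (P′ ∙ (cycle ∙ (Q′ ∙ (ε ∙ t k)))))
            ≈⟨ ∙-congˡ (∙-congˡ (∙-congˡ (∙-congˡ Q≈))) ⟨
          t k ∙ loop v′ (inject₁ k) ∎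
          where
          eq : lookup v (suc k) ≡ lookup v′ (inject₁ k)
          eq = ≡.sym v′-left
          P′ Q′ : Carrier
          P′ = prod (up v′ (inject₁ k)) (before (inject₁ k))
          Q′ = prod (down v′ (inject₁ k)) (after (suc k))
          Q≈ : prod (down v′ (inject₁ k)) (after (inject₁ k)) ≈ Q′ ∙ (ε ∙ t k)
          Q≈ = trans (reflexive (cong (prod (down v′ (inject₁ k))) (after-inject₁ k)))
            (trans (prod-∷ʳ (down v′ (inject₁ k)) (after (suc k)) k)
              (∙-congˡ (reflexive (cong (λ b → letter σ ε b k) (dec-false (lookup v′ (inject₁ k) ℕ.<? lookup v′ (suc k))
                λ lt → ℕ.<-asym ascent (≡.subst₂ ℕ._<_ v′-left v′-right lt))))))
          P≈ : prod (up v (suc k)) (before (suc k)) ≈ (σ⁻¹ ∙ t k) ∙ P′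
          P≈ = trans (reflexive (cong (prod (up v (suc k))) (before-suc k)))
            (∙-cong (reflexive (cong (λ b → letter ε σ⁻¹ b k)
              (dec-false (lookup v (suc k) ℕ.≤? lookup v (inject₁ k)) (ℕ.<⇒≱ ascent))))
              (prod-cong (ups eq (ℕ.≤-reflexive (Fin.toℕ-inject₁ k)))))

      -- T_{k+1} becomes T_k on passing the letters after the cycle, is raised back to T_{k+1} by
      -- the cycle, and commutes with the letters before it.
      at-below : ∀ v (k : Fin n) → lookup v (inject₁ (suc k)) ℕ.< lookup v (suc (suc k)) → ∀ i → toℕ i ℕ.≤ toℕ k →
                 loop v i ∙ t (suc k) ≈ t (suc k) ∙ loop (swapAt (suc k) v) i
      at-below v k ascent i i≤k = begin
        (κ i ∙ (P ∙ (cycle ∙ Q))) ∙ t (suc k)             ≈⟨ solve G ⟩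
        (κ i ∙ P ∙ cycle) ∙ (Q ∙ t (suc k))               ≈⟨ ∙-congˡ shift ⟩
        (κ i ∙ P ∙ cycle) ∙ (t (inject₁ k) ∙ Q′)          ≈⟨ solve G ⟩
        (κ i ∙ P) ∙ (cycle ∙ t (inject₁ k)) ∙ Q′          ≈⟨ ∙-congʳ (∙-congˡ (cycle-shift k)) ⟩
        (κ i ∙ P) ∙ (t (suc k) ∙ cycle) ∙ Q′              ≈⟨ solve G ⟩
        κ i ∙ (P ∙ t (suc k)) ∙ cycle ∙ Q′                ≈⟨ ∙-congʳ (∙-congʳ (∙-congˡ commute)) ⟩
        κ i ∙ (t (suc k) ∙ P) ∙ cycle ∙ Q′                ≈⟨ solve G ⟩
        (κ i ∙ t (suc k)) ∙ P ∙ cycle ∙ Q′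
          ≈⟨ ∙-congʳ (∙-congʳ (∙-cong (κ-central i _) (prod-cong (ups i≡ (ℕ.m≤n⇒m≤1+n i≤k))))) ⟩
        (t (suc k) ∙ κ i) ∙ P′ ∙ cycle ∙ Q′               ≈⟨ solve G ⟩
        t (suc k) ∙ (κ i ∙ (P′ ∙ (cycle ∙ Q′)))           ∎
        where
        open Swap v (suc k) ascent
        P P′ Q Q′ : Carrier
        P  = prod (up v i) (before i)
        P′ = prod (up v′ i) (before i)
        Q  = prod (down v i) (after i)
        Q′ = prod (down v′ i) (after i)
        i<k : toℕ i ℕ.< toℕ (inject₁ (suc k))
        i<k = s≤s (ℕ.≤-trans i≤k (ℕ.≤-reflexive (≡.sym (Fin.toℕ-inject₁ k))))
        i≡ : lookup v i ≡ lookup v′ i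
        i≡ = v′-other (<⇒≢ i<k) (<⇒≢ (ℕ.<-trans i<k (inject₁<suc (suc k))))
        commute : Commute P (t (suc k))
        commute = prod-commute (All.map
          (λ {l} (_ , l<i) → letter-commute ε-central σ⁻¹-central _ l (far l (suc k) (s≤s (ℕ.<-≤-trans l<i i≤k))))
          (descends-bounds (descends-before i)))
        shift : Q ∙ t (suc k) ≈ t (inject₁ k) ∙ Q′
        shift = prod-shift k (t (inject₁ k)) (t (suc k)) (down v i) (down v′ i)
          (λ j p q → down-≡ j i≡ (v′-other (p ∘ Fin.suc-injective) (q ∘ Fin.suc-injective)))
          (λ j j<k → letter-commute σ-central ε-central _ j (far j (suc k) (s≤s j<k)))
          (λ j k<j → letter-commute σ-central ε-central _ j (sym
            (far (inject₁ k) j (subst (λ x → suc (suc x) ℕ.≤ toℕ j) (≡.sym (Fin.toℕ-inject₁ k)) k<j))))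
          (trans (letter-braid σ-central ε-central monotone k)
            (∙-cong (∙-congˡ (down-≡ (suc k) i≡ (≡.sym v′-right))) (down-≡ (inject₁ k) i≡ (≡.sym v′-left))))
          (descends-after i) i≤k (subst (suc (toℕ k) ℕ.<_) (≡.sym (Fin.toℕ-fromℕ (suc n))) (s≤s (Fin.toℕ<n k)))
          where
          -- The ascent of `v` excludes exactly the sign pattern that has no braid relation.
          monotone : does (lookup v i ℕ.<? lookup v (suc (inject₁ k))) ≡ true →
            does (lookup v i ℕ.<? lookup v (suc (suc k))) ≡ true
          monotone = does-mono (lookup v i ℕ.<? lookup v (suc (inject₁ k)))
            (lookup v i ℕ.<? lookup v (suc (suc k))) (λ lt → ℕ.<-trans lt ascent)

      -- The mirror image: T_k commutes with the letters after the cycle, is raised to T_{k+1} by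
      -- the cycle and lowered again by the letters before it.
      at-above : ∀ v (k : Fin n) → lookup v (inject₁ (inject₁ k)) ℕ.< lookup v (suc (inject₁ k)) → ∀ i →
        suc (toℕ k) ℕ.< toℕ i →
                 loop v i ∙ t (inject₁ k) ≈ t (inject₁ k) ∙ loop (swapAt (inject₁ k) v) i
      at-above v k ascent i k<i = begin
        (κ i ∙ (P ∙ (cycle ∙ Q))) ∙ t (inject₁ k)         ≈⟨ solve G ⟩
        (κ i ∙ P ∙ cycle) ∙ (Q ∙ t (inject₁ k))           ≈⟨ ∙-congˡ commute ⟩
        (κ i ∙ P ∙ cycle) ∙ (t (inject₁ k) ∙ Q)           ≈⟨ solve G ⟩
        (κ i ∙ P) ∙ (cycle ∙ t (inject₁ k)) ∙ Q           ≈⟨ ∙-congʳ (∙-congˡ (cycle-shift k)) ⟩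
        (κ i ∙ P) ∙ (t (suc k) ∙ cycle) ∙ Q               ≈⟨ solve G ⟩
        κ i ∙ (P ∙ t (suc k)) ∙ cycle ∙ Q                 ≈⟨ ∙-congʳ (∙-congʳ (∙-congˡ shift)) ⟩
        κ i ∙ (t (inject₁ k) ∙ P′) ∙ cycle ∙ Q            ≈⟨ solve G ⟩
        (κ i ∙ t (inject₁ k)) ∙ P′ ∙ cycle ∙ Q
          ≈⟨ ∙-cong (∙-congʳ (∙-congʳ (κ-central i _))) (prod-cong (downs i≡ k<i′)) ⟩
        (t (inject₁ k) ∙ κ i) ∙ P′ ∙ cycle ∙ Q′           ≈⟨ solve G ⟩
        t (inject₁ k) ∙ (κ i ∙ (P′ ∙ (cycle ∙ Q′)))       ∎
        where
        open Swap v (inject₁ k) ascent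
        P P′ Q Q′ : Carrier
        P  = prod (up v i) (before i)
        P′ = prod (up v′ i) (before i)
        Q  = prod (down v i) (after i)
        Q′ = prod (down v′ i) (after i)
        k≡ : toℕ (inject₁ k) ≡ toℕ k
        k≡ = Fin.toℕ-inject₁ k
        k<i′ : toℕ (inject₁ k) ℕ.< toℕ i
        k<i′ = subst (ℕ._< toℕ i) (≡.sym k≡) (ℕ.<-trans (ℕ.n<1+n _) k<i)
        k+1<i : toℕ (Fin.suc (inject₁ k)) ℕ.< toℕ i
        k+1<i = subst (λ x → suc x ℕ.< toℕ i) (≡.sym k≡) k<i
        i≡ : lookup v i ≡ lookup v′ i
        i≡ = v′-other (<⇒≢ (ℕ.<-trans (inject₁<suc (inject₁ k)) k+1<i) ∘ ≡.sym) (<⇒≢ k+1<i ∘ ≡.sym)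
        commute : Commute Q (t (inject₁ k))
        commute = prod-commute (All.map
          (λ {l} (i≤l , _) → letter-commute σ-central ε-central _ l (sym (far (inject₁ k) l (ℕ.<-≤-trans k+1<i i≤l))))
          (descends-bounds (descends-after i)))
        shift : P ∙ t (suc k) ≈ t (inject₁ k) ∙ P′
        shift = prod-shift k (t (inject₁ k)) (t (suc k)) (up v i) (up v′ i)
          (λ j p q → up-≡ j i≡ (v′-other (p ∘ Fin.inject₁-injective) (q ∘ Fin.inject₁-injective)))
          (λ j j<k → letter-commute ε-central σ⁻¹-central _ j (far j (suc k) (s≤s j<k)))
          (λ j k<j → letter-commute ε-central σ⁻¹-central _ j
            (sym (far (inject₁ k) j (subst (λ x → suc (suc x) ℕ.≤ toℕ j) (≡.sym k≡) k<j))))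
          (trans (letter-braid ε-central σ⁻¹-central monotone k)
            (∙-cong (∙-congˡ (up-≡ (suc k) i≡ (≡.sym v′-right))) (up-≡ (inject₁ k) i≡ (≡.sym v′-left))))
          (descends-before i) z≤n k<i
          where
          monotone : does (lookup v i ℕ.≤? lookup v (inject₁ (inject₁ k))) ≡ true →
            does (lookup v i ℕ.≤? lookup v (inject₁ (suc k))) ≡ true
          monotone = does-mono (lookup v i ℕ.≤? lookup v (inject₁ (inject₁ k)))
            (lookup v i ℕ.≤? lookup v (inject₁ (suc k))) (λ le → ℕ.≤-trans le (ℕ.<⇒≤ ascent))

    loop-swap : ∀ v k → lookup v (inject₁ k) ℕ.< lookup v (suc k) → ∀ i →
                loop v i ∙ t k ≈ t k ∙ loop (swapAt k v) (adjacent k i)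
    loop-swap v k ascent i with adjacentView k i
    ... | left  = trans (Swap.at-left v k ascent) (reflexive (cong (λ j → t k ∙ loop (swapAt k v) j)
      (≡.sym (adjacent-inject₁ k))))
    ... | right = trans (Swap.at-right v k ascent) (reflexive
      (cong (λ j → t k ∙ loop (swapAt k v) j) (≡.sym (adjacent-suc k))))
    ... | other p q = trans (case k ascent p q) (reflexive (cong (λ j → t k ∙ loop (swapAt k v) j)
      (≡.sym (adjacent-other k p q))))
      where
      above : ∀ k → lookup v (inject₁ k) ℕ.< lookup v (suc k) → suc (toℕ k) ℕ.< toℕ i → loop v i ∙ t k
        ≈ t k ∙ loop (swapAt k v) i
      above k ascent k<i with view k
      ... | ‵fromℕ     = ⊥-elim (ℕ.<⇒≱ k<i (ℕ.≤-trans (ℕ.s≤s⁻¹ (Fin.toℕ<n i))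
        (ℕ.≤-reflexive (cong suc (≡.sym (Fin.toℕ-fromℕ n))))))
      ... | ‵inject₁ k = at-above v k ascent i (subst (λ x → suc x ℕ.< toℕ i) (Fin.toℕ-inject₁ k) k<i)
      case : ∀ k → lookup v (inject₁ k) ℕ.< lookup v (suc k) → i ≢ inject₁ k → i ≢ suc k → loop v i ∙ t k
        ≈ t k ∙ loop (swapAt k v) i
      case k ascent p q with ℕ.<-cmp (toℕ i) (toℕ k)
      case (suc k) ascent p q | tri< i<k _ _ = at-below v k ascent i (ℕ.s≤s⁻¹ i<k)
      case k ascent p q | tri≈ _ i≡k _ = ⊥-elim (p (Fin.toℕ-injective (≡.trans i≡k (≡.sym (Fin.toℕ-inject₁ k)))))
      case k ascent p q | tri> _ _ i>k = above k ascent (ℕ.≤∧≢⇒< i>k (q ∘ Fin.toℕ-injective ∘ ≡.sym))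

    private

      lookup-antitone′ : ∀ {m} (v : Vec ℕ (suc m)) → (∀ k → lookup v (suc k) ℕ.≤ lookup v (inject₁ k)) →
                         ∀ i j → toℕ i ℕ.≤ toℕ j → lookup v j ℕ.≤ lookup v i
      lookup-antitone′ v       decr zero zero _ = ℕ.≤-refl
      lookup-antitone′ {suc m} (x Vec.∷ v) decr zero (suc j) _ = ℕ.≤-trans
        (lookup-antitone′ v (decr ∘ suc) zero j z≤n) (decr zero)
      lookup-antitone′ {suc m} (x Vec.∷ v) decr (suc i) (suc j) (s≤s i≤j) = lookup-antitone′ v (decr ∘ suc) i j i≤j

      straight : Fin (suc (suc n)) → Carrier
      straight i = κ i ∙ (prod t⁻¹ (before i) ∙ (cycle ∙ prod t (after i)))

      -- The inverse letters cancel the beginning of the cycle, which leaves the Jucys-Murphy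
      -- product s^(i-N) T_i ⋯ T_{N-1} T_{N-1} ⋯ T_i. It obeys the same recursion as `D`, downward
      -- from the last index, where both are trivial.
      straight-murphy : ∀ i → straight i ≈ D i
      straight-murphy = >-weakInduction (λ i → straight i ≈ D i) last step
        where
        last : straight (fromℕ (suc n)) ≈ D (fromℕ (suc n))
        last = begin
          κ (fromℕ _) ∙ (prod t⁻¹ (before (fromℕ (suc n))) ∙ (cycle ∙ prod t (after (fromℕ (suc n)))))
            ≈⟨ ∙-cong κ-last (∙-cong (reflexive (cong (prod t⁻¹) before-last))
              (∙-congˡ (reflexive (cong (prod t) after-last)))) ⟩
          ε ∙ (prod t⁻¹ (reverse (allFin (suc n))) ∙ (cycle ∙ ε))
            ≈⟨ trans (identityˡ _) (∙-congˡ (identityʳ _)) ⟩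
          prod t⁻¹ (reverse (allFin (suc n))) ∙ cycle
            ≈⟨ prod-inverse t⁻¹ t inverseˡ (allFin (suc n)) ⟩
          ε ≈⟨ D-last ⟨
          D (fromℕ (suc n)) ∎
        step : ∀ k → straight (suc k) ≈ D (suc k) → straight (inject₁ k) ≈ D (inject₁ k)
        step k ih = begin
          straight (inject₁ k)                                   ≈⟨ identityˡ _ ⟨
          ε ∙ straight (inject₁ k)                               ≈⟨ ∙-congʳ σ⁻¹σ ⟨
          (σ⁻¹ ∙ σ) ∙ straight (inject₁ k)                       ≈⟨ ∙-congˡ (∙-congˡ (∙-congˡ (∙-congˡ Q≈))) ⟩
          (σ⁻¹ ∙ σ) ∙ (κ (inject₁ k) ∙ (U ∙ (cycle ∙ (Q ∙ t k)))) ≈⟨ solve G ⟩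
          σ⁻¹ ∙ ((σ ∙ κ (inject₁ k)) ∙ U ∙ cycle ∙ Q ∙ t k)
            ≈⟨ ∙-congˡ (∙-congʳ (∙-congʳ (∙-congʳ (∙-cong (κ-suc k) U≈)))) ⟨
          σ⁻¹ ∙ (κ (suc k) ∙ (t k ∙ U′) ∙ cycle ∙ Q ∙ t k)       ≈⟨ solve G ⟩
          σ⁻¹ ∙ ((κ (suc k) ∙ t k) ∙ U′ ∙ cycle ∙ Q ∙ t k)
            ≈⟨ ∙-congˡ (∙-congʳ (∙-congʳ (∙-congʳ (∙-congʳ (κ-central _ _))))) ⟩
          σ⁻¹ ∙ ((t k ∙ κ (suc k)) ∙ U′ ∙ cycle ∙ Q ∙ t k)       ≈⟨ solve G ⟩
          σ⁻¹ ∙ (t k ∙ straight (suc k) ∙ t k)                   ≈⟨ ∙-congˡ (∙-congʳ (∙-congˡ ih)) ⟩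
          σ⁻¹ ∙ (t k ∙ D (suc k) ∙ t k)                          ≈⟨ ∙-congˡ (D-step k) ⟩
          σ⁻¹ ∙ (σ ∙ D (inject₁ k))                              ≈⟨ assoc _ _ _ ⟨
          (σ⁻¹ ∙ σ) ∙ D (inject₁ k)                              ≈⟨ ∙-congʳ σ⁻¹σ ⟩
          ε ∙ D (inject₁ k)                                      ≈⟨ identityˡ _ ⟩
          D (inject₁ k)                                          ∎
          where
          U U′ Q : Carrier
          U  = prod t⁻¹ (before (inject₁ k))
          U′ = prod t⁻¹ (before (suc k))
          Q  = prod t (after (suc k))
          Q≈ : prod t (after (inject₁ k)) ≈ Q ∙ t k
          Q≈ = trans (reflexive (cong (prod t) (after-inject₁ k))) (prod-∷ʳ t (after (suc k)) k)
          U≈ : t k ∙ U′ ≈ U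
          U≈ = begin
            t k ∙ U′            ≡⟨ cong (λ w → t k ∙ prod t⁻¹ w) (before-suc k) ⟩
            t k ∙ (t⁻¹ k ∙ U)   ≈⟨ assoc _ _ _ ⟨
            (t k ∙ t⁻¹ k) ∙ U   ≈⟨ ∙-congʳ (inverseʳ k) ⟩
            ε ∙ U               ≈⟨ identityˡ U ⟩
            U                   ∎

    -- For decreasing `v` every comparison in `up` succeeds and every one in `down` fails, also on
    -- ties, so all letters are plain T_k⁻¹ and T_k.
    loop-sorted : ∀ v → (∀ k → lookup v (suc k) ℕ.≤ lookup v (inject₁ k)) → ∀ i → loop v i ≈ D i
    loop-sorted v decr i = trans (∙-congˡ (∙-cong (prod-cong ups) (∙-congˡ (prod-cong downs)))) (straight-murphy i)
      where
      ups : All (λ k → up v i k ≈ t⁻¹ k) (before i)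
      ups = All.map (λ {k} (_ , k<i) → trans
          (reflexive (cong (λ b → letter ε σ⁻¹ b k) (dec-true (lookup v i ℕ.≤? lookup v (inject₁ k))
            (lookup-antitone′ v decr (inject₁ k) i (subst (ℕ._≤ toℕ i) (≡.sym (Fin.toℕ-inject₁ k)) (ℕ.<⇒≤ k<i))))))
          (identityˡ _))
        (descends-bounds (descends-before i))
      downs : All (λ k → down v i k ≈ t k) (after i)
      downs = All.map (λ {k} (i≤k , _) → trans
          (reflexive (cong (λ b → letter σ ε b k) (dec-false (lookup v i ℕ.<? lookup v (suc k))
            (ℕ.≤⇒≯ (lookup-antitone′ v decr i (suc k) (ℕ.m≤n⇒m≤1+n i≤k))))))
          (identityˡ _))
        (descends-bounds (descends-after i))

    loop-conjugate : ∀ {v w} → Sorts v w → ∀ i → loop v i ∙ prod t w ≈ prod t w ∙ D (permute w i)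
    loop-conjugate {v} ([] decr) i = trans (identityʳ _) (trans (loop-sorted v decr i) (sym (identityˡ _)))
    loop-conjugate {v} {k ∷ w} (ascent ∷ sorts) i = begin
      loop v i ∙ (t k ∙ prod t w)                         ≈⟨ assoc _ _ _ ⟨
      (loop v i ∙ t k) ∙ prod t w                         ≈⟨ ∙-congʳ (loop-swap v k ascent i) ⟩
      (t k ∙ loop (swapAt k v) (adjacent k i)) ∙ prod t w ≈⟨ assoc _ _ _ ⟩
      t k ∙ (loop (swapAt k v) (adjacent k i) ∙ prod t w) ≈⟨ ∙-congˡ (loop-conjugate sorts (adjacent k i)) ⟩
      t k ∙ (prod t w ∙ D (permute w (adjacent k i)))     ≈⟨ assoc _ _ _ ⟨
      (t k ∙ prod t w) ∙ D (permute w (adjacent k i))     ∎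

-- The order on exponent vectors

module _ where

  open import Data.Nat.Base using (_+_; _*_; _≤_; _<_)
  open ℕ.≤-Reasoning
  open import Relation.Binary.PropositionalEquality using (refl; sym; trans)


  -- A permutation-invariant substitute for the partial sums of the decreasing rearrangement: by excess⇒≼ the
  -- inequalities between these functions of t imply those between the partial sums.
  excess : ℕ → List ℕ → ℕ
  excess t xs = sum (map (_∸ t) xs)

  excess-↭ : ∀ t {xs ys} → xs ↭ ys → excess t xs ≡ excess t ys
  excess-↭ t p = sum-↭ (↭.map⁺ (_∸ t) p)

  private

    interchange : ∀ a b c d → (a + b) + (c + d) ≡ (a + c) + (b + d)
    interchange = ℕ.solve-∀

    exchange-left : ∀ a b c → a + (b + c) ≡ b + (a + c)
    exchange-left = ℕ.solve-∀

    take-≤-excess : ∀ t i xs → sum (take i xs) ≤ i * t + excess t xs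
    take-≤-excess t zero    xs       = z≤n
    take-≤-excess t (suc i) []       = z≤n
    take-≤-excess t (suc i) (x ∷ xs) = begin
      x + sum (take i xs)                        ≤⟨ ℕ.+-mono-≤ (ℕ.m≤n+m∸n x t) (take-≤-excess t i xs) ⟩
      (t + (x ∸ t)) + (i * t + excess t xs)      ≡⟨ interchange t (x ∸ t) (i * t) (excess t xs) ⟩
      (t + i * t) + ((x ∸ t) + excess t xs)      ∎

    excess-above : ∀ b xs → Linked _≥_ (b ∷ xs) → excess b xs ≡ 0
    excess-above b []       _       = refl
    excess-above b (x ∷ xs) (b≥x ∷ L) = cong₂ _+_ (ℕ.m≤n⇒m∸n≡0 b≥x) (excess-above b xs (weaken xs L))
      where
      weaken : ∀ xs → Linked _≥_ (x ∷ xs) → Linked _≥_ (b ∷ xs)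
      weaken []       _         = [-]
      weaken (y ∷ xs) (x≥y ∷ L) = ℕ.≤-trans x≥y b≥x ∷ L

    -- The witness is the last of the first i entries, or 0 past the end of the list: the entries up
    -- to it exceed it by their exact differences, the later ones not at all.
    threshold : ∀ b xs → Linked _≥_ (b ∷ xs) → ∀ i → ∃[ t ] t ≤ b × i * t + excess t xs ≤ sum (take i xs)
    threshold b xs       L         zero    = b , ℕ.≤-refl , ℕ.≤-reflexive (excess-above b xs L)
    threshold b []       L         (suc i) = 0 , z≤n , ℕ.≤-reflexive (trans (ℕ.+-identityʳ _) (ℕ.*-zeroʳ i))
    threshold b (x ∷ xs) (b≥x ∷ L) (suc i) with threshold x xs L i
    ... | t , t≤x , le = t , ℕ.≤-trans t≤x b≥x , (begin
      (t + i * t) + ((x ∸ t) + excess t xs) ≡⟨ interchange t (i * t) (x ∸ t) (excess t xs) ⟩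
      (t + (x ∸ t)) + (i * t + excess t xs) ≡⟨ cong (λ u → u + (i * t + excess t xs)) (ℕ.m+[n∸m]≡n t≤x) ⟩
      x + (i * t + excess t xs)             ≤⟨ ℕ.+-monoʳ-≤ x le ⟩
      x + sum (take i xs)                   ∎)

  -- For a decreasing list, the sum of the first i entries is the minimum over t of
  -- `i * t + excess t`, attained at `threshold`.
  excess⇒≼ : ∀ xs ys → Linked _≥_ ys → (∀ t → excess t xs ≤ excess t ys) → xs ≼ ys
  excess⇒≼ xs ys L le i with threshold-any ys L i
    where
    threshold-any : ∀ ys → Linked _≥_ ys → ∀ i → ∃[ t ] i * t + excess t ys ≤ sum (take i ys)
    threshold-any []       L i with threshold 0 [] [-] i
    ... | t , _ , le = t , le
    threshold-any (y ∷ ys) L i with threshold y (y ∷ ys) (ℕ.≤-refl ∷ L) i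
    ... | t , _ , le = t , le
  ... | t , le′ = begin
    sum (take i xs)       ≤⟨ take-≤-excess t i xs ⟩
    i * t + excess t xs   ≤⟨ ℕ.+-monoʳ-≤ (i * t) (le t) ⟩
    i * t + excess t ys   ≤⟨ le′ ⟩
    sum (take i ys)       ∎

  ≼-trans : ∀ {xs ys zs} → xs ≼ ys → ys ≼ zs → xs ≼ zs
  ≼-trans p q i = ℕ.≤-trans (p i) (q i)

  ≼-antisym : ∀ {xs ys} → length xs ≡ length ys → xs ≼ ys → ys ≼ xs → xs ≡ ys
  ≼-antisym {[]}     {[]}     _   _ _ = refl
  ≼-antisym {x ∷ xs} {y ∷ ys} len p q = cong₂ _∷_ x≡y (≼-antisym (ℕ.suc-injective len)
      (λ i → ℕ.+-cancelˡ-≤ x _ _ (subst (λ z → x + sum (take i xs) ≤ z + sum (take i ys)) (sym x≡y) (p (suc i))))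
      (λ i → ℕ.+-cancelˡ-≤ y _ _ (subst (λ z → y + sum (take i ys) ≤ z + sum (take i xs)) x≡y (q (suc i)))))
    where
    x≡y : x ≡ y
    x≡y = ℕ.+-cancelʳ-≡ 0 x y (ℕ.≤-antisym (p 1) (q 1))

  infix 4 _≼?_

  -- Partial sums are constant from the longer length on, so finitely many comparisons decide.
  _≼?_ : ∀ xs ys → Dec (xs ≼ ys)
  xs ≼? ys = map′ extend (λ p {i} _ → p i) (ℕ.allUpTo? (λ i → sum (take i xs) ℕ.≤? sum (take i ys)) (suc b))
    where
    b = length xs ℕ.⊔ length ys
    extend : (∀ {i} → i < suc b → sum (take i xs) ≤ sum (take i ys)) → xs ≼ ys
    extend p i with i ℕ.≤? b
    ... | yes i≤b = p (s≤s i≤b)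
    ... | no i≰b  = subst₂ (λ us vs → sum us ≤ sum vs)
      (trans (List.take-all b xs (ℕ.m≤m⊔n _ _)) (sym (List.take-all i xs (ℕ.≤-trans (ℕ.m≤m⊔n _ _) b≤i))))
      (trans (List.take-all b ys (ℕ.m≤n⊔m (length xs) _)) (sym (List.take-all i ys (ℕ.≤-trans (ℕ.m≤n⊔m (length xs) _) b≤i))))
      (p (ℕ.n<1+n b))
      where
      b≤i : b ≤ i
      b≤i = ℕ.<⇒≤ (ℕ.≰⇒> i≰b)

  module _ {N : ℕ} where

    open Sort (Flip.decTotalOrder ℕ.≤-decTotalOrder) using (sort-↭; sort-↗)

    private

      _⁺ : Exponent N → List ℕ
      _⁺ = decreasingRearrangement

      ⁺-excess : ∀ t v → excess t (v ⁺) ≡ excess t (toList v)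
      ⁺-excess t v = excess-↭ t (sort-↭ (toList v))

      ⁺-length : ∀ v → length (v ⁺) ≡ N
      ⁺-length v = trans (↭.↭-length (sort-↭ (toList v))) (Vec.length-toList v)

      ⁺-length-≡ : ∀ v w → length (v ⁺) ≡ length (w ⁺)
      ⁺-length-≡ v w = trans (⁺-length v) (sym (⁺-length w))

      ⁺-≼ : ∀ v w → (∀ t → excess t (toList v) ≤ excess t (toList w)) → v ⁺ ≼ w ⁺
      ⁺-≼ v w le = excess⇒≼ (v ⁺) (w ⁺) (sort-↗ (toList w)) λ t → subst₂ _≤_ (sym (⁺-excess t v)) (sym (⁺-excess t w)) (le t)

      toList-injective : ∀ {m} {v w : Vec ℕ m} → toList v ≡ toList w → v ≡ w
      toList-injective {v = []}    {[]}    _  = refl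
      toList-injective {v = x ∷ v} {y ∷ w} eq = cong₂ _∷_ (List.∷-injectiveˡ eq) (toList-injective (List.∷-injectiveʳ eq))

    -- If `u` and `w` coincided, antisymmetry of `≼` on lists of equal length would identify the
    -- middle vector, or its rearrangement, with theirs.
    ◁-trans : ∀ {u v w : Exponent N} → u ◁ v → v ◁ w → u ◁ w
    ◁-trans {u} {v} {w} (u⊴v , u≢v) (v⊴w , v≢w) = both u⊴v v⊴w , different u⊴v v⊴w
      where
      both : u ⊴ v → v ⊴ w → u ⊴ w
      both (inj₁ (ne , p)) (inj₁ (ne′ , p′)) = inj₁ ((λ eq → ne
        (≼-antisym (⁺-length-≡ u v) p (subst (v ⁺ ≼_) (sym eq) p′))) , ≼-trans {u ⁺} {v ⁺} {w ⁺} p p′)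
      both (inj₁ (ne , p)) (inj₂ (eq′ , _))  = inj₁ (subst (λ z → u ⁺ ≢ z × u ⁺ ≼ z) eq′ (ne , p))
      both (inj₂ (eq , _)) (inj₁ (ne′ , p′)) = inj₁ (subst (λ z → z ≢ w ⁺ × z ≼ w ⁺) (sym eq) (ne′ , p′))
      both (inj₂ (eq , p)) (inj₂ (eq′ , p′)) = inj₂ (trans eq eq′ , ≼-trans {toList u} {toList v} {toList w} p p′)
      different : u ⊴ v → v ⊴ w → u ≢ w
      different (inj₁ (ne , p)) (inj₁ (ne′ , p′)) refl = ne (≼-antisym (⁺-length-≡ u v) p p′)
      different (inj₁ (ne , _)) (inj₂ (eq′ , _))  refl = ne (sym eq′)
      different (inj₂ (eq , _)) (inj₁ (ne′ , _))  refl = ne′ (sym eq)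
      different (inj₂ (_ , p))  (inj₂ (_ , p′))   refl =
        u≢v (toList-injective (≼-antisym (trans (Vec.length-toList u) (sym (Vec.length-toList v))) p p′))

    ◁-irrefl : ∀ {v : Exponent N} → ¬ v ◁ v
    ◁-irrefl (_ , ne) = ne refl

    infix 4 _◁?_

    _◁?_ : ∀ (v w : Exponent N) → Dec (v ◁ w)
    v ◁? w = ((¬? (v⁺≟w⁺) ×-dec (v ⁺ ≼? w ⁺)) ⊎-dec (v⁺≟w⁺ ×-dec (toList v ≼? toList w))) ×-dec ¬? (Vec.≡-dec ℕ._≟_ v w)
      where
      v⁺≟w⁺ : Dec (v ⁺ ≡ w ⁺)
      v⁺≟w⁺ = List.≡-dec ℕ._≟_ (v ⁺) (w ⁺)

    -- Excess depends on the rearrangement only, so strictness at a single t separates the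
    -- rearrangements.
    excess-<⇒◁ : ∀ {v w : Exponent N} → (∀ t → excess t (toList v) ≤ excess t (toList w)) →
                 (∃[ t ] excess t (toList v) < excess t (toList w)) → v ◁ w
    excess-<⇒◁ {v} {w} le (t , lt) = inj₁ (v⁺≢w⁺ , ⁺-≼ v w le) , λ { refl → ℕ.<-irrefl refl lt }
      where
      v⁺≢w⁺ : v ⁺ ≢ w ⁺
      v⁺≢w⁺ eq = ℕ.<-irrefl (trans (sym (⁺-excess t v)) (trans (cong (excess t) eq) (⁺-excess t w))) lt

    -- Equal excesses give `≼` between the rearrangements in both directions, hence their equality;
    -- the partial sums of the vectors themselves then decide.
    excess-≡⇒◁ : ∀ {v w : Exponent N} → (∀ t → excess t (toList v) ≡ excess t (toList w)) →
                 toList v ≼ toList w → v ≢ w → v ◁ w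
    excess-≡⇒◁ {v} {w} eq p ne = inj₂ (≼-antisym (⁺-length-≡ v w) (⁺-≼ v w (ℕ.≤-reflexive ∘ eq))
      (⁺-≼ w v (ℕ.≤-reflexive ∘ sym ∘ eq)) , p) , ne

  private

    excess-insertAt : ∀ t {m} (z : Vec ℕ m) i c → excess t (toList (insertAt z i c)) ≡ (c ∸ t) + excess t (toList z)
    excess-insertAt t z       zero    c = refl
    excess-insertAt t (x ∷ z) (suc i) c = trans (cong (λ u → (x ∸ t) + u) (excess-insertAt t z i c))
      (exchange-left (x ∸ t) (c ∸ t) _)

    excess-update : ∀ t {m} (z : Vec ℕ m) k c → (lookup z k ∸ t) + excess t (toList (z [ k ]≔ c))
      ≡ (c ∸ t) + excess t (toList z)
    excess-update t (x ∷ z) zero    c = exchange-left (x ∸ t) (c ∸ t) _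
    excess-update t (x ∷ z) (suc k) c = trans (exchange-left (lookup z k ∸ t) (x ∸ t) _)
      (trans (cong (λ u → (x ∸ t) + u) (excess-update t z k c)) (exchange-left (x ∸ t) (c ∸ t) _))

    prefix : ∀ {m} → ℕ → Vec ℕ m → ℕ
    prefix j v = sum (take j (toList v))

    +-swap-≤ : ∀ x a b c d → a + c ≤ b + d → a + (x + c) ≤ b + (x + d)
    +-swap-≤ x a b c d le = subst₂ _≤_ (exchange-left x a c) (exchange-left x b d) (ℕ.+-monoʳ-≤ x le)

    prefix-insertAt : ∀ {m} j (z : Vec ℕ m) i {c a} → c ≤ a → c + prefix j (insertAt z i a) ≤ a + prefix j (insertAt z i c)
    prefix-insertAt zero    z       i       c≤a = ℕ.+-monoˡ-≤ 0 c≤a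
    prefix-insertAt (suc j) z       zero    {c} {a} c≤a = ℕ.≤-reflexive (exchange-left c a (prefix j z))
    prefix-insertAt (suc j) (x ∷ z) (suc i) {c} {a} c≤a = +-swap-≤ x c a _ _ (prefix-insertAt j z i c≤a)

    prefix-update : ∀ {m} j (z : Vec ℕ m) k {c} → lookup z k ≤ c → lookup z k + prefix j (z [ k ]≔ c) ≤ c + prefix j z
    prefix-update zero    z       k       a≤c = ℕ.+-monoˡ-≤ 0 a≤c
    prefix-update (suc j) (x ∷ z) zero    {c} a≤c = ℕ.≤-reflexive (exchange-left x c (prefix j z))
    prefix-update (suc j) (x ∷ z) (suc k) {c} a≤c = +-swap-≤ x (lookup z k) c _ _ (prefix-update j z k a≤c)

  -- This is `insertAt z i c` with the inserted entry and the entry coming from position k of `z`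
  -- exchanged.
  exchangeEntry : ∀ {m} → Vec ℕ m → Fin (suc m) → Fin m → ℕ → Vec ℕ (suc m)
  exchangeEntry z i k c = insertAt (z [ k ]≔ c) i (lookup z k)

  private

    prefix-exchange-before : ∀ {m} (z : Vec ℕ m) i k c → toℕ k < toℕ i → c ≤ lookup z k →
                             ∀ j → prefix j (exchangeEntry z i k c) ≤ prefix j (insertAt z i c)
    prefix-exchange-before (x ∷ z) (suc i) k       c k<i le zero    = z≤n
    prefix-exchange-before (x ∷ z) (suc i) zero    c k<i le (suc j) = prefix-insertAt j z i le
    prefix-exchange-before (x ∷ z) (suc i) (suc k) c k<i le (suc j) =
      ℕ.+-monoʳ-≤ x (prefix-exchange-before z i k c (ℕ.s≤s⁻¹ k<i) le j)

    prefix-exchange-after : ∀ {m} (z : Vec ℕ m) i k c → toℕ i ≤ toℕ k → lookup z k ≤ c →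
                            ∀ j → prefix j (exchangeEntry z i k c) ≤ prefix j (insertAt z i c)
    prefix-exchange-after z       i       k       c i≤k le zero    = z≤n
    prefix-exchange-after (x ∷ z) zero    k       c i≤k le (suc j) = prefix-update j (x ∷ z) k le
    prefix-exchange-after (x ∷ z) (suc i) (suc k) c i≤k le (suc j) =
      ℕ.+-monoʳ-≤ x (prefix-exchange-after z i k c (ℕ.s≤s⁻¹ i≤k) le j)

    exchangeEntry-◁ : ∀ {m} (z : Vec ℕ m) i k c → lookup z k ≢ c →
                      (∀ j → prefix j (exchangeEntry z i k c) ≤ prefix j
                        (insertAt z i c)) → exchangeEntry z i k c ◁ insertAt z i c
    exchangeEntry-◁ z i k c ne le = excess-≡⇒◁
      (λ t → trans (excess-insertAt t (z [ k ]≔ c) i (lookup z k))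
        (trans (excess-update t z k c) (sym (excess-insertAt t z i c))))
      le
      (λ eq → ne (trans (sym (Vec.insertAt-lookup (z [ k ]≔ c) i (lookup z k)))
        (trans (cong (λ v → lookup v i) eq) (Vec.insertAt-lookup z i c))))

  -- The exchange moves the larger of the two entries to the right: the rearrangement stays and
  -- partial sums can only drop. The same happens in `exchange-after-◁`.
  exchange-before-◁ : ∀ {m} (z : Vec ℕ m) i k c → toℕ k < toℕ i → c < lookup z k → exchangeEntry z i k c ◁ insertAt z i c
  exchange-before-◁ z i k c k<i lt =
    exchangeEntry-◁ z i k c (ℕ.<⇒≢ lt ∘ sym) (prefix-exchange-before z i k c k<i (ℕ.<⇒≤ lt))

  exchange-after-◁ : ∀ {m} (z : Vec ℕ m) i k c → toℕ i ≤ toℕ k → lookup z k < c → exchangeEntry z i k c ◁ insertAt z i c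
  exchange-after-◁ z i k c i≤k lt =
    exchangeEntry-◁ z i k c (ℕ.<⇒≢ lt) (prefix-exchange-after z i k c i≤k (ℕ.<⇒≤ lt))

  private

    ∸-subadditive : ∀ p p′ v → (p ∸ v) + (p′ ∸ v) ≤ (p + p′) ∸ v
    ∸-subadditive p p′ v with ℕ.≤-total p v
    ... | inj₁ p≤v = subst (λ x → x + (p′ ∸ v) ≤ (p + p′) ∸ v) (sym (ℕ.m≤n⇒m∸n≡0 p≤v)) (ℕ.∸-monoˡ-≤ v (ℕ.m≤n+m p′ p))
    ... | inj₂ v≤p = ℕ.≤-trans (ℕ.+-monoʳ-≤ (p ∸ v) (ℕ.m∸n≤m p′ v)) (ℕ.≤-reflexive (sym (ℕ.+-∸-comm p′ v≤p)))

    -- Convexity of x ↦ x ∸ t: moving two numbers towards each other with fixed sum does not raise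
    -- their total excess.
    ∸-convex : ∀ m p p′ t → ((m + p) ∸ t) + ((m + p′) ∸ t) ≤ (m ∸ t) + ((m + (p + p′)) ∸ t)
    ∸-convex m p p′ t with ℕ.≤-total t m
    ... | inj₁ t≤m = ℕ.≤-reflexive (trans (cong₂ _+_ (ℕ.+-∸-comm p t≤m) (ℕ.+-∸-comm p′ t≤m))
        (trans (assoc (m ∸ t) p p′) (cong (λ u → (m ∸ t) + u) (sym (ℕ.+-∸-comm (p + p′) t≤m)))))
      where
      assoc : ∀ u p p′ → (u + p) + (u + p′) ≡ u + (u + (p + p′))
      assoc = ℕ.solve-∀
    ... | inj₂ m≤t = subst (λ t → ((m + p) ∸ t) + ((m + p′) ∸ t) ≤ (m ∸ t) + ((m + (p + p′)) ∸ t)) (ℕ.m+[n∸m]≡n m≤t)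
        (subst₂ _≤_ (cong₂ _+_ (sym (ℕ.[m+n]∸[m+o]≡n∸o m p v)) (sym (ℕ.[m+n]∸[m+o]≡n∸o m p′ v)))
          (cong₂ _+_ (sym (ℕ.m≤n⇒m∸n≡0 (ℕ.m≤m+n m v))) (sym (ℕ.[m+n]∸[m+o]≡n∸o m (p + p′) v)))
          (∸-subadditive p p′ v))
      where v = t ∸ m

    between-◁ : ∀ {m} (z : Vec ℕ m) i k c α β →
                (∀ t → (α ∸ t) + (β ∸ t) ≤ (lookup z k ∸ t) + (c ∸ t)) →
                (∃[ t ] (α ∸ t) + (β ∸ t) < (lookup z k ∸ t) + (c ∸ t)) →
                insertAt (z [ k ]≔ β) i α ◁ insertAt z i c
    between-◁ z i k c α β le (t₀ , lt) = excess-<⇒◁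
      (λ t → ℕ.+-cancelˡ-≤ (lookup z k ∸ t) _ _ (subst₂ _≤_ (sym (lhs t)) (sym (rhs t))
        (ℕ.+-monoˡ-≤ (excess t (toList z)) (le t))))
      (t₀ , ℕ.+-cancelˡ-< (lookup z k ∸ t₀) _ _ (subst₂ _<_ (sym (lhs t₀)) (sym (rhs t₀))
        (ℕ.+-monoˡ-< (excess t₀ (toList z)) lt)))
      where
      lhs : ∀ t → (lookup z k ∸ t) + excess t (toList (insertAt (z [ k ]≔ β) i α))
        ≡ ((α ∸ t) + (β ∸ t)) + excess t (toList z)
      lhs t = trans (cong (λ u → (lookup z k ∸ t) + u) (excess-insertAt t (z [ k ]≔ β) i α))
        (trans (exchange-left (lookup z k ∸ t) (α ∸ t) _) (trans (cong (λ u → (α ∸ t) + u) (excess-update t z k β))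
          (sym (ℕ.+-assoc (α ∸ t) _ _))))
      rhs : ∀ t → (lookup z k ∸ t) + excess t (toList (insertAt z i c)) ≡ ((lookup z k ∸ t) + (c ∸ t)) + excess t (toList z)
      rhs t = trans (cong (λ u → (lookup z k ∸ t) + u) (excess-insertAt t z i c)) (sym (ℕ.+-assoc (lookup z k ∸ t) _ _))

    ∸-convex-strict : ∀ m p p′ → 0 < p → 0 < p′ → ∃[ t ] ((m + p) ∸ t) + ((m + p′) ∸ t) < (m ∸ t) + ((m + (p + p′)) ∸ t)
    ∸-convex-strict m p p′ 0<p 0<p′ = t , subst (_< (m ∸ t) + ((m + (p + p′)) ∸ t))
        (sym (cong₂ _+_ (ℕ.m≤n⇒m∸n≡0 (ℕ.m≤m⊔n (m + p) (m + p′))) (ℕ.m≤n⇒m∸n≡0 (ℕ.m≤n⊔m (m + p) (m + p′)))))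
        (ℕ.≤-trans (ℕ.m<n⇒0<n∸m (ℕ.⊔-lub (s≤s-mono (ℕ.m<m+n p 0<p′)) (s≤s-mono (ℕ.m<n+m p′ 0<p)))) (ℕ.m≤n+m _ (m ∸ t)))
      where
      -- At the larger of the two inner numbers both inner excesses vanish, while m + (p + p′) still
      -- exceeds it.
      t = (m + p) ℕ.⊔ (m + p′)
      s≤s-mono : ∀ {x y} → x < y → suc (m + x) ≤ m + y
      s≤s-mono {x} {y} x<y = subst (_≤ m + y) (ℕ.+-suc m x) (ℕ.+-monoʳ-≤ m x<y)

  -- The inner monomials of a divided difference have this form: two entries are replaced by two
  -- strictly between them with the same sum, which lowers the rearrangement itself.
  between-below-◁ : ∀ {m} (z : Vec ℕ m) i k c p p′ → 0 < p → 0 < p′ → lookup z k ≡ c + (p + p′) →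
                    insertAt (z [ k ]≔ (c + p′)) i (c + p) ◁ insertAt z i c
  between-below-◁ z i k c p p′ 0<p 0<p′ eq = between-◁ z i k c (c + p) (c + p′)
    (λ t → ℕ.≤-trans (∸-convex c p p′ t) (ℕ.≤-reflexive (reorder t)))
    (let t , lt = ∸-convex-strict c p p′ 0<p 0<p′ in t , ℕ.<-≤-trans lt (ℕ.≤-reflexive (reorder t)))
    where
    reorder : ∀ t → (c ∸ t) + ((c + (p + p′)) ∸ t) ≡ (lookup z k ∸ t) + (c ∸ t)
    reorder t = trans (ℕ.+-comm (c ∸ t) _) (cong (λ x → (x ∸ t) + (c ∸ t)) (sym eq))

  between-above-◁ : ∀ {m} (z : Vec ℕ m) i k c p p′ → 0 < p → 0 < p′ → c ≡ lookup z k + (p + p′) →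
                    insertAt (z [ k ]≔ (lookup z k + p′)) i (lookup z k + p) ◁ insertAt z i c
  between-above-◁ z i k c p p′ 0<p 0<p′ eq = between-◁ z i k c (lookup z k + p) (lookup z k + p′)
    (λ t → subst (λ x → _ ≤ (lookup z k ∸ t) + (x ∸ t)) (sym eq) (∸-convex (lookup z k) p p′ t))
    (let t , lt = ∸-convex-strict (lookup z k) p p′ 0<p 0<p′ in t , subst (λ x → _ < (lookup z k ∸ t) + (x ∸ t)) (sym eq) lt)

-- Reduced words of the rank permutation

module _ where

  open import Data.Nat.Base using (_+_; _≤_; _<_)
  open import Relation.Binary.PropositionalEquality using (refl; sym; trans)

  adjacent-injective : ∀ {m} (k : Fin m) {i j} → adjacent k i ≡ adjacent k j → i ≡ j
  adjacent-injective k {i} {j} eq = trans (sym (adjacent-involutive k i))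
    (trans (cong (adjacent k) eq) (adjacent-involutive k j))

  adjacent-mono : ∀ {m} (k : Fin m) {i j} → i Fin.< j → ¬ (i ≡ inject₁ k × j ≡ suc k) → adjacent k i Fin.< adjacent k j
  adjacent-mono k {i} {j} i<j exc with adjacentView k i | adjacentView k j
  ... | left      | left      = ⊥-elim (ℕ.<-irrefl refl i<j)
  ... | left      | right     = ⊥-elim (exc (refl , refl))
  ... | right     | left      = ⊥-elim (ℕ.<-asym i<j (inject₁<suc k))
  ... | right     | right     = ⊥-elim (ℕ.<-irrefl refl i<j)
  ... | other p q | other p′ q′ = subst₂ Fin._<_ (sym (adjacent-other k p q)) (sym (adjacent-other k p′ q′)) i<j
  ... | left      | other p q = subst₂ Fin._<_ (sym (adjacent-inject₁ k)) (sym (adjacent-other k p q))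
    (ℕ.≤∧≢⇒< (subst (λ x → suc x ≤ toℕ j) (Fin.toℕ-inject₁ k) i<j) (q ∘ Fin.toℕ-injective ∘ sym))
  ... | right     | other p q = subst₂ Fin._<_ (sym (adjacent-suc k)) (sym (adjacent-other k p q))
    (ℕ.<-trans (inject₁<suc k) i<j)
  ... | other p q | left      = subst₂ Fin._<_ (sym (adjacent-other k p q)) (sym (adjacent-inject₁ k))
    (ℕ.<-trans i<j (inject₁<suc k))
  ... | other p q | right     = subst₂ Fin._<_ (sym (adjacent-other k p q)) (sym (adjacent-suc k))
    (ℕ.≤∧≢⇒< (subst (toℕ i ≤_) (sym (Fin.toℕ-inject₁ k)) (ℕ.s≤s⁻¹ i<j)) (p ∘ Fin.toℕ-injective))

  permute-injective : ∀ {m} (w : Word m) {i j} → permute w i ≡ permute w j → i ≡ j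
  permute-injective []      eq = eq
  permute-injective (k ∷ w) eq = adjacent-injective k (permute-injective w eq)

  permute-surjective : ∀ {m} (w : Word m) j → ∃[ i ] permute w i ≡ j
  permute-surjective []      j = j , refl
  permute-surjective (k ∷ w) j with permute-surjective w j
  ... | i , eq = adjacent k i , trans (cong (permute w) (adjacent-involutive k i)) eq

  -- Some letter of w exchanges the images of x and y: delete it.
  exchange-condition : ∀ {m} (w : Word m) x y → x Fin.< y → permute w y Fin.< permute w x →
    ∃[ w′ ] length w ≡ suc (length w′) × permute w′ x ≡ permute w y × permute w′ y ≡ permute w x ×
            (∀ i → i ≢ x → i ≢ y → permute w′ i ≡ permute w i)
  exchange-condition []      x y x<y y<x = ⊥-elim (ℕ.<-asym x<y y<x)
  exchange-condition (k ∷ w) x y x<y inv with (x Fin.≟ inject₁ k) ×-dec (y Fin.≟ suc k)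
  ... | yes (refl , refl) = w , refl , cong (permute w) (sym (adjacent-suc k)) , cong (permute w)
    (sym (adjacent-inject₁ k)) ,
    λ i p q → cong (permute w) (sym (adjacent-other k p q))
  ... | no exc with exchange-condition w (adjacent k x) (adjacent k y) (adjacent-mono k x<y exc) inv
  ...   | w′ , len , px , py , rest = (k ∷ w′) , cong suc len , px , py ,
    λ i p q → rest (adjacent k i) (p ∘ adjacent-injective k) (q ∘ adjacent-injective k)

  -- The properties of r_v that survive an exchange of an ascent, so that the first letter of a
  -- reduced word can be split off.
  record Ranks {m} (v : Vec ℕ (suc m)) (σ : Fin (suc m) → Fin (suc m)) : Set where
    field
      larger-first : ∀ i j → lookup v i < lookup v j → σ j Fin.< σ i
      left-first   : ∀ i j → i Fin.< j → lookup v i ≡ lookup v j → σ i Fin.< σ j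

  -- s_k reverses the order of a single pair of positions, and that pair carries a strict ascent,
  -- not a tie.
  ranks-swap : ∀ {m} {v : Vec ℕ (suc m)} {σ} k → lookup v (inject₁ k) < lookup v (suc k) →
               Ranks v σ → Ranks (swapAt k v) (σ ∘ adjacent k)
  ranks-swap {v = v} k ascent ranks = record
    { larger-first = λ i j lt → larger-first _ _ (subst₂ _<_ (lookup-swapAt k v i) (lookup-swapAt k v j) lt)
    ; left-first   = λ i j i<j eq → let eq′ = trans (sym (lookup-swapAt k v i)) (trans eq (lookup-swapAt k v j)) in
        left-first _ _ (adjacent-mono k i<j λ { (refl , refl) → ℕ.<⇒≢ ascent
          (trans (cong (lookup v) (sym (adjacent-suc k))) (trans (sym eq′) (cong (lookup v) (adjacent-inject₁ k)))) }) eq′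
    }
    where open Ranks ranks

  -- If the first letter k were not at an ascent, σ would keep k and k + 1 in order, so the
  -- remaining word would invert them. Deleting a letter from it by `exchange-condition` would give
  -- a word for σ two letters shorter.
  reduced⇒sorts : ∀ {m} {v : Vec ℕ (suc m)} {σ} w → Ranks v σ → IsReducedWordOf σ w → Sorts v w
  reduced⇒sorts {v = v} {σ} [] ranks reduced = [] λ k → ℕ.≮⇒≥ λ lt →
    ℕ.<-asym (inject₁<suc k) (subst₂ Fin._<_ (sym (represents (suc k))) (sym (represents (inject₁ k))) (larger-first _ _ lt))
    where
    open Ranks ranks
    open IsReducedWordOf reduced
  reduced⇒sorts {v = v} {σ} (k ∷ w) ranks reduced = ascent ∷ reduced⇒sorts w (ranks-swap k ascent ranks) record
    { represents = λ i → trans (cong (permute w) (sym (adjacent-involutive k i))) (represents (adjacent k i))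
    ; shortest   = λ w′ rep → ℕ.s≤s⁻¹ (shortest (k ∷ w′) λ i → trans (rep (adjacent k i)) (cong σ (adjacent-involutive k i)))
    }
    where
    open Ranks ranks
    open IsReducedWordOf reduced
    not-shortest : ¬ σ (inject₁ k) Fin.< σ (suc k)
    not-shortest lt with exchange-condition w (inject₁ k) (suc k) (inject₁<suc k)
      (subst₂ Fin._<_ (trans (sym (represents (inject₁ k))) (cong (permute w) (adjacent-inject₁ k)))
                      (trans (sym (represents (suc k))) (cong (permute w) (adjacent-suc k))) lt)
    ... | w′ , len , px , py , rest = ℕ.<⇒≱ (ℕ.n≤1+n _) (subst (λ l → suc l ≤ length w′) len (shortest w′ agrees))
      where
      agrees : ∀ i → permute w′ i ≡ σ i
      agrees i with adjacentView k i
      ... | left      = trans px (trans (cong (permute w) (sym (adjacent-inject₁ k))) (represents (inject₁ k)))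
      ... | right     = trans py (trans (cong (permute w) (sym (adjacent-suc k))) (represents (suc k)))
      ... | other p q = trans (rest i p q) (trans (cong (permute w) (sym (adjacent-other k p q))) (represents i))
    ascent : lookup v (inject₁ k) < lookup v (suc k)
    ascent = ℕ.≰⇒> λ le → not-shortest (case (ℕ.m≤n⇒m<n∨m≡n le))
      where
      case : lookup v (suc k) < lookup v (inject₁ k) ⊎ lookup v (suc k) ≡ lookup v (inject₁ k) →
        σ (inject₁ k) Fin.< σ (suc k)
      case (inj₁ lt) = larger-first _ _ lt
      case (inj₂ eq) = left-first _ _ (inject₁<suc k) (sym eq)

  private

    filter-≤ : ∀ {a} {A : Set a} {P Q : A → Set} (P? : ∀ x → Dec (P x)) (Q? : ∀ x → Dec (Q x)) → (∀ x → P x → Q x) →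
               ∀ xs → length (filter P? xs) ≤ length (filter Q? xs)
    filter-≤ P? Q? imp [] = z≤n
    filter-≤ P? Q? imp (x ∷ xs) with P? x | Q? x
    ... | yes p | yes q = s≤s (filter-≤ P? Q? imp xs)
    ... | yes p | no ¬q = ⊥-elim (¬q (imp x p))
    ... | no ¬p | yes q = ℕ.m≤n⇒m≤1+n (filter-≤ P? Q? imp xs)
    ... | no ¬p | no ¬q = filter-≤ P? Q? imp xs

    filter-< : ∀ {a} {A : Set a} {P Q : A → Set} (P? : ∀ x → Dec (P x)) (Q? : ∀ x → Dec (Q x)) → (∀ x → P x → Q x) →
               ∀ {x xs} → x ∈ xs → ¬ P x → Q x → length (filter P? xs) < length (filter Q? xs)
    filter-< P? Q? imp {x} {.x ∷ xs} (here refl) ¬px qx with P? x | Q? x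
    ... | yes p | _     = ⊥-elim (¬px p)
    ... | no _  | no ¬q = ⊥-elim (¬q qx)
    ... | no _  | yes _ = s≤s (filter-≤ P? Q? imp xs)
    filter-< P? Q? imp {x} {y ∷ xs} (there x∈) ¬px qx with P? y | Q? y
    ... | yes p | yes q = s≤s (filter-< P? Q? imp x∈ ¬px qx)
    ... | yes p | no ¬q = ⊥-elim (¬q (imp y p))
    ... | no ¬p | yes q = ℕ.m≤n⇒m≤1+n (filter-< P? Q? imp x∈ ¬px qx)
    ... | no ¬p | no ¬q = filter-< P? Q? imp x∈ ¬px qx

  module _ {m} (v : Vec ℕ (suc m)) where

    private

      Beats : Fin (suc m) → Fin (suc m) → Set
      Beats i j = (j Fin.≤ i × lookup v i ≤ lookup v j) ⊎ (i Fin.< j × lookup v i < lookup v j)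

      beats? : ∀ i j → Dec (Beats i j)
      beats? i j = ((j Fin.≤? i) ×-dec (lookup v i ℕ.≤? lookup v j)) ⊎-dec ((i Fin.<? j) ×-dec (lookup v i ℕ.<? lookup v j))

      beats-≤ : ∀ {i j} → Beats i j → lookup v i ≤ lookup v j
      beats-≤ (inj₁ (_ , le)) = le
      beats-≤ (inj₂ (_ , lt)) = ℕ.<⇒≤ lt

      beats-< : ∀ i j → lookup v i < lookup v j → Beats i j
      beats-< i j lt with j Fin.≤? i
      ... | yes j≤i = inj₁ (j≤i , ℕ.<⇒≤ lt)
      ... | no j≰i  = inj₂ (ℕ.≰⇒> j≰i , lt)

      beats-refl : ∀ i → Beats i i
      beats-refl i = inj₁ (ℕ.≤-refl , ℕ.≤-refl)

      rank-< : ∀ i j → (∀ l → Beats i l → Beats j l) → ¬ Beats i j → rank v i < rank v j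
      rank-< i j imp ¬b = filter-< (beats? i) (beats? j) imp (∈-allFin j) ¬b (beats-refl j)

      0<rank : ∀ i → 0 < rank v i
      0<rank i = ℕ.≤-<-trans z≤n (filter-< (λ _ → no id) (beats? i) (λ _ ()) (∈-allFin i) id (beats-refl i))

      r-< : ∀ i j → rank v i < rank v j → r v i Fin.< r v j
      r-< i j lt = subst₂ _<_ (sym (Fin.toℕ-fromℕ< _)) (sym (Fin.toℕ-fromℕ< _)) (ℕ.pred-mono-< {{ℕ.>-nonZero (0<rank i)}} lt)

    -- `rank` counts the positions that beat a given one. In both clauses one such set is contained
    -- in the other and misses the position whose rank is to be larger, which beats itself.
    r-ranks : Ranks v (r v)
    r-ranks = record
      { larger-first = λ i j lt → r-< j i (rank-< j i (λ l b → beats-< i l (ℕ.<-≤-trans lt (beats-≤ b)))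
        (λ b → ℕ.<⇒≱ lt (beats-≤ b)))
      ; left-first   = λ i j i<j eq → r-< i j (rank-< i j (imp i j i<j eq) (¬b i j i<j eq))
      }
      where
      imp : ∀ i j → i Fin.< j → lookup v i ≡ lookup v j → ∀ l → Beats i l → Beats j l
      imp i j i<j eq l (inj₁ (l≤i , le)) = inj₁ (ℕ.≤-trans l≤i (ℕ.<⇒≤ i<j) , subst (_≤ lookup v l) eq le)
      imp i j i<j eq l (inj₂ (_ , lt))   = beats-< j l (subst (_< lookup v l) eq lt)
      ¬b : ∀ i j → i Fin.< j → lookup v i ≡ lookup v j → ¬ Beats i j
      ¬b i j i<j eq (inj₁ (j≤i , _)) = ℕ.<⇒≱ i<j j≤i
      ¬b i j i<j eq (inj₂ (_ , lt))  = ℕ.<⇒≢ lt eq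

  private

    -- The sum of j v_j with positions counted from 0, which drops when an ascent is exchanged.
    weight : ∀ {m} → Vec ℕ m → ℕ
    weight []      = 0
    weight (x ∷ v) = Vec.sum v + weight v

    sum-swapAt : ∀ {m} (k : Fin m) v → Vec.sum (swapAt k v) ≡ Vec.sum v
    sum-swapAt zero    (x ∷ y ∷ v) = exchange-left y x (Vec.sum v)
      where
      exchange-left : ∀ a b c → a + (b + c) ≡ b + (a + c)
      exchange-left = ℕ.solve-∀
    sum-swapAt (suc k) (x ∷ v)     = cong (λ u → x + u) (sum-swapAt k v)

    weight-swapAt : ∀ {m} (k : Fin m) v → lookup v (inject₁ k) < lookup v (suc k) → weight (swapAt k v) < weight v
    weight-swapAt zero    (x ∷ y ∷ v) x<y = ℕ.+-monoˡ-< _ (ℕ.+-monoˡ-< (Vec.sum v) x<y)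
    weight-swapAt (suc k) (x ∷ v)     x<y =
      subst (λ a → a + weight (swapAt k v) < Vec.sum v + weight v) (sym (sum-swapAt k v))
        (ℕ.+-monoʳ-< (Vec.sum v) (weight-swapAt k v x<y))

  sorting-word : ∀ {m} (v : Vec ℕ (suc m)) → ∃[ w ] Sorts v w
  sorting-word v = go v (<-wellFounded (weight v))
    where
    go : ∀ v → Acc _<_ (weight v) → ∃[ w ] Sorts v w
    go v (acc rec) with Fin.any? (λ k → lookup v (inject₁ k) ℕ.<? lookup v (suc k))
    ... | no ¬asc          = [] , [] (λ k → ℕ.≮⇒≥ (¬asc ∘ (k ,_)))
    ... | yes (k , ascent) with go (swapAt k v) (rec (weight-swapAt k v ascent))
    ...   | w , sorts = k ∷ w , ascent ∷ sorts

-- The seminormal form in terms of contents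

module ContentGaps {m : ℕ} (κ : Partition (suc m)) where

  open Tableaux κ
  open TableauContents κ

  gap : Tableau → Fin m → ℤ
  gap T k = CT T (suc k) ℤ.- CT T (inject₁ k)

  private

    cells-distinct : ∀ T k → cell T (inject₁ k) ≢ cell T (suc k)
    cells-distinct T k eq = inject₁≢suc k (cell-injective T eq)

    not-between : ∀ T (k : Fin m) a → inject₁ k Fin.< entry T a → ¬ entry T a Fin.< suc k
    not-between T k a lt gt = ℕ.<⇒≱ lt (subst (toℕ (entry T a) ℕ.≤_) (≡.sym (Fin.toℕ-inject₁ k)) (ℕ.s≤s⁻¹ gt))

    not-before : ∀ T k → ¬ entry T (cell T (suc k)) Fin.< entry T (cell T (inject₁ k))
    not-before T k lt = ℕ.<-asym (inject₁<suc k) (subst₂ Fin._<_ (entry-cell T (suc k)) (entry-cell T (inject₁ k)) lt)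

    +1-gap : ∀ c r → (suc c ⊖ r) ≡ (c ⊖ r) ℤ.+ + 1
    +1-gap c r = ≡.sym (≡.trans (ℤ.distribˡ-⊖-+-pos 1 c r) (cong (_⊖ r) (ℕ.+-comm c 1)))

    -1-gap : ∀ c r → (c ⊖ r) ≡ (c ⊖ suc r) ℤ.+ + 1
    -1-gap c r = ≡.trans (≡.sym (ℤ.[1+m]⊖[1+n]≡m⊖n c r)) (+1-gap c (suc r))

  -- The two cells are neighbours, because a cell between them would need an entry between k and k +
  -- 1; the larger label is on the left.
  gap-row : ∀ T k → row (cell T (inject₁ k)) ≡ row (cell T (suc k)) → gap T k ≡ -[1+ 0 ]
  gap-row T k r≡r = ≡.trans (cong (λ z → CT T (suc k) ℤ.- z) CT≡) (minus-one (CT T (suc k)))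
    where
    a = cell T (inject₁ k)
    b = cell T (suc k)
    b<a : col b ℕ.< col a
    b<a with ℕ.<-cmp (col b) (col a)
    ... | tri< lt _ _ = lt
    ... | tri≈ _ eq _ = ⊥-elim (cells-distinct T k (row,col-injective r≡r (≡.sym eq)))
    ... | tri> _ _ gt = ⊥-elim (not-before T k (rowsDecrease T a b r≡r gt))
    col≡ : col a ≡ suc (col b)
    col≡ with ℕ.m≤n⇒m<n∨m≡n b<a | cellLeft a (suc (col b)) b<a
    ... | inj₂ eq | _ = ≡.sym eq
    ... | inj₁ lt | x , rx , cx = ⊥-elim (not-between T k x
      (subst (Fin._< entry T x) (entry-cell T (inject₁ k)) (rowsDecrease T x a rx (subst (ℕ._< col a) (≡.sym cx) lt)))
      (subst (entry T x Fin.<_) (entry-cell T (suc k)) (rowsDecrease T b x (≡.sym (≡.trans rx r≡r))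
        (subst (col b ℕ.<_) (≡.sym cx) ℕ.≤-refl))))
    CT≡ : CT T (inject₁ k) ≡ CT T (suc k) ℤ.+ + 1
    CT≡ = ≡.trans (cong₂ _⊖_ col≡ r≡r) (+1-gap (col b) (row b))
    minus-one : ∀ z → z ℤ.- (z ℤ.+ + 1) ≡ -[1+ 0 ]
    minus-one = ℤ.solve-∀

  gap-col : ∀ T k → col (cell T (inject₁ k)) ≡ col (cell T (suc k)) → gap T k ≡ + 1
  gap-col T k c≡c = ≡.trans (cong (λ z → z ℤ.- CT T (inject₁ k)) CT≡) (plus-one (CT T (inject₁ k)))
    where
    a = cell T (inject₁ k)
    b = cell T (suc k)
    b<a : row b ℕ.< row a
    b<a with ℕ.<-cmp (row b) (row a)
    ... | tri< lt _ _ = lt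
    ... | tri≈ _ eq _ = ⊥-elim (cells-distinct T k (row,col-injective (≡.sym eq) c≡c))
    ... | tri> _ _ gt = ⊥-elim (not-before T k (colsDecrease T a b c≡c gt))
    plus-one : ∀ z → (z ℤ.+ + 1) ℤ.- z ≡ + 1
    plus-one = ℤ.solve-∀
    row≡ : row a ≡ suc (row b)
    row≡ with ℕ.m≤n⇒m<n∨m≡n b<a | cellBelow a (suc (row b)) b<a
    ... | inj₂ eq | _ = ≡.sym eq
    ... | inj₁ lt | x , rx , cx = ⊥-elim (not-between T k x
      (subst (Fin._< entry T x) (entry-cell T (inject₁ k)) (colsDecrease T x a cx (subst (ℕ._< row a) (≡.sym rx) lt)))
      (subst (entry T x Fin.<_) (entry-cell T (suc k)) (colsDecrease T b x (≡.sym (≡.trans cx c≡c))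
        (subst (row b ℕ.<_) (≡.sym rx) ℕ.≤-refl))))
    CT≡ : CT T (suc k) ≡ CT T (inject₁ k) ℤ.+ + 1
    CT≡ = ≡.trans (-1-gap (col b) (row b)) (cong (λ z → z ℤ.+ + 1) (cong₂ _⊖_ (≡.sym c≡c) (≡.sym row≡)))

  -- k + 1 lies strictly to the right of k: strictly to the left, the two cells would span a
  -- rectangle and their labels would differ by at least 2.
  gap-positive : ∀ T k → row (cell T (suc k)) ℕ.< row (cell T (inject₁ k)) →
                 col (cell T (inject₁ k)) ≢ col (cell T (suc k)) → + 0 ℤ.≤ gap T k
  gap-positive T k r<r c≢c = ℤ.i≤j⇒0≤j-i (ℤ.<⇒≤ (ℤ.<-trans (ℤ.⊖-monoʳ->-< (col a) r<r) (ℤ.⊖-monoˡ-< (row b) c<c)))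
    where
    a = cell T (inject₁ k)
    b = cell T (suc k)
    c<c : col a ℕ.< col b
    c<c with ℕ.<-cmp (col a) (col b)
    ... | tri< lt _ _ = lt
    ... | tri≈ _ eq _ = ⊥-elim (c≢c eq)
    ... | tri> _ _ gt = ⊥-elim (ℕ.1+n≰n (subst₂ (λ x y → 2 ℕ.+ x ℕ.≤ y)
      (≡.trans (cong toℕ (entry-cell T (inject₁ k))) (Fin.toℕ-inject₁ k)) (cong toℕ (entry-cell T (suc k)))
      (entry-upperLeft T b a r<r gt)))

  -- The bound -2 keeps clear of the gap -1, where `offDiagonal` is set to 0 instead of 1.
  gap-negative : ∀ T k → row (cell T (inject₁ k)) ℕ.< row (cell T (suc k)) → + 2 ℤ.+ gap T k ℤ.≤ + 0
  gap-negative T k r<r = subst (λ z → z ℤ.≤ + 0) (rearrange (CT T (suc k)) (CT T (inject₁ k))) (ℤ.i≤j⇒i-j≤0 (begin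
    CT T (suc k) ℤ.+ + 2       ≡⟨ ℤ.distribˡ-⊖-+-pos 2 (col b) (row b) ⟩
    (col b ℕ.+ 2) ⊖ row b      ≡⟨ cong (_⊖ row b) (ℕ.+-comm (col b) 2) ⟩
    suc (suc (col b)) ⊖ row b  ≤⟨ ℤ.⊖-monoˡ-≤ (row b) (s≤s c<c) ⟩
    suc (col a) ⊖ row b        ≤⟨ ℤ.⊖-monoʳ-≥-≤ (suc (col a)) r<r ⟩
    suc (col a) ⊖ suc (row a)  ≡⟨ ℤ.[1+m]⊖[1+n]≡m⊖n (col a) (row a) ⟩
    CT T (inject₁ k)           ∎))
    where
    open ℤ.≤-Reasoning
    a = cell T (inject₁ k)
    b = cell T (suc k)
    rearrange : ∀ y x → (y ℤ.+ + 2) ℤ.- x ≡ + 2 ℤ.+ (y ℤ.- x)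
    rearrange = ℤ.solve-∀
    c<c : col b ℕ.< col a
    c<c = ℕ.≰⇒> λ c≤c → not-before T k (ℕ.<-≤-trans (upper c≤c) ℕ.≤-refl)
      where
      upper : col a ℕ.≤ col b → entry T b Fin.< entry T a
      upper c≤c with ℕ.m≤n⇒m<n∨m≡n c≤c
      ... | inj₁ lt = ℕ.<⇒≤ (entry-upperLeft T a b r<r lt)
      ... | inj₂ eq = colsDecrease T a b eq r<r

module Operators {c ℓ₁ ℓ₂ : Level} (K : RationalFunctionField c ℓ₁ ℓ₂) {n : ℕ} (κ : Partition (suc (suc n))) where

  open VectorValuedMacdonald K κ
  open CommutativeRing commutativeRing using (refl; sym; trans)
  open DifferenceSolver commutativeRing
  open Scalars K
  open Pairing heytingField
  open TableauContents κ
  open TableauContents₂ κ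
  open ContentGaps κ
  open SetoidReasoning setoid

  private

    positive-entries : ∀ z .{{_ : NonZero ∣ z ∣}} → + 0 ℤ.≤ z →
      diagonal z ≡ (s - 1#) /1-s^ ∣ z ∣ ×
      offDiagonal z ≡ s * (1# - s ^ suc ∣ z ∣) * (1# - s ^ pred ∣ z ∣) /1-s^ ∣ z ∣ /1-s^ ∣ z ∣
    positive-entries (+ zero)  _ = ⊥-elim (ℕ.≢-nonZero⁻¹ 0 ≡.refl)
    positive-entries (+ suc m) _ = ≡.refl , ≡.refl

    negative-entries : ∀ z .{{_ : NonZero ∣ z ∣}} → + 2 ℤ.+ z ℤ.≤ + 0 →
      diagonal z ≡ s - 1# - (s - 1#) /1-s^ ∣ z ∣ × offDiagonal z ≡ 1#
    negative-entries (+ m)          (ℤ.+≤+ ())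
    negative-entries -[1+ zero ]    (ℤ.+≤+ ())
    negative-entries -[1+ suc m ]   _ = ≡.refl , ≡.refl

    diagonal-row : diagonal -[1+ 0 ] ≈ s
    diagonal-row = begin
      s - 1# - (s - 1#) * i
        ≈⟨ solve 2 (λ s i → s :- :1 :- (s :- :1) :* i := s :- :1 :+ i :* (:1 :- s :* :1)) refl s i ⟩
      s - 1# + i * (1# - s ^ 1)              ≈⟨ +-congˡ (inverse-correct (1-s^m#0 1)) ⟩
      s - 1# + 1#                            ≈⟨ solve 1 (λ s → s :- :1 :+ :1 := s) refl s ⟩
      s                                      ∎
      where i = inverse (1-s^m#0 1)

    diagonal-col : diagonal (+ 1) ≈ - 1#
    diagonal-col = begin
      (s - 1#) * i            ≈⟨ solve 2 (λ s i → (s :- :1) :* i := :- (i :* (:1 :- s :* :1))) refl s i ⟩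
      - (i * (1# - s ^ 1))    ≈⟨ -‿cong (inverse-correct (1-s^m#0 1)) ⟩
      - 1#                    ∎
      where i = inverse (1-s^m#0 1)

    offDiagonal-col : offDiagonal (+ 1) ≈ 0#
    offDiagonal-col = solve 3 (λ s u i → s :* u :* (:1 :- :1) :* i :* i := :0) refl s _ _

  𝔽 : Set c
  𝔽 = Vec ℤ N → Carrier

  private

    hecke-at : ∀ k (f : 𝔽) T → hecke k f (contents T) ≡
               diagonal (gap T k) * f (contents T) + offDiagonal (gap T k) * f (swapAt k (contents T))
    hecke-at k f T = cong₂ (λ x y → d x y * f (contents T) + e x y * f (swapAt k (contents T)))
      (lookup-contents T (inject₁ k)) (lookup-contents T (suc k))

  -- In the row and column cases the swapped vector belongs to no tableau, but its coefficient
  -- vanishes, so the value of `f` there has no effect.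
  T-basis-pair : ∀ k (f : 𝔽) T → pair (f ∘ contents) (T-basis k T) ≈ hecke k f (contents T)
  T-basis-pair k f T rewrite hecke-at k f T with row (cell T (inject₁ k)) ℕ.≟ row (cell T (suc k))
  ... | yes r≡r = begin
    s * 1# * fT + 0#              ≈⟨ solve 3 (λ s u v → s :* :1 :* u :+ :0 := s :* u :+ :0 :* v) refl s fT fT′ ⟩
    s * fT + 0# * fT′             ≈⟨ +-congʳ (*-congʳ diagonal-row) ⟨
    diagonal -[1+ 0 ] * fT + offDiagonal -[1+ 0 ] * fT′
      ≡⟨ cong (λ z → diagonal z * fT + offDiagonal z * fT′) (gap-row T k r≡r) ⟨
    diagonal (gap T k) * fT + offDiagonal (gap T k) * fT′ ∎
    where
    fT = f (contents T)
    fT′ = f (swapAt k (contents T))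
  ... | no ¬row with col (cell T (inject₁ k)) ℕ.≟ col (cell T (suc k))
  ...   | yes c≡c = begin
    - 1# * 1# * fT + 0#           ≈⟨ solve 2 (λ u v → :- :1 :* :1 :* u :+ :0 := (:- :1) :* u :+ :0 :* v) refl fT fT′ ⟩
    - 1# * fT + 0# * fT′          ≈⟨ +-cong (*-congʳ diagonal-col) (*-congʳ offDiagonal-col) ⟨
    diagonal (+ 1) * fT + offDiagonal (+ 1) * fT′  ≡⟨ cong (λ z → diagonal z * fT + offDiagonal z * fT′) (gap-col T k c≡c) ⟨
    diagonal (gap T k) * fT + offDiagonal (gap T k) * fT′ ∎
    where
    fT = f (contents T)
    fT′ = f (swapAt k (contents T))
  -- The `does` of the comparison in `T-basis` computes to this Boolean, so abstracting it releases
  -- the `if`.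
  ...   | no ¬col with row (cell T (suc k)) ℕ.<ᵇ row (cell T (inject₁ k)) | ℕ.<ᵇ-reflects-< (row (cell T (suc k)))
    (row (cell T (inject₁ k)))
  ...     | true | ofʸ r<r = generic _ _ _ _ (proj₁ entries) (proj₂ entries)
    where
    instance
      _ : NonZero (contentGap κ T k)
      _ = contentGap-nonZero κ T k ¬row
    entries = positive-entries (gap T k) (gap-positive T k r<r ¬col)
    generic : ∀ a a′ b b′ → a′ ≡ a → b′ ≡ b →
      a * 1# * f (contents T) + (b * 1# * f (contents (exchange κ T k ¬row ¬col)) + 0#) ≈
              a′ * f (contents T) + b′ * f (swapAt k (contents T))
    generic a _ b _ ≡.refl ≡.refl rewrite contents-exchange T k ¬row ¬col =
      solve 4 (λ a b u v → a :* :1 :* u :+ (b :* :1 :* v :+ :0) := a :* u :+ b :* v) refl a b _ _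
  ...     | false | ofⁿ r≮r = generic _ _ _ (proj₁ entries) (proj₂ entries)
    where
    instance
      _ : NonZero (contentGap κ T k)
      _ = contentGap-nonZero κ T k ¬row
    entries = negative-entries (gap T k) (gap-negative T k (ℕ.≤∧≢⇒< (ℕ.≮⇒≥ r≮r) ¬row))
    generic : ∀ a a′ b′ → a′ ≡ a → b′ ≡ 1# → a * 1# * f (contents T) + (1# * f (contents (exchange κ T k ¬row ¬col)) + 0#) ≈
              a′ * f (contents T) + b′ * f (swapAt k (contents T))
    generic a _ _ ≡.refl ≡.refl rewrite contents-exchange T k ¬row ¬col =
      solve 3 (λ a u v → a :* :1 :* u :+ (:1 :* v :+ :0) := a :* u :+ :1 :* v) refl a _ _

-- Transposed operators on functions of contents

module OperatorMonoid {c ℓ₁ ℓ₂ : Level} (K : RationalFunctionField c ℓ₁ ℓ₂) {n : ℕ} (κ : Partition (suc (suc n))) where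

  open VectorValuedMacdonald K κ
  open CommutativeRing commutativeRing using (refl; sym; trans)
  open DifferenceSolver commutativeRing
  open Scalars K
  open Pairing heytingField
  open TableauContents κ
  open TableauContents₂ κ
  open Operators K κ
  open SetoidReasoning setoid

  infix 4 _≃_

  -- Equality is tested at the contents of tableaux only: the Hecke relations rely on distinct
  -- neighbouring contents, which arbitrary vectors lack.
  _≃_ : 𝔽 → 𝔽 → Set ℓ₁
  f ≃ g = ∀ T → f (contents T) ≈ g (contents T)

  0ᶠ : 𝔽
  0ᶠ _ = 0#

  -- The transpose of a linear operator on V_λ, acting on functions of content vectors.
  record Op : Set (c ⊔ ℓ₁) where
    field
      act      : 𝔽 → 𝔽
      act-cong : ∀ {f g} → f ≃ g → act f ≃ act g
      act-+    : ∀ f g → act (λ X → f X + g X) ≃ (λ X → act f X + act g X)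
      act-*    : ∀ k f → act (λ X → k * f X) ≃ (λ X → k * act f X)

    act-0 : ∀ {f} → f ≃ 0ᶠ → act f ≃ 0ᶠ
    act-0 {f} f≃0 T = begin
      act f (contents T)                   ≈⟨ act-cong (λ T → trans (f≃0 T) (sym (zeroˡ _))) T ⟩
      act (λ X → 0# * f X) (contents T)    ≈⟨ act-* 0# f T ⟩
      0# * act f (contents T)              ≈⟨ zeroˡ _ ⟩
      0#                                   ∎

  open Op public

  -- Transposition and the right action each reverse the order of composition, so a word and the
  -- product of its transposes are read in the same direction.
  opMonoid : Monoid (c ⊔ ℓ₁) (c ⊔ ℓ₁)
  opMonoid = record
    { Carrier  = Op
    ; _≈_      = λ A B → ∀ f → act A f ≃ act B f
    ; _∙_      = λ A B → record
      { act      = act A ∘ act B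
      ; act-cong = act-cong A ∘ act-cong B
      ; act-+    = λ f g T → trans (act-cong A (act-+ B f g) T) (act-+ A (act B f) (act B g) T)
      ; act-*    = λ k f T → trans (act-cong A (act-* B k f) T) (act-* A k (act B f) T)
      }
    ; ε        = record { act = id ; act-cong = id ; act-+ = λ _ _ _ → refl ; act-* = λ _ _ _ → refl }
    ; isMonoid = record
      { isSemigroup = record
        { isMagma = record
          { isEquivalence = record
            { refl  = λ _ _ → refl
            ; sym   = λ eq f T → sym (eq f T)
            ; trans = λ eq eq′ f T → trans (eq f T) (eq′ f T)
            }
          ; ∙-cong = λ {A} {A′} {B} {B′} eq eq′ f T → trans (act-cong A (eq′ f) T) (eq (act B′ f) T)
          }
        ; assoc = λ _ _ _ _ _ → refl
        }
      ; identity = (λ _ _ _ → refl) , (λ _ _ _ → refl)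
      }
    }

  open Products opMonoid public using (prod; prod-cong; prod-inverse)
  open HeckeRelations opMonoid

  scalar : Carrier → Op
  scalar k = record
    { act      = λ f X → k * f X
    ; act-cong = λ eq T → *-congˡ (eq T)
    ; act-+    = λ f g T → distribˡ k _ _
    ; act-*    = λ l f T → solve 3 (λ k l u → k :* (l :* u) := l :* (k :* u)) refl k l (f (contents T))
    }

  t t⁻¹ : Fin (suc n) → Op
  t k = record
    { act      = hecke k
    -- The formula of `hecke` also evaluates at a swapped vector that may belong to no tableau.
    -- Congruence therefore goes through `T-basis`, where only tableaux occur.
    ; act-cong = λ {f} {g} eq T → trans (sym (T-basis-pair k f T)) (trans (pair-cong eq (T-basis k T)) (T-basis-pair k g T))
    ; act-+    = λ f g T → solve 6 (λ p o u v u′ v′ → p :* (u :+ v) :+ o :* (u′ :+ v′) := (p :* u :+ o :* u′) :+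
      (p :* v :+ o :* v′)) refl _ _ _ _ _ _
    ; act-*    = λ l f T → solve 5 (λ l p o u u′ → p :* (l :* u) :+ o :* (l :* u′) := l :*
      (p :* u :+ o :* u′)) refl l _ _ _ _
    }
  t⁻¹ k = record
    { act      = λ f X → s⁻¹ * (hecke k f X + (1# - s) * f X)
    ; act-cong = λ {f} {g} eq T → *-congˡ (+-cong (act-cong (t k) {f} {g} eq T) (*-congˡ (eq T)))
    ; act-+    = λ f g T → trans (*-congˡ (+-congʳ (act-+ (t k) f g T)))
        (solve 6 (λ i z h h′ u v → i :* ((h :+ h′) :+ z :* (u :+ v)) := i :* (h :+ z :* u) :+ i :*
          (h′ :+ z :* v)) refl s⁻¹ (1# - s) _ _ _ _)
    ; act-*    = λ l f T → trans (*-congˡ (+-congʳ (act-* (t k) l f T)))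
        (solve 5 (λ i z l h u → i :* (l :* h :+ z :* (l :* u)) := l :* (i :* (h :+ z :* u))) refl s⁻¹ (1# - s) l _ _)
    }

  κᵒ Dᵒ : Fin N → Op
  κᵒ i = scalar (s^ℤ (suc (toℕ i) ⊖ N))
  Dᵒ i = record
    { act      = murphy i
    ; act-cong = λ eq T → *-congˡ (eq T)
    ; act-+    = λ f g T → distribˡ _ _ _
    ; act-*    = λ l f T → solve 3 (λ k l u → k :* (l :* u) := l :* (k :* u)) refl _ l (f (contents T))
    }

  private

    t⁻¹t : ∀ k (f : 𝔽) T → s⁻¹ * (hecke k (hecke k f) (contents T) + (1# - s) * hecke k f (contents T)) ≈ f (contents T)
    t⁻¹t k f T = begin
      s⁻¹ * (hecke k (hecke k f) (contents T) + (1# - s) * h)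
        ≈⟨ *-congˡ (+-congʳ (hecke-quadratic k f (contents T) (contents-inject₁≢suc T k))) ⟩
      s⁻¹ * ((s - 1#) * h + s * u + (1# - s) * h)
        ≈⟨ solve 4 (λ i s h u → i :* ((s :- :1) :* h :+ s :* u :+ (:1 :- s) :* h) := i :* s :* u) refl s⁻¹ s h u ⟩
      s⁻¹ * s * u
        ≈⟨ trans (*-congʳ s⁻¹*s) (*-identityˡ u) ⟩
      u ∎
      where
      h = hecke k f (contents T)
      u = f (contents T)

  scalar-central : ∀ k A (f : 𝔽) → (λ X → k * act A f X) ≃ act A (λ X → k * f X)
  scalar-central k A f T = sym (act-* A k f T)

  isHecke : IsHecke t t⁻¹ (scalar s) (scalar s⁻¹) κᵒ Dᵒ
  isHecke = record
    { inverseˡ    = t⁻¹t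
    ; inverseʳ    = λ k f T → trans (act-* (t k) s⁻¹ (λ X → hecke k f X + (1# - s) * f X) T)
        (trans (*-congˡ (trans (act-+ (t k) (hecke k f) (λ X → (1# - s) * f X) T)
          (+-congˡ (act-* (t k) (1# - s) f T)))) (t⁻¹t k f T))
    ; far         = λ k j lt f T → hecke-far k j f (contents T) lt
    ; braid       = λ k f T → hecke-braid k f (contents T) (contents-inject₁≢suc T (inject₁ k))
        (contents-inject₁≢suc T (suc k)) (contents-inject₁≢suc-suc T k)
    ; σ-central   = scalar-central s
    ; σ⁻¹-central = scalar-central s⁻¹
    ; κ-central   = λ i → scalar-central (s^ℤ (suc (toℕ i) ⊖ N))
    ; σ⁻¹σ        = λ f T → trans (sym (*-assoc _ _ _)) (trans (*-congʳ s⁻¹*s) (*-identityˡ _))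
    ; κ-suc       = λ k f T → trans (*-congʳ (κ-step k)) (*-assoc _ _ _)
    ; κ-last      = λ f T → trans (*-congʳ (reflexive (cong s^ℤ_
      (≡.trans (cong (λ x → suc x ⊖ N) (Fin.toℕ-fromℕ (suc n))) (ℤ.n⊖n≡0 N))))) (*-identityˡ _)
    ; D-last      = λ f T → trans (*-congʳ (reflexive (cong s^ℤ_
      (≡.trans (lookup-contents T (fromℕ (suc n))) (CT-last T))))) (*-identityˡ _)
    ; D-step      = λ k f T → hecke-murphy k f (contents T) (contents-inject₁≢suc T k)
    }
    where
    κ-step : ∀ k → s^ℤ (suc (suc (toℕ k)) ⊖ N) ≈ s * s^ℤ (suc (toℕ (inject₁ k)) ⊖ N)
    κ-step k = begin
      s^ℤ (suc (suc (toℕ k)) ⊖ N)                     ≡⟨ cong (λ x → s^ℤ (x ⊖ N)) (ℕ.+-comm 1 (suc (toℕ k))) ⟩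
      s^ℤ ((suc (toℕ k) ℕ.+ 1) ⊖ N)                   ≡⟨ cong s^ℤ_ (ℤ.distribˡ-⊖-+-pos 1 (suc (toℕ k)) N) ⟨
      s^ℤ ((suc (toℕ k) ⊖ N) ℤ.+ + 1)                 ≈⟨ s^ℤ-+ (suc (toℕ k) ⊖ N) 1 ⟩
      s^ℤ (suc (toℕ k) ⊖ N) * (s * 1#)                ≈⟨ solve 2 (λ x s → x :* (s :* :1) := s :* x) refl _ s ⟩
      s * s^ℤ (suc (toℕ k) ⊖ N)                       ≡⟨ cong (λ x → s * s^ℤ (suc x ⊖ N)) (Fin.toℕ-inject₁ k) ⟨
      s * s^ℤ (suc (toℕ (inject₁ k)) ⊖ N)             ∎

  open IsHecke isHecke public using (inverseˡ; inverseʳ)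

  letterᵒ : Op → Op → Data.Bool.Base.Bool → Fin (suc n) → Op
  letterᵒ = letter isHecke

  cycleᵒ : Op
  cycleᵒ = cycle isHecke

  loopᵒ : Exponent N → Fin N → Op
  loopᵒ = loop isHecke

  upLetterᵒ downLetterᵒ : ℕ → ℕ → Fin (suc n) → Op
  upLetterᵒ   = upLetter isHecke
  downLetterᵒ = downLetter isHecke

  upᵒ downᵒ : Exponent N → Fin N → Fin (suc n) → Op
  upᵒ   = up isHecke
  downᵒ = down isHecke

  loopᵒ-conjugate : ∀ {v w} → Sorts v w → ∀ i f →
    act (loopᵒ v i) (act (prod t w) f) ≃ act (prod t w) (murphy (permute w i) f)
  loopᵒ-conjugate sorts i f = loop-conjugate isHecke sorts i f

  T-pair : ∀ k (f : 𝔽) u → pair (f ∘ contents) (T⟨ k ⟩ u) ≈ pair (hecke k f ∘ contents) u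
  T-pair k f u = trans (pair-linear (f ∘ contents) (T-basis k) u) (pair-cong (T-basis-pair k f) u)

  T-word-pair : ∀ w (f : 𝔽) u → pair (f ∘ contents) (applyAll T⟨_⟩ w u) ≈ pair (act (prod t w) f ∘ contents) u
  T-word-pair []      f u = refl
  T-word-pair (k ∷ w) f u = trans (T-word-pair w f (T⟨ k ⟩ u)) (T-pair k (act (prod t w) f) u)

  T⁻¹-word-pair : ∀ w (f : 𝔽) u → pair (f ∘ contents) (applyAll T⁻¹⟨_⟩ w u) ≈ pair (act (prod t⁻¹ w) f ∘ contents) u
  T⁻¹-word-pair []      f u = refl
  T⁻¹-word-pair (k ∷ w) f u = trans (T⁻¹-word-pair w f (T⁻¹⟨ k ⟩ u)) (begin
    pair g (s⁻¹ • (T⟨ k ⟩ u ⊕ (1# - s) • u))           ≈⟨ pair-• g s⁻¹ (T⟨ k ⟩ u ⊕ (1# - s) • u) ⟩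
    s⁻¹ * pair g (T⟨ k ⟩ u ⊕ (1# - s) • u)
      ≈⟨ *-congˡ (trans (pair-⊕ g (T⟨ k ⟩ u) _) (+-cong (T-pair k g′ u) (pair-• g (1# - s) u))) ⟩
    s⁻¹ * (pair (hecke k g′ ∘ contents) u + (1# - s) * pair g u)
      ≈⟨ *-congˡ (+-congˡ (pair-* (1# - s) g u)) ⟨
    s⁻¹ * (pair (hecke k g′ ∘ contents) u + pair (λ T → (1# - s) * g T) u)
      ≈⟨ *-congˡ (pair-+ (hecke k g′ ∘ contents) (λ T → (1# - s) * g T) u) ⟨
    s⁻¹ * pair (λ T → hecke k g′ (contents T) + (1# - s) * g T) u
      ≈⟨ pair-* s⁻¹ (λ T → hecke k g′ (contents T) + (1# - s) * g T) u ⟨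
    pair (act (t⁻¹ k) g′ ∘ contents) u ∎)
    where
    g′ = act (prod t⁻¹ w) f
    g = g′ ∘ contents

lookup-insertAt-before : ∀ {m} (z : Vec ℕ m) i k c → toℕ k ℕ.< toℕ i → lookup (insertAt z i c) (inject₁ k) ≡ lookup z k
lookup-insertAt-before (x ∷ z) (suc i) zero    c _         = ≡.refl
lookup-insertAt-before (x ∷ z) (suc i) (suc k) c (s≤s k<i) = lookup-insertAt-before z i k c k<i

lookup-insertAt-after : ∀ {m} (z : Vec ℕ m) i k c → toℕ i ℕ.≤ toℕ k → lookup (insertAt z i c) (suc k) ≡ lookup z k
lookup-insertAt-after (x ∷ z) zero    k       c _         = ≡.refl
lookup-insertAt-after (x ∷ z) (suc i) (suc k) c (s≤s i≤k) = lookup-insertAt-after z i k c i≤k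

insertAt-last : ∀ {m} (z : Vec ℕ m) c → insertAt z (fromℕ m) c ≡ z Vec.∷ʳ c
insertAt-last []      c = ≡.refl
insertAt-last (x ∷ z) c = cong (x ∷_) (insertAt-last z c)

replace-insertAt : ∀ {m} (z : Vec ℕ m) k c α β → insertAt z (suc k) c [ inject₁ k ]≔ α [ suc k ]≔ β
  ≡ insertAt (z [ k ]≔ β) (inject₁ k) α
replace-insertAt (x ∷ z) zero    c α β = ≡.refl
replace-insertAt (x ∷ z) (suc k) c α β = cong (x ∷_) (replace-insertAt z k c α β)

replace-bump : ∀ {m} (v : Vec ℕ (suc m)) k x y → (v [ inject₁ k ]≔ x [ suc k ]≔ y) [ suc k ]%= suc
  ≡ v [ inject₁ k ]≔ x [ suc k ]≔ suc y
replace-bump (_ ∷ _ ∷ v) zero    x y = ≡.refl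
replace-bump (a ∷ v)     (suc k) x y = cong (a ∷_) (replace-bump v k x y)

replace-lookup : ∀ {m} (v : Vec ℕ (suc m)) k → v [ inject₁ k ]≔ lookup v (inject₁ k) [ suc k ]≔ lookup v (suc k) ≡ v
replace-lookup (_ ∷ _ ∷ v) zero    = ≡.refl
replace-lookup (a ∷ v)     (suc k) = cong (a ∷_) (replace-lookup v k)

-- Divided differences under a functional

module DividedDifference {c ℓ₁ ℓ₂ : Level} (K : RationalFunctionField c ℓ₁ ℓ₂) {m : ℕ} where

  open RationalFunctionField K
  open CommutativeRing commutativeRing using (refl; sym; trans)
  open FormalSums commutativeRing
  open Polynomials commutativeRing {m}
  open Pairing heytingField
  open DifferenceSolver commutativeRing
  open SetoidReasoning setoid

  private

    pair-multiplyByX : ∀ (g : Exponent (suc m) → Carrier) i p → pair g (multiplyByX i p) ≈ pair (λ v → g (v [ i ]%= suc)) p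
    pair-multiplyByX g i p = trans (pair-linear g (λ v → [ v [ i ]%= suc ]) p)
      (pair-cong (λ v → pair-[] g (v [ i ]%= suc)) p)

    pair-applyUpTo-0 : ∀ (g : Exponent (suc m) → Carrier) h N → (∀ j → j ℕ.< N → g (h j) ≈ 0#) →
                       pair g (applyUpTo (λ j → 1# , h j) N) ≈ 0#
    pair-applyUpTo-0 g h zero    eq = refl
    pair-applyUpTo-0 g h (suc N) eq = trans (+-cong (trans (*-identityˡ _) (eq 0 (s≤s z≤n)))
      (pair-applyUpTo-0 g (h ∘ suc) N (λ j j<N → eq (suc j) (s≤s j<N)))) (+-identityˡ 0#)

    -- After multiplication by x_{k+1} the summands have exponents (b + j , a - j). All but j = 0
    -- lie strictly between and are killed by `g`.
    pair-geometric : ∀ (g : Exponent (suc m) → Carrier) k v b D →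
                     (∀ p p′ → 0 ℕ.< p → 0 ℕ.< p′ → p ℕ.+ p′ ≡ suc D → g (replace k (b ℕ.+ p) (b ℕ.+ p′) v) ≈ 0#) →
                     pair g (multiplyByX (suc k) (geometric k v (b ℕ.+ suc D) b)) ≈ g (replace k b (b ℕ.+ suc D) v)
    pair-geometric g k v b D between = begin
      pair g (multiplyByX (suc k) (geometric k v a b))     ≈⟨ pair-multiplyByX g (suc k) (geometric k v a b) ⟩
      pair g′ (applyUpTo (λ j → 1# , h j) (a ∸ b))
        ≡⟨ cong (λ M → pair g′ (applyUpTo (λ j → 1# , h j) M)) (ℕ.m+n∸m≡n b (suc D)) ⟩
      1# * g′ (h 0) + pair g′ (applyUpTo (λ j → 1# , h (suc j)) D)
        ≈⟨ +-cong (*-identityˡ _) (pair-applyUpTo-0 g′ (h ∘ suc) D inner) ⟩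
      g′ (h 0) + 0#                                        ≈⟨ +-identityʳ _ ⟩
      g′ (h 0)
        ≡⟨ cong g (≡.trans (replace-bump v k (b ℕ.+ 0) (a ∸ 1 ∸ 0))
          (cong₂ (λ x y → replace k x y v) (ℕ.+-identityʳ b) head)) ⟩
      g (replace k b a v)                                  ∎
      where
      a = b ℕ.+ suc D
      g′ : Exponent (suc m) → Carrier
      g′ w = g (w [ suc k ]%= suc)
      h : ℕ → Exponent (suc m)
      h j = replace k (b ℕ.+ j) (a ∸ 1 ∸ j) v
      head : suc (a ∸ 1) ≡ a
      head = ≡.trans (cong (λ x → suc (x ∸ 1)) (ℕ.+-suc b D)) (≡.sym (ℕ.+-suc b D))
      exponent : ∀ j → j ℕ.< D → suc (a ∸ 1 ∸ suc j) ≡ b ℕ.+ (D ∸ j)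
      exponent j j<D = ≡.trans (cong (λ x → suc (x ∸ 1 ∸ suc j)) (ℕ.+-suc b D))
        (≡.trans (cong suc (ℕ.+-∸-assoc b j<D)) (≡.trans (≡.sym (ℕ.+-suc b _)) (cong (b ℕ.+_) (≡.sym (ℕ.+-∸-assoc 1 j<D)))))
      inner : ∀ j → j ℕ.< D → g′ (h (suc j)) ≈ 0#
      inner j j<D = trans (reflexive (cong g (≡.trans (replace-bump v k (b ℕ.+ suc j) (a ∸ 1 ∸ suc j))
        (cong (λ y → replace k (b ℕ.+ suc j) y v) (exponent j j<D)))))
        (between (suc j) (D ∸ j) (s≤s z≤n) (ℕ.m<n⇒0<n∸m j<D) (cong suc (ℕ.m+[n∸m]≡n (ℕ.<⇒≤ j<D))))

    geometric-empty : ∀ k v a b → a ℕ.≤ b → geometric k v a b ≡ []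
    geometric-empty k v a b a≤b = cong (applyUpTo (λ j → 1# , replace k (b ℕ.+ j) (a ∸ 1 ∸ j) v)) (ℕ.m≤n⇒m∸n≡0 a≤b)

    as-sum : ∀ {x y} → x ℕ.< y → ∃[ D ] y ≡ x ℕ.+ suc D
    as-sum {x} {y} x<y = y ∸ suc x , ≡.sym (≡.trans (ℕ.+-suc x _) (ℕ.m+[n∸m]≡n x<y))

    split : ∀ (g : Exponent (suc m) → Carrier) k v → let a = lookup v (inject₁ k); b = lookup v (suc k) in
            pair g (multiplyByX (suc k) (∂ k v)) ≈
            pair g (multiplyByX (suc k) (geometric k v a b)) - pair g (multiplyByX (suc k) (geometric k v b a))
    split g k v = begin
      pair g (multiplyByX (suc k) (∂ k v))                               ≈⟨ pair-multiplyByX g (suc k) (∂ k v) ⟩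
      pair g′ (geometric k v a b ⊕ (- 1# • geometric k v b a))           ≈⟨ pair-⊕ g′ (geometric k v a b) _ ⟩
      pair g′ (geometric k v a b) + pair g′ (- 1# • geometric k v b a)   ≈⟨ +-congˡ (pair-• g′ (- 1#) (geometric k v b a)) ⟩
      pair g′ (geometric k v a b) + - 1# * pair g′ (geometric k v b a)
        ≈⟨ solve 2 (λ x y → x :+ :- :1 :* y := x :- y) refl _ _ ⟩
      pair g′ (geometric k v a b) - pair g′ (geometric k v b a)
        ≈⟨ +-cong (pair-multiplyByX g (suc k) (geometric k v a b))
          (-‿cong (pair-multiplyByX g (suc k) (geometric k v b a))) ⟨
      pair g (multiplyByX (suc k) (geometric k v a b)) - pair g (multiplyByX (suc k) (geometric k v b a)) ∎
      where
      a = lookup v (inject₁ k)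
      b = lookup v (suc k)
      g′ : Exponent (suc m) → Carrier
      g′ w = g (w [ suc k ]%= suc)

    empty : ∀ (g : Exponent (suc m) → Carrier) k v a b → a ℕ.≤ b → pair g (multiplyByX (suc k) (geometric k v a b)) ≈ 0#
    empty g k v a b a≤b = reflexive (cong (pair g ∘ multiplyByX (suc k)) (geometric-empty k v a b a≤b))

    x-0 : ∀ x → x - 0# ≈ x
    x-0 x = solve 1 (λ x → x :- :0 := x) refl x

    nonempty : ∀ (g : Exponent (suc m) → Carrier) k v a b → b ℕ.< a →
               (∀ p p′ → 0 ℕ.< p → 0 ℕ.< p′ → a ≡ b ℕ.+ (p ℕ.+ p′) → g (replace k (b ℕ.+ p) (b ℕ.+ p′) v) ≈ 0#) →
               pair g (multiplyByX (suc k) (geometric k v a b)) ≈ g (replace k b a v)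
    nonempty g k v a b b<a between with as-sum b<a
    ... | D , ≡.refl = pair-geometric g k v b D λ p p′ 0<p 0<p′ eq → between p p′ 0<p 0<p′ (cong (b ℕ.+_) (≡.sym eq))

  ∂-equal : ∀ g k v → lookup v (inject₁ k) ≡ lookup v (suc k) → pair g (multiplyByX (suc k) (∂ k v)) ≈ 0#
  ∂-equal g k v eq = trans (split g k v) (trans (+-cong (empty g k v _ _ (ℕ.≤-reflexive eq))
    (-‿cong (empty g k v _ _ (ℕ.≤-reflexive (≡.sym eq))))) (x-0 0#))

  -- The surviving monomial has the smaller exponent at position k: here it is the swapped one, in
  -- `∂-less` it is x^v itself with a minus sign.
  ∂-greater : ∀ g k v → let a = lookup v (inject₁ k); b = lookup v (suc k) in b ℕ.< a →
              (∀ p p′ → 0 ℕ.< p → 0 ℕ.< p′ → a ≡ b ℕ.+ (p ℕ.+ p′) → g (replace k (b ℕ.+ p) (b ℕ.+ p′) v) ≈ 0#) →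
              pair g (multiplyByX (suc k) (∂ k v)) ≈ g (swap k v)
  ∂-greater g k v b<a between = trans (split g k v) (trans (+-cong (nonempty g k v _ _ b<a between)
    (-‿cong (empty g k v _ _ (ℕ.<⇒≤ b<a)))) (x-0 _))

  ∂-less : ∀ g k v → let a = lookup v (inject₁ k); b = lookup v (suc k) in a ℕ.< b →
           (∀ p p′ → 0 ℕ.< p → 0 ℕ.< p′ → b ≡ a ℕ.+ (p ℕ.+ p′) → g (replace k (a ℕ.+ p) (a ℕ.+ p′) v) ≈ 0#) →
           pair g (multiplyByX (suc k) (∂ k v)) ≈ - g v
  ∂-less g k v a<b between = trans (split g k v) (trans (+-cong (empty g k v _ _ (ℕ.<⇒≤ a<b))
    (-‿cong (trans (nonempty g k v _ _ a<b between) (reflexive (cong g (replace-lookup v k)))))) (+-identityˡ _))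

-- Transposes of the operators on vector-valued polynomials

module Transposes {c ℓ₁ ℓ₂ : Level} (K : RationalFunctionField c ℓ₁ ℓ₂) {n : ℕ} (κ : Partition (suc (suc n))) where

  open VectorValuedMacdonald K κ
  open Polynomials commutativeRing {suc n}
  open import Data.Vec.Base using (_∷ʳ_)
  open CommutativeRing commutativeRing using (refl; sym; trans)
  open DifferenceSolver commutativeRing
  open Scalars K
  open Pairing heytingField
  open TableauContents κ
  open Operators K κ
  open OperatorMonoid K κ
  open SetoidReasoning setoid

  𝔾 : Set c
  𝔾 = Exponent N → 𝔽

  lift : 𝔾 → Exponent N × Tableau → Carrier
  lift F (v , T) = F v (contents T)

  -- What `F` becomes after precomposition with the operator. Words act on functionals by `foldr`,
  -- since the operator applied last is transposed first.
  𝐓* 𝐓⁻¹* : Fin (suc n) → 𝔾 → 𝔾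
  𝐓* k F v X   = (1# - s) * pair (λ w → F w X) (multiplyByX (suc k) (∂ k v)) + hecke k (F (swap k v)) X
  𝐓⁻¹* k F v X = s⁻¹ * (𝐓* k F v X + (1# - s) * F v X)

  𝐰* : 𝔾 → 𝔾
  𝐰* F (v₁ ∷ v) X = q ^ v₁ * act cycleᵒ (F (v ∷ʳ v₁)) X

  Ξ* : Fin N → 𝔾 → 𝔾
  Ξ* i F v X = s^ℤ (suc (toℕ i) ⊖ N) * foldr 𝐓⁻¹* (𝐰* (foldr 𝐓* F (after i))) (before i) v X

  private

    𝐓-pair : ∀ k F P → pair (lift F) (𝐓⟨ k ⟩ P) ≈ pair (lift (𝐓* k F)) P
    𝐓-pair k F P = trans (pair-linear (lift F) 𝐓-basis P) (pair-cong on-basis P)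
      where
      𝐓-basis : Exponent N × Tableau → M
      𝐓-basis (v , T) = ((1# - s) • multiplyByX (suc k) (∂ k v)) ⊗ [ T ] ⊕ [ swap k v ] ⊗ T⟨ k ⟩ [ T ]
      on-basis : ∀ b → pair (lift F) (𝐓-basis b) ≈ lift (𝐓* k F) b
      on-basis (v , T) = trans (pair-⊕ (lift F) (((1# - s) • p) ⊗ [ T ]) _) (+-cong
        (begin
          pair (lift F) (((1# - s) • p) ⊗ [ T ])                         ≈⟨ pair-⊗ (lift F) ((1# - s) • p) [ T ] ⟩
          pair (λ w → pair (F w ∘ contents) [ T ]) ((1# - s) • p)
            ≈⟨ pair-cong (λ w → pair-[] (F w ∘ contents) T) ((1# - s) • p) ⟩
          pair (λ w → F w (contents T)) ((1# - s) • p)                   ≈⟨ pair-• (λ w → F w (contents T)) (1# - s) p ⟩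
          (1# - s) * pair (λ w → F w (contents T)) p                     ∎)
        (begin
          pair (lift F) ([ swap k v ] ⊗ T⟨ k ⟩ [ T ])                    ≈⟨ pair-⊗ (lift F) [ swap k v ] (T⟨ k ⟩ [ T ]) ⟩
          pair (λ w → pair (F w ∘ contents) (T⟨ k ⟩ [ T ])) [ swap k v ]
            ≈⟨ pair-[] (λ w → pair (F w ∘ contents) (T⟨ k ⟩ [ T ])) (swap k v) ⟩
          pair (F (swap k v) ∘ contents) (T⟨ k ⟩ [ T ])                  ≈⟨ T-pair k (F (swap k v)) [ T ] ⟩
          pair (hecke k (F (swap k v)) ∘ contents) [ T ]                 ≈⟨ pair-[] (hecke k (F (swap k v)) ∘ contents) T ⟩
          hecke k (F (swap k v)) (contents T)                            ∎))
        where p = multiplyByX (suc k) (∂ k v)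

    𝐓⁻¹-pair : ∀ k F P → pair (lift F) (𝐓⁻¹⟨ k ⟩ P) ≈ pair (lift (𝐓⁻¹* k F)) P
    𝐓⁻¹-pair k F P = begin
      pair (lift F) (s⁻¹ • (𝐓⟨ k ⟩ P ⊕ (1# - s) • P))                    ≈⟨ pair-• (lift F) s⁻¹ (𝐓⟨ k ⟩ P ⊕ (1# - s) • P) ⟩
      s⁻¹ * pair (lift F) (𝐓⟨ k ⟩ P ⊕ (1# - s) • P)
        ≈⟨ *-congˡ (trans (pair-⊕ (lift F) (𝐓⟨ k ⟩ P) _) (+-cong (𝐓-pair k F P) (pair-• (lift F) (1# - s) P))) ⟩
      s⁻¹ * (pair (lift (𝐓* k F)) P + (1# - s) * pair (lift F) P)        ≈⟨ *-congˡ (+-congˡ (pair-* (1# - s) (lift F) P)) ⟨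
      s⁻¹ * (pair (lift (𝐓* k F)) P + pair (λ b → (1# - s) * lift F b) P)
        ≈⟨ *-congˡ (pair-+ (lift (𝐓* k F)) (λ b → (1# - s) * lift F b) P) ⟨
      s⁻¹ * pair (λ b → lift (𝐓* k F) b + (1# - s) * lift F b) P
        ≈⟨ pair-* s⁻¹ (λ b → lift (𝐓* k F) b + (1# - s) * lift F b) P ⟨
      pair (lift (𝐓⁻¹* k F)) P                                           ∎

    𝐓-word-pair : ∀ w F P → pair (lift F) (applyAll 𝐓⟨_⟩ w P) ≈ pair (lift (foldr 𝐓* F w)) P
    𝐓-word-pair []      F P = refl
    𝐓-word-pair (k ∷ w) F P = trans (𝐓-word-pair w F (𝐓⟨ k ⟩ P)) (𝐓-pair k (foldr 𝐓* F w) P)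

    𝐓⁻¹-word-pair : ∀ w F P → pair (lift F) (applyAll 𝐓⁻¹⟨_⟩ w P) ≈ pair (lift (foldr 𝐓⁻¹* F w)) P
    𝐓⁻¹-word-pair []      F P = refl
    𝐓⁻¹-word-pair (k ∷ w) F P = trans (𝐓⁻¹-word-pair w F (𝐓⁻¹⟨ k ⟩ P)) (𝐓⁻¹-pair k (foldr 𝐓⁻¹* F w) P)

    𝐰-pair : ∀ F P → pair (lift F) (𝐰 P) ≈ pair (lift (𝐰* F)) P
    𝐰-pair F P = trans (pair-linear (lift F) _ P) (pair-cong (λ { (v₁ ∷ v , T) → on-basis v₁ v T }) P)
      where
      on-basis : ∀ v₁ v T → pair (lift F) (q ^ v₁ • [ v ∷ʳ v₁ ] ⊗ applyAll T⟨_⟩ (allFin (suc n)) [ T ]) ≈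
                            q ^ v₁ * act cycleᵒ (F (v ∷ʳ v₁)) (contents T)
      on-basis v₁ v T = begin
        pair (lift F) (q ^ v₁ • [ v ∷ʳ v₁ ] ⊗ u)                       ≈⟨ pair-• (lift F) (q ^ v₁) ([ v ∷ʳ v₁ ] ⊗ u) ⟩
        q ^ v₁ * pair (lift F) ([ v ∷ʳ v₁ ] ⊗ u)                       ≈⟨ *-congˡ (pair-⊗ (lift F) [ v ∷ʳ v₁ ] u) ⟩
        q ^ v₁ * pair (λ w → pair (F w ∘ contents) u) [ v ∷ʳ v₁ ]
          ≈⟨ *-congˡ (pair-[] (λ w → pair (F w ∘ contents) u) (v ∷ʳ v₁)) ⟩
        q ^ v₁ * pair (F (v ∷ʳ v₁) ∘ contents) u
          ≈⟨ *-congˡ (T-word-pair (allFin (suc n)) (F (v ∷ʳ v₁)) [ T ]) ⟩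
        q ^ v₁ * pair (act cycleᵒ (F (v ∷ʳ v₁)) ∘ contents) [ T ]
          ≈⟨ *-congˡ (pair-[] (act cycleᵒ (F (v ∷ʳ v₁)) ∘ contents) T) ⟩
        q ^ v₁ * act cycleᵒ (F (v ∷ʳ v₁)) (contents T)                 ∎
        where
        u : V
        u = applyAll T⟨_⟩ (allFin (suc n)) [ T ]

  Ξ-pair : ∀ i F P → pair (lift F) (Ξ i P) ≈ pair (lift (Ξ* i F)) P
  Ξ-pair i F P = begin
    pair (lift F) (k • applyAll 𝐓⟨_⟩ (after i) (𝐰 Q))      ≈⟨ pair-• (lift F) k (applyAll 𝐓⟨_⟩ (after i) (𝐰 Q)) ⟩
    k * pair (lift F) (applyAll 𝐓⟨_⟩ (after i) (𝐰 Q))      ≈⟨ *-congˡ (𝐓-word-pair (after i) F (𝐰 Q)) ⟩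
    k * pair (lift (foldr 𝐓* F (after i))) (𝐰 Q)            ≈⟨ *-congˡ (𝐰-pair (foldr 𝐓* F (after i)) Q) ⟩
    k * pair (lift (𝐰* (foldr 𝐓* F (after i)))) Q
      ≈⟨ *-congˡ (𝐓⁻¹-word-pair (before i) (𝐰* (foldr 𝐓* F (after i))) P) ⟩
    k * pair (lift (foldr 𝐓⁻¹* (𝐰* (foldr 𝐓* F (after i))) (before i))) P
      ≈⟨ pair-* k (lift (foldr 𝐓⁻¹* (𝐰* (foldr 𝐓* F (after i))) (before i))) P ⟨
    pair (lift (Ξ* i F)) P                                  ∎
    where
    k = s^ℤ (suc (toℕ i) ⊖ N)
    Q = applyAll 𝐓⁻¹⟨_⟩ (before i) P

-- Triangularity of Ξ_i

-- The leading term of x^v ⊗ u under Ξ_i.  On its way, an operator word has carried the entry c, which starts at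
-- position i of v, to some position of the remaining vector z.  The state (z , c) aims at insertAt z i c, and every
-- step keeps the target or passes to states with smaller targets.
module LeadingTerm {c ℓ₁ ℓ₂ : Level} (K : RationalFunctionField c ℓ₁ ℓ₂) {n : ℕ} (κ : Partition (suc (suc n))) where

  open VectorValuedMacdonald K κ hiding (zero)
  open Polynomials commutativeRing {suc n} using (replace; swap; ∂; multiplyByX)
  open CommutativeRing commutativeRing using (refl; sym; trans)
  open DifferenceSolver commutativeRing
  open Scalars K
  open Pairing heytingField
  open TableauContents κ
  open Operators K κ
  open OperatorMonoid K κ
  open Transposes K κ
  open DividedDifference K {suc n}
  open Monoid opMonoid using (ε)
  open SetoidReasoning setoid

  module _ (i : Fin N) (F : 𝔾) where

    -- Such a functional ignores the lower terms of Ξ_i (x^v ⊗ u), which isolates the leading one.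
    VanishesBelow : Exponent N → Set ℓ₁
    VanishesBelow v = ∀ w → w ◁ v → F w ≃ 0ᶠ

    private

      -- `G` is the functional `F` pulled back along the rest of the word, and `e` is the current
      -- position of the carried entry. `A` expresses `G` at a state through `F` at its target;
      -- `lead-zero` makes states with lower targets drop out.
      record Leads (G : 𝔾) (e : Fin N) (A : Vec ℕ (suc n) → ℕ → 𝔽 → 𝔽) : Set (c ⊔ ℓ₁) where
        constructor leads
        field
          lead      : ∀ z c → VanishesBelow (insertAt z i c) → G (insertAt z e c) ≃ A z c (F (insertAt z i c))
          lead-zero : ∀ z c {f} → f ≃ 0ᶠ → A z c f ≃ 0ᶠ

      open Leads

      leads-◁ : ∀ {G e A} → Leads G e A → ∀ {v} → VanishesBelow v → ∀ z c → insertAt z i c ◁ v → G (insertAt z e c) ≃ 0ᶠ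
      leads-◁ L below z c t◁v T =
        trans (lead L z c (λ w w◁t → below w (◁-trans w◁t t◁v)) T) (lead-zero L z c (below _ t◁v) T)

      upᶻ downᶻ : Vec ℕ (suc n) → ℕ → Fin (suc n) → Op
      upᶻ   z c k = upLetterᵒ c (lookup z k) k
      downᶻ z c k = downLetterᵒ c (lookup z k) k

      module Step (k : Fin (suc n)) {G : 𝔾} {A : Vec ℕ (suc n) → ℕ → 𝔽 → 𝔽} (L : Leads G (inject₁ k) A)
                  (z : Vec ℕ (suc n)) (c : ℕ) (below : VanishesBelow (insertAt z i c)) (T : Tableau) where

        X : Vec ℤ N
        X = contents T

        a : ℕ
        a = lookup z k

        y y′ : Exponent N
        y  = insertAt z (suc k) c
        y′ = insertAt z (inject₁ k) c

        y-left : lookup y (inject₁ k) ≡ a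
        y-left = lookup-insertAt-before z (suc k) k c ℕ.≤-refl

        y-right : lookup y (suc k) ≡ c
        y-right = Vec.insertAt-lookup z (suc k) c

        y-swap : swap k y ≡ y′
        y-swap = ≡.trans (cong₂ (λ α β → replace k α β y) y-right y-left)
          (≡.trans (replace-insertAt z k c c a) (cong (λ z → insertAt z (inject₁ k) c) (Vec.[]≔-lookup z k)))

        -- The same exponent read as a state with carried position k: `c` is left behind, `a` is
        -- carried on, and the target has the two exchanged.
        y-stay : y ≡ exchangeEntry z (inject₁ k) k c
        y-stay = ≡.trans (≡.sym (replace-lookup y k)) (≡.trans (cong₂ (λ α β → replace k α β y) y-left y-right)
          (replace-insertAt z k c a c))

        stay-0 : exchangeEntry z i k c ◁ insertAt z i c → G y X ≈ 0#
        stay-0 lower = trans (reflexive (cong (λ v → G v X) y-stay)) (leads-◁ L below (z [ k ]≔ c) a lower T)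

        difference : Carrier
        difference = pair (λ w → G w X) (multiplyByX (suc k) (∂ k y))

        difference-equal : a ≡ c → difference ≈ 0#
        difference-equal a≡c = ∂-equal (λ w → G w X) k y (≡.trans y-left (≡.trans a≡c (≡.sym y-right)))

        difference-greater : c ℕ.< a → difference ≈ G y′ X
        difference-greater c<a = trans (∂-greater (λ w → G w X) k y
          (subst₂ ℕ._<_ (≡.sym y-right) (≡.sym y-left) c<a) between)
          (reflexive (cong (λ v → G v X) y-swap))
          where
          between : ∀ p p′ → 0 ℕ.< p → 0 ℕ.< p′ → lookup y (inject₁ k) ≡ lookup y (suc k) ℕ.+ (p ℕ.+ p′) →
                    G (replace k (lookup y (suc k) ℕ.+ p) (lookup y (suc k) ℕ.+ p′) y) X ≈ 0#
          between p p′ 0<p 0<p′ eq = trans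
            (reflexive (cong (λ v → G v X) (≡.trans (cong (λ x → replace k (x ℕ.+ p) (x ℕ.+ p′) y) y-right)
              (replace-insertAt z k c (c ℕ.+ p) (c ℕ.+ p′)))))
            (leads-◁ L below (z [ k ]≔ (c ℕ.+ p′)) (c ℕ.+ p)
              (between-below-◁ z i k c p p′ 0<p 0<p′ (≡.trans (≡.sym y-left)
                (≡.trans eq (cong (ℕ._+ (p ℕ.+ p′)) y-right)))) T)

        difference-less : a ℕ.< c → difference ≈ - G y X
        difference-less a<c = ∂-less (λ w → G w X) k y (subst₂ ℕ._<_ (≡.sym y-left) (≡.sym y-right) a<c) between
          where
          between : ∀ p p′ → 0 ℕ.< p → 0 ℕ.< p′ → lookup y (suc k) ≡ lookup y (inject₁ k) ℕ.+ (p ℕ.+ p′) →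
                    G (replace k (lookup y (inject₁ k) ℕ.+ p) (lookup y (inject₁ k) ℕ.+ p′) y) X ≈ 0#
          between p p′ 0<p 0<p′ eq = trans
            (reflexive (cong (λ v → G v X) (≡.trans (cong (λ x → replace k (x ℕ.+ p) (x ℕ.+ p′) y) y-left)
              (replace-insertAt z k c (a ℕ.+ p) (a ℕ.+ p′)))))
            (leads-◁ L below (z [ k ]≔ (a ℕ.+ p′)) (a ℕ.+ p)
              (between-above-◁ z i k c p p′ 0<p 0<p′ (≡.trans (≡.sym y-right)
                (≡.trans eq (cong (ℕ._+ (p ℕ.+ p′)) y-left)))) T)

        h : Carrier
        h = hecke k (G y′) X

        h≈ : hecke k (G (swap k y)) X ≈ h
        h≈ = reflexive (cong (λ v → hecke k (G v) X) y-swap)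

        ready : ∀ B → act B (G y′) X ≈ act B (A z c (F (insertAt z i c))) X
        ready B = act-cong B (lead L z c below) T

        -- For c < a the divided difference adds (1 - s) times the swapped state, turning T_k into
        -- T_k + 1 - s = s T_k⁻¹. For a < c it yields only the state that stays, whose target is
        -- lower. For a = c it vanishes.
        down-value : toℕ i ℕ.≤ toℕ k → 𝐓* k G y X ≈ act (downᶻ z c k) (G y′) X
        down-value i≤k = value (ℕ.<-cmp a c)
          where
          letter-≡ : ∀ {b} → does (c ℕ.<? a) ≡ b → act (letterᵒ (scalar s) ε b k) (G y′) X ≈ act (downᶻ z c k) (G y′) X
          letter-≡ eq = reflexive (cong (λ b → act (letterᵒ (scalar s) ε b k) (G y′) X) (≡.sym eq))
          value : Tri (a ℕ.< c) (a ≡ c) (c ℕ.< a) → 𝐓* k G y X ≈ act (downᶻ z c k) (G y′) X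
          value (tri≈ _ a≡c _) = begin
            (1# - s) * difference + hecke k (G (swap k y)) X  ≈⟨ +-cong (*-congˡ (difference-equal a≡c)) h≈ ⟩
            (1# - s) * 0# + h                                 ≈⟨ solve 2 (λ z h → z :* :0 :+ h := h) refl (1# - s) h ⟩
            h
              ≈⟨ letter-≡ (dec-false (c ℕ.<? a) (ℕ.≤⇒≯ (ℕ.≤-reflexive a≡c))) ⟩
            act (downᶻ z c k) (G y′) X                        ∎
          value (tri> _ _ c<a) = begin
            (1# - s) * difference + hecke k (G (swap k y)) X  ≈⟨ +-cong (*-congˡ (difference-greater c<a)) h≈ ⟩
            (1# - s) * G y′ X + h                             ≈⟨ *-identityˡ _ ⟨
            1# * ((1# - s) * G y′ X + h)                      ≈⟨ *-congʳ s⁻¹*s ⟨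
            s⁻¹ * s * ((1# - s) * G y′ X + h)
              ≈⟨ solve 4 (λ i s u h → i :* s :* ((:1 :- s) :* u :+ h) := s :*
                (i :* (h :+ (:1 :- s) :* u))) refl s⁻¹ s (G y′ X) h ⟩
            s * (s⁻¹ * (h + (1# - s) * G y′ X))               ≈⟨ letter-≡ (dec-true (c ℕ.<? a) c<a) ⟩
            act (downᶻ z c k) (G y′) X                        ∎
          value (tri< a<c _ _) = begin
            (1# - s) * difference + hecke k (G (swap k y)) X
              ≈⟨ +-cong (*-congˡ (trans (difference-less a<c) (-‿cong (stay-0 (exchange-after-◁ z i k c i≤k a<c))))) h≈ ⟩
            (1# - s) * - 0# + h                               ≈⟨ solve 2 (λ z h → z :* (:- :0) :+ h := h) refl (1# - s) h ⟩
            h                                                 ≈⟨ letter-≡ (dec-false (c ℕ.<? a) (ℕ.<-asym a<c)) ⟩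
            act (downᶻ z c k) (G y′) X                        ∎

        -- Here 𝐓_k⁻¹ = s⁻¹ (𝐓_k + 1 - s) adds a staying term. For a = c that is the swapped state,
        -- for c < a it has a lower target, and for a < c it cancels the divided difference and
        -- leaves s⁻¹ T_k.
        up-value : toℕ k ℕ.< toℕ i → 𝐓⁻¹* k G y X ≈ act (upᶻ z c k) (G y′) X
        up-value k<i = value (ℕ.<-cmp a c)
          where
          letter-≡ : ∀ {b} → does (c ℕ.≤? a) ≡ b → act (letterᵒ ε (scalar s⁻¹) b k) (G y′) X ≈ act (upᶻ z c k) (G y′) X
          letter-≡ eq = reflexive (cong (λ b → act (letterᵒ ε (scalar s⁻¹) b k) (G y′) X) (≡.sym eq))
          value : Tri (a ℕ.< c) (a ≡ c) (c ℕ.< a) → 𝐓⁻¹* k G y X ≈ act (upᶻ z c k) (G y′) X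
          value (tri≈ _ a≡c _) = begin
            s⁻¹ * ((1# - s) * difference + hecke k (G (swap k y)) X + (1# - s) * G y X)
              ≈⟨ *-congˡ (+-cong (+-cong (*-congˡ (difference-equal a≡c)) h≈)
                (*-congˡ (reflexive (cong (λ v → G v X) y≡y′)))) ⟩
            s⁻¹ * ((1# - s) * 0# + h + (1# - s) * G y′ X)
              ≈⟨ solve 4 (λ i z h u → i :* (z :* :0 :+ h :+ z :* u) := i :* (h :+ z :* u)) refl s⁻¹ (1# - s) h (G y′ X) ⟩
            s⁻¹ * (h + (1# - s) * G y′ X)
              ≈⟨ letter-≡ (dec-true (c ℕ.≤? a) (ℕ.≤-reflexive (≡.sym a≡c))) ⟩
            act (upᶻ z c k) (G y′) X ∎
            where
            y≡y′ : y ≡ y′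
            y≡y′ = ≡.trans y-stay (cong₂ (λ z x → insertAt z (inject₁ k) x)
              (≡.trans (cong (z [ k ]≔_) (≡.sym a≡c)) (Vec.[]≔-lookup z k)) a≡c)
          value (tri> _ _ c<a) = begin
            s⁻¹ * ((1# - s) * difference + hecke k (G (swap k y)) X + (1# - s) * G y X)
              ≈⟨ *-congˡ (+-cong (+-cong (*-congˡ (difference-greater c<a)) h≈)
                (*-congˡ (stay-0 (exchange-before-◁ z i k c k<i c<a)))) ⟩
            s⁻¹ * ((1# - s) * G y′ X + h + (1# - s) * 0#)
              ≈⟨ solve 4 (λ i z h u → i :* (z :* u :+ h :+ z :* :0) := i :* (h :+ z :* u)) refl s⁻¹ (1# - s) h (G y′ X) ⟩
            s⁻¹ * (h + (1# - s) * G y′ X)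
              ≈⟨ letter-≡ (dec-true (c ℕ.≤? a) (ℕ.<⇒≤ c<a)) ⟩
            act (upᶻ z c k) (G y′) X ∎
          value (tri< a<c _ _) = begin
            s⁻¹ * ((1# - s) * difference + hecke k (G (swap k y)) X + (1# - s) * G y X)
              ≈⟨ *-congˡ (+-congʳ (+-cong (*-congˡ (difference-less a<c)) h≈)) ⟩
            s⁻¹ * ((1# - s) * - G y X + h + (1# - s) * G y X)
              ≈⟨ solve 4 (λ i z h u → i :* (z :* (:- u) :+ h :+ z :* u) := i :* h) refl s⁻¹ (1# - s) h (G y X) ⟩
            s⁻¹ * h
              ≈⟨ letter-≡ (dec-false (c ℕ.≤? a) (ℕ.<⇒≱ a<c)) ⟩
            act (upᶻ z c k) (G y′) X ∎

      leads-down : ∀ k {G A} → toℕ i ℕ.≤ toℕ k → Leads G (inject₁ k) A →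
        Leads (𝐓* k G) (suc k) (λ z c f → act (downᶻ z c k) (A z c f))
      leads-down k i≤k L = leads
        (λ z c below T → trans (Step.down-value k L z c below T i≤k) (Step.ready k L z c below T (downᶻ z c k)))
        (λ z c f≃0 → act-0 (downᶻ z c k) (lead-zero L z c f≃0))

      leads-up : ∀ k {G A} → toℕ k ℕ.< toℕ i → Leads G (inject₁ k) A →
        Leads (𝐓⁻¹* k G) (suc k) (λ z c f → act (upᶻ z c k) (A z c f))
      leads-up k k<i L = leads
        (λ z c below T → trans (Step.up-value k L z c below T k<i) (Step.ready k L z c below T (upᶻ z c k)))
        (λ z c f≃0 → act-0 (upᶻ z c k) (lead-zero L z c f≃0))

      -- The path is followed backwards from its end, where the carried entry is at position i and
      -- `F` itself is evaluated.
      leads-downs : ∀ {p w} → Descends p i w → Leads (foldr 𝐓* F w) p (λ z c f → act (prod (downᶻ z c) w) f)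
      leads-downs []      = leads (λ z c below T → refl) (λ z c f≃0 → f≃0)
      leads-downs (k ∷ D) = leads-down k (subst (toℕ i ℕ.≤_) (Fin.toℕ-inject₁ k) (descends-≤ D)) (leads-downs D)

      leads-cycle : ∀ {G A} → Leads G (fromℕ (suc n)) A → Leads (𝐰* G) zero (λ z c f X → q ^ c * act cycleᵒ (A z c f) X)
      leads-cycle {G} L = leads
        (λ z c below T → *-congˡ (act-cong cycleᵒ
          (λ T → trans (reflexive (cong (λ v → G v (contents T)) (≡.sym (insertAt-last z c)))) (lead L z c below T)) T))
        (λ z c f≃0 T → trans (*-congˡ (act-0 cycleᵒ (lead-zero L z c f≃0) T)) (zeroʳ _))

      leads-ups : ∀ {G A} → Leads G zero A → ∀ {p w} → Descends p zero w → toℕ p ℕ.≤ toℕ i →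
                  Leads (foldr 𝐓⁻¹* G w) p (λ z c f → act (prod (upᶻ z c) w) (A z c f))
      leads-ups L []      p≤i = L
      leads-ups L (k ∷ D) k<i = leads-up k k<i (leads-ups L D (subst (ℕ._≤ toℕ i) (≡.sym (Fin.toℕ-inject₁ k)) (ℕ.<⇒≤ k<i)))

      ups-≈ : ∀ z c f → act (prod (upᶻ z c) (before i)) f ≃ act (prod (upᵒ (insertAt z i c) i) (before i)) f
      ups-≈ z c = prod-cong {f = upᶻ z c} {g = upᵒ (insertAt z i c) i} (All.map
        (λ {k} (_ , k<i) → Monoid.reflexive opMonoid (cong₂ (λ x y → upLetterᵒ x y k)
          (≡.sym (Vec.insertAt-lookup z i c)) (≡.sym (lookup-insertAt-before z i k c k<i))))
        (descends-bounds (descends-before i)))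

      downs-≈ : ∀ z c f → act (prod (downᶻ z c) (after i)) f ≃ act (prod (downᵒ (insertAt z i c) i) (after i)) f
      downs-≈ z c = prod-cong {f = downᶻ z c} {g = downᵒ (insertAt z i c) i} (All.map
        (λ {k} (i≤k , _) → Monoid.reflexive opMonoid (cong₂ (λ x y → downLetterᵒ x y k)
          (≡.sym (Vec.insertAt-lookup z i c)) (≡.sym (lookup-insertAt-after z i k c i≤k))))
        (descends-bounds (descends-after i)))

      leading-insertAt : ∀ z c → VanishesBelow (insertAt z i c) →
                         Ξ* i F (insertAt z i c) ≃ (λ X → q ^ c * act (loopᵒ (insertAt z i c) i) (F (insertAt z i c)) X)
      leading-insertAt z c below T = begin
        Ξ* i F v X
          ≈⟨ *-congˡ (lead (leads-ups (leads-cycle (leads-downs (descends-after i)))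
            (descends-before i) ℕ.≤-refl) z c below T) ⟩
        k * act U (λ X → q ^ c * act cycleᵒ (act D (F v)) X) X
          ≈⟨ *-congˡ (act-* U (q ^ c) (act cycleᵒ (act D (F v))) T) ⟩
        k * (q ^ c * act U (act cycleᵒ (act D (F v))) X)
          ≈⟨ solve 3 (λ k x u → k :* (x :* u) := x :* (k :* u)) refl k (q ^ c) (act U (act cycleᵒ (act D (F v))) X) ⟩
        q ^ c * (k * act U (act cycleᵒ (act D (F v))) X)
          ≈⟨ *-congˡ (*-congˡ (act-cong U (act-cong cycleᵒ (downs-≈ z c (F v))) T)) ⟩
        q ^ c * (k * act U (act cycleᵒ (act D′ (F v))) X)
          ≈⟨ *-congˡ (*-congˡ (ups-≈ z c (act cycleᵒ (act D′ (F v))) T)) ⟩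
        q ^ c * (k * act U′ (act cycleᵒ (act D′ (F v))) X) ∎
        where
        v : Exponent N
        v = insertAt z i c
        X : Vec ℤ N
        X = contents T
        k : Carrier
        k = s^ℤ (suc (toℕ i) ⊖ N)
        U U′ D D′ : Op
        U  = prod (upᶻ z c) (before i)
        U′ = prod (upᵒ v i) (before i)
        D  = prod (downᶻ z c) (after i)
        D′ = prod (downᵒ v i) (after i)

    leading-term : ∀ v → VanishesBelow v → Ξ* i F v ≃ (λ X → q ^ lookup v i * act (loopᵒ v i) (F v) X)
    leading-term v below = subst
      (λ w → VanishesBelow w → Ξ* i F w ≃ (λ X → q ^ lookup v i * act (loopᵒ w i) (F w) X))
      (Vec.insertAt-removeAt v i) (leading-insertAt (removeAt v i) (lookup v i)) below

-- Climbing in the support and the expansion of an eigenfunction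

module Eigenfunction {c ℓ₁ ℓ₂ : Level} (K : RationalFunctionField c ℓ₁ ℓ₂) {n : ℕ} (κ : Partition (suc (suc n))) where

  open VectorValuedMacdonald K κ hiding (zero)
  open Polynomials commutativeRing {suc n} using (exponents)
  open CommutativeRing commutativeRing using (refl; sym; trans)
  open DifferenceSolver commutativeRing
  open FieldProperties heytingField
  open Scalars K
  open Pairing heytingField
  open TableauContents κ
  open Operators K κ
  open OperatorMonoid K κ
  open Transposes K κ
  open LeadingTerm K κ
  open SetoidReasoning setoid

  module C₂ = Coefficients (×-decSetoid exponents tableaux)
  module C₁ = Coefficients tableaux
  module V₁ = Equality tableaux

  infix 4 _≟ᵉ_

  _≟ᵉ_ : (v w : Exponent N) → Dec (v ≡ w)
  _≟ᵉ_ = Vec.≡-dec ℕ._≟_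

  lift-respects : ∀ F {b b′} → DecSetoid._≈_ (×-decSetoid exponents tableaux) b b′ → lift F b ≈ lift F b′
  lift-respects F {v , T} {.v , T′} (≡.refl , eq) = reflexive (cong (F v) (contents-cong T T′ eq))

  at : Exponent N → 𝔽 → 𝔾
  at w f w′ X = if does (w ≟ᵉ w′) then f X else 0#

  at-same : ∀ w f X → at w f w X ≈ f X
  at-same w f X = reflexive (cong (λ b → if b then f X else 0#) (dec-true (w ≟ᵉ w) ≡.refl))

  at-other : ∀ w w′ f X → w ≢ w′ → at w f w′ X ≈ 0#
  at-other w w′ f X ne = reflexive (cong (λ b → if b then f X else 0#) (dec-false (w ≟ᵉ w′) ne))

  at-cong : ∀ w f g → f ≃ g → ∀ w′ → at w f w′ ≃ at w g w′
  at-cong w f g eq w′ T with does (w ≟ᵉ w′)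
  ... | true  = eq T
  ... | false = refl

  -- The coefficient functional of `T`, expressed through contents; `contents-injective` makes it
  -- separate tableaux.
  evaluate : Tableau → 𝔽
  evaluate T X = if does (Vec.≡-dec ℤ._≟_ (contents T) X) then 1# else 0#

  evaluate-same : ∀ T → evaluate T (contents T) ≈ 1#
  evaluate-same T = reflexive (cong (λ b → if b then 1# else 0#)
    (dec-true (Vec.≡-dec ℤ._≟_ (contents T) (contents T)) ≡.refl))

  evaluate-other : ∀ T {X} → contents T ≢ X → evaluate T X ≈ 0#
  evaluate-other T {X} ne = reflexive (cong (λ b → if b then 1# else 0#) (dec-false (Vec.≡-dec ℤ._≟_ (contents T) X) ne))

  evaluate-δ : ∀ T T′ → evaluate T (contents T′) ≈ C₁.δ T T′
  evaluate-δ T T′ with DecSetoid._≟_ tableaux T T′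
  ... | yes T~T′ = trans (reflexive (cong (evaluate T) (≡.sym (contents-cong T T′ T~T′))))
    (trans (evaluate-same T) (reflexive (≡.sym (C₁.δ-yes {T′} {T} T~T′))))
  ... | no T≁T′  = trans (evaluate-other T (T≁T′ ∘ contents-injective T T′)) (reflexive (≡.sym (C₁.δ-no {T′} {T} T≁T′)))

  at-evaluate-δ : ∀ v T b → lift (at v (evaluate T)) b ≈ C₂.δ (v , T) b
  at-evaluate-δ v T (v′ , T′) = case (v ≟ᵉ v′) (DecSetoid._≟_ tableaux T T′)
    where
    case : Dec (v ≡ v′) → Dec (DecSetoid._≈_ tableaux T T′) → at v (evaluate T) v′ (contents T′) ≈ C₂.δ (v , T) (v′ , T′)
    case (no v≢v′)     _          = trans (at-other v v′ (evaluate T) (contents T′) v≢v′)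
      (reflexive (≡.sym (C₂.δ-no {v′ , T′} {v , T} (v≢v′ ∘ proj₁))))
    case (yes ≡.refl) (yes T~T′) = trans (at-same v (evaluate T) (contents T′))
      (trans (evaluate-δ T T′) (trans (reflexive (C₁.δ-yes {T′} {T} T~T′))
        (reflexive (≡.sym (C₂.δ-yes {v′ , T′} {v , T} (≡.refl , T~T′))))))
    case (yes ≡.refl) (no T≁T′)  = trans (at-same v (evaluate T) (contents T′))
      (trans (evaluate-δ T T′) (trans (reflexive (C₁.δ-no {T′} {T} T≁T′))
        (reflexive (≡.sym (C₂.δ-no {v′ , T′} {v , T} (T≁T′ ∘ proj₂))))))

  coeff-pair : ∀ v T P → coeff (v , T) P ≈ pair (lift (at v (evaluate T))) P
  coeff-pair v T P = trans (C₂.coeff≈pair (v , T) P) (pair-cong (sym ∘ at-evaluate-δ v T) P)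

  coeff₁-pair : ∀ T u → V₁.coeff T u ≈ pair (evaluate T ∘ contents) u
  coeff₁-pair T u = trans (C₁.coeff≈pair T u) (pair-cong (sym ∘ evaluate-δ T) u)

  -- The coefficient of x^v in P, as a vector of V_λ.
  block : Exponent N → M → V
  block v = linear λ (v′ , T) → if does (v ≟ᵉ v′) then [ T ] else []

  pair-block : ∀ v f P → pair (f ∘ contents) (block v P) ≈ pair (lift (at v f)) P
  pair-block v f P = trans (pair-linear (f ∘ contents) _ P) (pair-cong (λ (v′ , T) → on-basis v′ T) P)
    where
    on-basis : ∀ v′ T → pair (f ∘ contents) (if does (v ≟ᵉ v′) then [ T ] else []) ≈ lift (at v f) (v′ , T)
    on-basis v′ T with does (v ≟ᵉ v′)
    ... | true  = pair-[] (f ∘ contents) T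
    ... | false = refl

  module _ (v : Exponent N) (T₀ : Tableau) (P : M) (macdonald : IsMacdonald v T₀ P) where

    open IsMacdonald macdonald

    eigenvalue : Fin N → Carrier
    eigenvalue i = q ^ lookup v i * (s^ℤ CT T₀ (r v i))

    NonzeroAt : Exponent N → Set ℓ₂
    NonzeroAt w = ∃[ T ] coeff (w , T) P # 0#

    support : List (Exponent N)
    support = map proj₁ (map proj₂ P)

    private

      eigen-pair : ∀ i F → pair (lift (Ξ* i F)) P ≈ eigenvalue i * pair (lift F) P
      eigen-pair i F = begin
        pair (lift (Ξ* i F)) P              ≈⟨ Ξ-pair i F P ⟨
        pair (lift F) (Ξ i P)
          ≈⟨ C₂.pair-≋ (Ξ i P) (eigenvalue i • P) (lift F) (λ {b} {b′} → lift-respects F {b} {b′}) (eigenfunction i) ⟩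
        pair (lift F) (eigenvalue i • P)    ≈⟨ pair-• (lift F) (eigenvalue i) P ⟩
        eigenvalue i * pair (lift F) P      ∎

      -- The difference between the eigenvalue of Ξ_i belonging to `w` with contents `X` and the
      -- eigenvalue of P; `permute ω i` stands for r_w[i].
      factor : Exponent N → Word (suc n) → Fin N → Vec ℤ N → Carrier
      factor w ω i X = q ^ lookup w i * s^ℤ lookup X (permute ω i) - eigenvalue i

      -- Pair the eigenvalue equation of Ξ_i with the functional h on the block of w: by the triangularity of Ξ_i the
      -- terms not from the block of w come from blocks above it.
      climb : ∀ {w ω} → Sorts w ω → ∀ i (h : 𝔽) → pair (lift (at w (act (prod t ω) (λ X → factor w ω i X * h X)))) P # 0# →
              ∃[ w′ ] w ◁ w′ × NonzeroAt w′ × w′ ∈ support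
      climb {w} {ω} sorts i h nz = found (C₂.pair#0⇒coeff#0 P (lift H) (λ {b} {b′} → lift-respects H {b} {b′}) H#0)
        where
        f : 𝔽
        f = act (prod t ω) h
        F : 𝔾
        F = at w f
        g : 𝔽
        g = act (prod t ω) (λ X → factor w ω i X * h X)
        H : 𝔾
        -- By the eigenvalue equation the first two terms pair to zero with P, so H inherits the
        -- given nonzero value up to sign. On the block of `w`, `loopᵒ-conjugate` makes these terms
        -- equal to `g`, and H vanishes.
        H w′ X = (Ξ* i F w′ X + (- eigenvalue i) * F w′ X) + (- 1#) * at w g w′ X
        H#0 : pair (lift H) P # 0#
        H#0 = P.#-congʳ (sym H-pair) (*#0ʳ {x = - 1#} (P.#-congʳ (solve 1 (λ x → x := (:- :1) :* ((:- :1) :* x)) refl _) nz))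
          where
          H-pair : pair (lift H) P ≈ - 1# * pair (lift (at w g)) P
          H-pair = begin
            pair (lift H) P
              ≈⟨ pair-+ (λ b → lift (Ξ* i F) b + (- eigenvalue i) * lift F b) (λ b → (- 1#) * lift (at w g) b) P ⟩
            pair (λ b → lift (Ξ* i F) b + (- eigenvalue i) * lift F b) P + pair (λ b → (- 1#) * lift (at w g) b) P
              ≈⟨ +-cong (pair-+ (lift (Ξ* i F)) (λ b → (- eigenvalue i) * lift F b) P) (pair-* (- 1#) (lift (at w g)) P) ⟩
            pair (lift (Ξ* i F)) P + pair (λ b → (- eigenvalue i) * lift F b) P + - 1# * pair (lift (at w g)) P
              ≈⟨ +-congʳ (+-cong (eigen-pair i F) (pair-* (- eigenvalue i) (lift F) P)) ⟩
            eigenvalue i * pair (lift F) P + (- eigenvalue i) * pair (lift F) P + - 1# * pair (lift (at w g)) P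
              ≈⟨ solve 3 (λ l x y → l :* x :+ (:- l) :* x :+ (:- :1) :* y := (:- :1) :* y) refl (eigenvalue i) _ _ ⟩
            - 1# * pair (lift (at w g)) P ∎
        below-w : VanishesBelow i F w
        below-w w′ w′◁w T = at-other w w′ f (contents T) (λ { ≡.refl → ◁-irrefl w′◁w })
        at-w : ∀ T → H w (contents T) ≈ 0#
        at-w T = begin
          (Ξ* i F w X + (- λᵢ) * F w X) + (- 1#) * at w g w X
            ≈⟨ +-cong (+-cong (leading-term i F w below-w T) (*-congˡ (at-same w f X))) (*-congˡ (at-same w g X)) ⟩
          (qʷ * act (loopᵒ w i) (F w) X + (- λᵢ) * f X) + (- 1#) * g X
            ≈⟨ +-cong (+-congʳ (*-congˡ (trans (act-cong (loopᵒ w i) {F w} {f} (λ T → at-same w f (contents T)) T)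
              (loopᵒ-conjugate sorts i h T)))) (*-congˡ g≈) ⟩
          (qʷ * A (murphy (permute ω i) h) + (- λᵢ) * A h) + (- 1#) * (qʷ * A (murphy (permute ω i) h) + (- λᵢ) * A h)
            ≈⟨ solve 1 (λ x → x :+ (:- :1) :* x := :0) refl (qʷ * A (murphy (permute ω i) h) + (- λᵢ) * A h) ⟩
          0# ∎
          where
          X = contents T
          λᵢ = eigenvalue i
          qʷ = q ^ lookup w i
          A : 𝔽 → Carrier
          A f = act (prod t ω) f X
          g≈ : g X ≈ qʷ * A (murphy (permute ω i) h) + (- λᵢ) * A h
          g≈ = begin
            g X
              ≈⟨ act-cong (prod t ω) {λ X → factor w ω i X * h X} {λ X → qʷ * murphy (permute ω i) h X +
                (- λᵢ) * h X} (λ T → solve 4 (λ x y l u → (x :* y :- l) :* u := x :* (y :* u) :+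
                (:- l) :* u) refl qʷ (s^ℤ lookup (contents T) (permute ω i)) λᵢ (h (contents T))) T ⟩
            A (λ X → qʷ * murphy (permute ω i) h X + (- λᵢ) * h X)
              ≈⟨ act-+ (prod t ω) (λ X → qʷ * murphy (permute ω i) h X) (λ X → (- λᵢ) * h X) T ⟩
            A (λ X → qʷ * murphy (permute ω i) h X) + A (λ X → (- λᵢ) * h X)
              ≈⟨ +-cong (act-* (prod t ω) qʷ (murphy (permute ω i) h) T) (act-* (prod t ω) (- λᵢ) h T) ⟩
            qʷ * A (murphy (permute ω i) h) + (- λᵢ) * A h ∎
        not-above : ∀ w′ T → w ≢ w′ → ¬ w ◁ w′ → H w′ (contents T) ≈ 0#
        not-above w′ T w≢w′ ¬w◁w′ = begin
          (Ξ* i F w′ X + (- eigenvalue i) * F w′ X) + (- 1#) * at w g w′ X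
            ≈⟨ +-cong (+-cong (leading-term i F w′ below T) (*-congˡ (at-other w w′ f X w≢w′)))
              (*-congˡ (at-other w w′ g X w≢w′)) ⟩
          (q ^ lookup w′ i * act (loopᵒ w′ i) (F w′) X + (- eigenvalue i) * 0#) + (- 1#) * 0#
            ≈⟨ +-congʳ (+-congʳ (*-congˡ (act-0 (loopᵒ w′ i) {F w′} (λ T → at-other w w′ f (contents T) w≢w′) T))) ⟩
          (q ^ lookup w′ i * 0# + (- eigenvalue i) * 0#) + (- 1#) * 0#
            ≈⟨ solve 2 (λ x y → (x :* :0 :+ y :* :0) :+ (:- :1) :* :0 := :0) refl (q ^ lookup w′ i) (- eigenvalue i) ⟩
          0# ∎
          where
          X = contents T
          below : VanishesBelow i F w′
          below w″ w″◁w′ T = at-other w w″ f (contents T) (λ { ≡.refl → ¬w◁w′ w″◁w′ })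
        found : ∃[ b ] lift H b # 0# × coeff b P # 0# × b ∈ map proj₂ P → ∃[ w′ ] w ◁ w′ × NonzeroAt w′ × w′ ∈ support
        found ((w′ , T) , H#0 , coeff#0 , b∈) = cases (w ≟ᵉ w′) (w ◁? w′)
          where
          cases : Dec (w ≡ w′) → Dec (w ◁ w′) → ∃[ w′ ] w ◁ w′ × NonzeroAt w′ × w′ ∈ support
          cases (yes w≡w′) _          = contradiction H#0 (≈⇒¬# (subst (λ w′ → H w′ (contents T) ≈ 0#) w≡w′ (at-w T)))
          cases (no _)     (yes w◁w′) = w′ , w◁w′ , (T , coeff#0) , ∈-map⁺ proj₁ b∈
          cases (no w≢w′)  (no ¬w◁w′) = contradiction H#0 (≈⇒¬# (not-above w′ T w≢w′ ¬w◁w′))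

      undo-sorting : ∀ ω f → act (prod t ω) (act (prod t⁻¹ (List.reverse ω)) f) ≃ f
      undo-sorting ω f T = trans (reflexive (cong (λ ω′ → act (prod t ω′) (act (prod t⁻¹ (List.reverse ω)) f)
        (contents T)) (≡.sym (List.reverse-involutive ω))))
        (prod-inverse t t⁻¹ inverseʳ (List.reverse ω) f T)

      -- Some entry of `w` differs from that of `v`, so the powers of q differ and `factor` is
      -- invertible at every vector. Dividing by it, after undoing the sorting word, brings the
      -- coefficient functional of `T` into the form required by `climb`.
      climb-≢ : ∀ {w} → w ≢ v → NonzeroAt w → ∃[ w′ ] w ◁ w′ × NonzeroAt w′ × w′ ∈ support
      climb-≢ {w} w≢v (T , coeff#0) with Fin.¬∀⟶∃¬ N (λ i → lookup w i ≡ lookup v i)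
        (λ i → lookup w i ℕ.≟ lookup v i) (w≢v ∘ lookup-injective) | sorting-word w
      ... | i , wᵢ≢vᵢ | ω , sorts = climb sorts i h (P.#-congʳ
        (trans (coeff-pair w T P) (pair-cong (λ (w′ , T′) → at-cong w (evaluate T)
        (act (prod t ω) (λ X → factor w ω i X * h X)) same w′ T′) P)) coeff#0)
        where
        R : 𝔽 → 𝔽
        R = act (prod t⁻¹ (List.reverse ω))
        factor#0 : ∀ X → factor w ω i X # 0#
        factor#0 X = eigenvalues-distinct {lookup w i} {lookup v i} {lookup X (permute ω i)} {CT T₀ (r v i)} (wᵢ≢vᵢ ∘ proj₁)
        h : 𝔽
        h X = inverse (factor#0 X) * R (evaluate T) X
        same : evaluate T ≃ act (prod t ω) (λ X → factor w ω i X * h X)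
        same T′ = sym (trans (act-cong (prod t ω) {λ X → factor w ω i X * h X} {R (evaluate T)} cancel T′)
          (undo-sorting ω (evaluate T) T′))
          where
          cancel : (λ X → factor w ω i X * h X) ≃ R (evaluate T)
          cancel T′ = trans (solve 3 (λ x i u → x :* (i :* u) := i :* x :* u) refl (factor w ω i (contents T′))
            (inverse (factor#0 (contents T′))) (R (evaluate T) (contents T′)))
            (trans (*-congʳ (inverse-correct (factor#0 (contents T′)))) (*-identityˡ _))

      exponent : Fin (length support) → Exponent N
      exponent = List.lookup support

      -- The order is pulled back to the indices of the finite list `support`, where a strict
      -- partial order cannot ascend forever.
      noetherian : WellFounded (flip (λ j j′ → exponent j ◁ exponent j′))
      noetherian = spo-noetherian {_⊏_ = λ j j′ → exponent j ◁ exponent j′} record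
        { isEquivalence = ≡.isEquivalence
        ; irrefl        = λ { ≡.refl → ◁-irrefl }
        ; trans         = ◁-trans
        ; <-resp-≈      = (λ { ≡.refl → id }) , (λ { ≡.refl → id })
        }

      Top : Exponent N → Set ℓ₂
      Top w = (w ≡ v ⊎ w ◁ v) × NonzeroAt v

      climb-top : ∀ j → Acc (flip (λ j j′ → exponent j ◁ exponent j′)) j → NonzeroAt (exponent j) → Top (exponent j)
      climb-top j (acc rec) nz with exponent j ≟ᵉ v
      ... | yes eq = inj₁ eq , subst NonzeroAt eq nz
      ... | no ne = continue (climb-≢ ne nz)
        where
        continue : ∃[ w′ ] exponent j ◁ w′ × NonzeroAt w′ × w′ ∈ support → Top (exponent j)
        continue (w′ , j◁w′ , nz′ , w′∈) = inj₂ (above (proj₁ top)) , proj₂ top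
          where
          j′ = Any.index w′∈
          w′≡ : w′ ≡ exponent j′
          w′≡ = Any.lookup-index w′∈
          j◁j′ : exponent j ◁ exponent j′
          j◁j′ = subst (exponent j ◁_) w′≡ j◁w′
          top : Top (exponent j′)
          top = climb-top j′ (rec j◁j′) (subst NonzeroAt w′≡ nz′)
          above : exponent j′ ≡ v ⊎ exponent j′ ◁ v → exponent j ◁ v
          above (inj₁ eq) = subst (exponent j ◁_) eq j◁j′
          above (inj₂ lt) = ◁-trans j◁j′ lt

    nonzero⇒support : ∀ {w} → NonzeroAt w → w ∈ support
    nonzero⇒support {w} (T , coeff#0) with C₂.pair#0⇒coeff#0 P (C₂.δ (w , T))
      (λ {b} {b′} → C₂.δ-respects (w , T) {b} {b′}) (P.#-congʳ (C₂.coeff≈pair (w , T) P) coeff#0)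
    ... | (w′ , T′) , δ#0 , _ , b∈ = case (w ≟ᵉ w′)
      where
      case : Dec (w ≡ w′) → w ∈ support
      case (yes w≡w′) = subst (_∈ support) (≡.sym w≡w′) (∈-map⁺ proj₁ b∈)
      case (no w≢w′)  = contradiction δ#0 (≈⇒¬# (reflexive (C₂.δ-no {w′ , T′} {w , T} (w≢w′ ∘ proj₁))))

    nonzero⇒top : ∀ {w} → NonzeroAt w → (w ≡ v ⊎ w ◁ v) × NonzeroAt v
    nonzero⇒top {w} nz = subst Top (≡.sym w≡) (climb-top (Any.index w∈) (noetherian _) (subst NonzeroAt w≡ nz))
      where
      w∈ = nonzero⇒support nz
      w≡ : w ≡ exponent (Any.index w∈)
      w≡ = Any.lookup-index w∈

    module _ (w : Word (suc n)) (reduced : IsReducedWordOf (r v) w) where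

      open IsReducedWordOf reduced

      private

        -- The block at `v` with R_v undone by the sorting word; it turns out to be a multiple of
        -- `T₀`.
        y : V
        y = applyAll T⟨_⟩ w (block v P)

      leading : Carrier
      leading = V₁.coeff T₀ y

      private

        sorts : Sorts v w
        sorts = reduced⇒sorts w (r-ranks v) reduced

        y-pair : ∀ f → pair (f ∘ contents) y ≈ pair (lift (at v (act (prod t w) f))) P
        y-pair f = trans (T-word-pair w f (block v P)) (pair-block v (act (prod t w) f) P)

        -- The contents of `T` and `T₀` differ at some label j. For the i with r_v[i] = j the
        -- eigenvalues of Ξ_i differ, so a nonzero coefficient would allow a climb to a nonzero
        -- block above `v`, against `nonzero⇒top`.
        not-eigenvector : ∀ T → ¬ DecSetoid._≈_ tableaux T₀ T → ¬ V₁.coeff T y # 0#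
        not-eigenvector T T₀≁T coeff#0 = refute
          (Fin.¬∀⟶∃¬ N (λ j → lookup (contents T) j ≡ lookup (contents T₀) j)
            (λ j → lookup (contents T) j ℤ.≟ lookup (contents T₀) j)
            (λ eq → T₀≁T (contents-injective T₀ T (≡.sym (lookup-injective eq)))))
          where
          refute : ¬ (∃[ j ] lookup (contents T) j ≢ lookup (contents T₀) j)
          refute (j , ne) = above-v (climb sorts i h (P.#-congʳ
              (trans (coeff₁-pair T y) (trans (y-pair (evaluate T))
                (pair-cong (λ (v′ , T′) → at-cong v A A′
                (act-cong (prod t w) {evaluate T} {λ X → factor v w i X * h X} same) v′ T′) P))) coeff#0))
            where
            i : Fin N
            i = proj₁ (permute-surjective w j)
            wi≡j : permute w i ≡ j
            wi≡j = proj₂ (permute-surjective w j)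
            factor#0 : factor v w i (contents T) # 0#
            factor#0 = eigenvalues-distinct {lookup v i} {lookup v i} {lookup (contents T) (permute w i)} {CT T₀
              (r v i)} λ (_ , eq) →
              ne (≡.trans (cong (lookup (contents T)) (≡.sym wi≡j)) (≡.trans eq
                (≡.trans (cong (CT T₀) (≡.trans (≡.sym (represents i)) wi≡j)) (≡.sym (lookup-contents T₀ j)))))
            -- The factor may vanish at other content vectors, so it is inverted at the contents of
            -- `T` alone; `evaluate T` vanishes at the other tableaux.
            h : 𝔽
            h X = inverse factor#0 * evaluate T X
            A A′ : 𝔽
            A  = act (prod t w) (evaluate T)
            A′ = act (prod t w) (λ X → factor v w i X * h X)
            same : evaluate T ≃ (λ X → factor v w i X * h X)
            same T′ = case (DecSetoid._≟_ tableaux T T′)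
              where
              X = contents T′
              case : Dec (DecSetoid._≈_ tableaux T T′) → evaluate T X ≈ factor v w i X * (inverse factor#0 * evaluate T X)
              case (yes T~T′) = subst (λ X → evaluate T X ≈ factor v w i X * (inverse factor#0 * evaluate T X))
                (contents-cong T T′ T~T′)
                (sym (trans (sym (*-assoc _ _ _)) (trans (*-congʳ (trans (*-comm _ _) (inverse-correct factor#0)))
                  (*-identityˡ _))))
              case (no T≁T′)  = trans elsewhere (sym (trans (*-congˡ (trans (*-congˡ elsewhere) (zeroʳ _))) (zeroʳ _)))
                where
                elsewhere : evaluate T X ≈ 0#
                elsewhere = evaluate-other T (T≁T′ ∘ contents-injective T T′)
            above-v : ¬ (∃[ w′ ] v ◁ w′ × NonzeroAt w′ × w′ ∈ support)
            above-v (w′ , v◁w′ , nz , _) with proj₁ (nonzero⇒top nz)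
            ... | inj₁ ≡.refl = ◁-irrefl v◁w′
            ... | inj₂ w′◁v   = ◁-irrefl (◁-trans v◁w′ w′◁v)

        y-≋ : y V₁.≋ leading • [ T₀ ]
        y-≋ T = case (DecSetoid._≟_ tableaux T₀ T)
          where
          case : Dec (DecSetoid._≈_ tableaux T₀ T) → V₁.coeff T y ≈ V₁.coeff T (leading • [ T₀ ])
          case (yes T₀~T) = begin
            V₁.coeff T y                      ≈⟨ coeff₁-pair T y ⟩
            pair (evaluate T ∘ contents) y
              ≡⟨ cong (λ X → pair ((λ X′ → if does (Vec.≡-dec ℤ._≟_ X X′) then 1# else 0#) ∘ contents) y)
                (contents-cong T₀ T T₀~T) ⟨
            pair (evaluate T₀ ∘ contents) y   ≈⟨ coeff₁-pair T₀ y ⟨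
            leading                           ≈⟨ solve 1 (λ x → x := x :* :1 :* :1 :+ :0) refl leading ⟩
            leading * 1# * 1# + 0#            ≈⟨ +-congʳ (*-congˡ one) ⟨
            pair (C₁.δ T) (leading • [ T₀ ])  ≈⟨ C₁.coeff≈pair T (leading • [ T₀ ]) ⟨
            V₁.coeff T (leading • [ T₀ ])     ∎
            where
            one : C₁.δ T T₀ ≈ 1#
            one = reflexive (C₁.δ-yes {T₀} {T} (DecSetoid.sym tableaux {T₀} {T} T₀~T))
          case (no T₀≁T) = begin
            V₁.coeff T y                      ≈⟨ ¬#⇒≈ (not-eigenvector T T₀≁T) ⟩
            0#                                ≈⟨ solve 1 (λ x → :0 := x :* :1 :* :0 :+ :0) refl leading ⟩
            leading * 1# * 0# + 0#            ≈⟨ +-congʳ (*-congˡ none) ⟨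
            pair (C₁.δ T) (leading • [ T₀ ])  ≈⟨ C₁.coeff≈pair T (leading • [ T₀ ]) ⟨
            V₁.coeff T (leading • [ T₀ ])     ∎
            where
            none : C₁.δ T T₀ ≈ 0#
            none = reflexive (C₁.δ-no {T₀} {T} (λ eq → T₀≁T (DecSetoid.sym tableaux {T} {T₀} eq)))

      -- The block is recovered from `y` by R_v, and `y` is `leading` times `T₀`.
      leading-block : ∀ f → pair (lift (at v f)) P ≈ leading * pair (f ∘ contents) (R⟨ w ⟩ [ T₀ ])
      leading-block f = begin
        pair (lift (at v f)) P
          ≈⟨ pair-cong (λ (v′ , T′) → at-cong v (act (prod t w) (R f)) f (undo-sorting w f) v′ T′) P ⟨
        pair (lift (at v (act (prod t w) (R f)))) P      ≈⟨ y-pair (R f) ⟨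
        pair (R f ∘ contents) y
          ≈⟨ C₁.pair-≋ y (leading • [ T₀ ]) (R f ∘ contents) (λ {T} {T′} eq → reflexive
            (cong (R f) (contents-cong T T′ eq))) y-≋ ⟩
        pair (R f ∘ contents) (leading • [ T₀ ])         ≈⟨ pair-• (R f ∘ contents) leading [ T₀ ] ⟩
        leading * pair (R f ∘ contents) [ T₀ ]           ≈⟨ *-congˡ (T⁻¹-word-pair (List.reverse w) f [ T₀ ]) ⟨
        leading * pair (f ∘ contents) (R⟨ w ⟩ [ T₀ ])    ∎
        where
        R : 𝔽 → 𝔽
        R = act (prod t⁻¹ (List.reverse w))

      -- Climbing from a nonzero coefficient of P ends in the block of `v`, and each coefficient of
      -- that block has `leading` as a factor.
      leading#0 : leading # 0#
      leading#0 = *#0ˡ (P.#-congʳ (trans (coeff-pair v (proj₁ nz) P) (leading-block (evaluate (proj₁ nz)))) (proj₂ nz))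
        where
        nz : NonzeroAt v
        nz = proj₂ (nonzero⇒top {proj₁ (proj₁ nonzero)} (proj₂ (proj₁ nonzero) , proj₂ nonzero))

      -- The support repeats exponents, but each block may enter the sum only once.
      lower : List (Exponent N)
      lower = deduplicate _≟ᵉ_ (filter (_◁? v) support)

      lower-◁ : All (_◁ v) lower
      lower-◁ = All.tabulate λ w∈ → proj₂ (∈-filter⁻ (_◁? v) {xs = support}
        (∈-deduplicate⁻ _≟ᵉ_ (filter (_◁? v) support) w∈))

      lower-unique : Unique lower
      lower-unique = Unique.deduplicate-! _≟ᵉ_ (filter (_◁? v) support)

      private

        module Coefficient (v₀ : Exponent N) (T : Tableau) where

          f : 𝔽
          f = evaluate T

          term : ∀ v′ u → pair (lift (at v₀ f)) ([ v′ ] ⊗ u) ≈ pair (at v₀ f v′ ∘ contents) u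
          term v′ u = trans (pair-⊗ (lift (at v₀ f)) [ v′ ] u) (pair-[] (λ v″ → pair (at v₀ f v″ ∘ contents) u) v′)

          term-same : ∀ u → pair (lift (at v₀ f)) ([ v₀ ] ⊗ u) ≈ pair (f ∘ contents) u
          term-same u = trans (term v₀ u) (pair-cong (λ T′ → at-same v₀ f (contents T′)) u)

          term-other : ∀ {v′} u → v₀ ≢ v′ → pair (lift (at v₀ f)) ([ v′ ] ⊗ u) ≈ 0#
          term-other {v′} u ne = trans (term v′ u) (pair-0 (λ T′ → at-other v₀ v′ f (contents T′) ne) u)

          blocks : List (Exponent N) → M
          blocks vs = Sum vs (λ v′ → [ v′ ] ⊗ block v′ P)

          sum-∉ : ∀ vs → v₀ ∉ vs → pair (lift (at v₀ f)) (blocks vs) ≈ 0#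
          sum-∉ []       _   = refl
          sum-∉ (v′ ∷ vs) v₀∉ = trans (pair-⊕ (lift (at v₀ f)) ([ v′ ] ⊗ block v′ P) (blocks vs))
            (trans (+-cong (term-other (block v′ P) (λ eq → v₀∉ (here eq))) (sum-∉ vs (v₀∉ ∘ there))) (+-identityˡ _))

          sum-∈ : ∀ vs → Unique vs → v₀ ∈ vs → pair (lift (at v₀ f)) (blocks vs) ≈ coeff (v₀ , T) P
          sum-∈ (v′ ∷ vs) (v′∉ AllPairs.∷ _) (here ≡.refl) = trans
            (pair-⊕ (lift (at v₀ f)) ([ v′ ] ⊗ block v′ P) (blocks vs))
            (trans (+-cong (trans (term-same (block v₀ P)) (trans (pair-block v₀ f P) (sym (coeff-pair v₀ T P))))
              (sum-∉ vs (λ v₀∈ → All.lookup v′∉ v₀∈ ≡.refl))) (+-identityʳ _))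
          sum-∈ (v′ ∷ vs) (v′∉ AllPairs.∷ unique) (there v₀∈) = trans
            (pair-⊕ (lift (at v₀ f)) ([ v′ ] ⊗ block v′ P) (blocks vs))
            (trans (+-cong (term-other (block v′ P) (λ eq → All.lookup v′∉ v₀∈ (≡.sym eq))) (sum-∈ vs unique v₀∈))
              (+-identityˡ _))

          leadingTerm : M
          leadingTerm = leading • ([ v ] ⊗ R⟨ w ⟩ [ T₀ ])

          value : Dec (v₀ ≡ v) → Dec (v₀ ◁ v) →
                  leading * pair (lift (at v₀ f)) ([ v ] ⊗ R⟨ w ⟩ [ T₀ ]) + pair (lift (at v₀ f))
                    (blocks lower) ≈ coeff (v₀ , T) P
          value (yes ≡.refl) _ = begin
            leading * pair (lift (at v f)) ([ v ] ⊗ R⟨ w ⟩ [ T₀ ]) + pair (lift (at v f)) (blocks lower)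
              ≈⟨ +-cong (*-congˡ (term-same (R⟨ w ⟩ [ T₀ ]))) (sum-∉ lower (λ v∈ → ◁-irrefl (All.lookup lower-◁ v∈))) ⟩
            leading * pair (f ∘ contents) (R⟨ w ⟩ [ T₀ ]) + 0#   ≈⟨ +-identityʳ _ ⟩
            leading * pair (f ∘ contents) (R⟨ w ⟩ [ T₀ ])        ≈⟨ leading-block f ⟨
            pair (lift (at v f)) P                                ≈⟨ coeff-pair v T P ⟨
            coeff (v , T) P                                       ∎
          value (no v₀≢v) v₀◁?v = begin
            leading * pair (lift (at v₀ f)) ([ v ] ⊗ R⟨ w ⟩ [ T₀ ]) + pair (lift (at v₀ f)) (blocks lower)
              ≈⟨ +-congʳ (trans (*-congˡ (term-other (R⟨ w ⟩ [ T₀ ]) v₀≢v)) (zeroʳ _)) ⟩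
            0# + pair (lift (at v₀ f)) (blocks lower)            ≈⟨ +-identityˡ _ ⟩
            pair (lift (at v₀ f)) (blocks lower)                 ≈⟨ case v₀◁?v (DecMembership._∈?_ _≟ᵉ_ v₀ lower) ⟩
            coeff (v₀ , T) P                                      ∎
            where
            case : Dec (v₀ ◁ v) → Dec (v₀ ∈ lower) → pair (lift (at v₀ f)) (blocks lower) ≈ coeff (v₀ , T) P
            case _ (yes v₀∈) = sum-∈ lower lower-unique v₀∈
            -- A nonzero coefficient would place `v₀` in the support and, being different from `v`,
            -- below `v`, hence in `lower`.
            case v₀◁?v (no v₀∉) = trans (sum-∉ lower v₀∉) (sym
              (¬#⇒≈ λ coeff#0 → vanishes (T , coeff#0) (proj₁ (nonzero⇒top (T , coeff#0)))))
              where
              vanishes : NonzeroAt v₀ → ¬ (v₀ ≡ v ⊎ v₀ ◁ v)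
              vanishes nz (inj₁ eq)   = v₀≢v eq
              vanishes nz (inj₂ v₀◁v) = v₀∉ (∈-deduplicate⁺ _≟ᵉ_ (∈-filter⁺ (_◁? v) (nonzero⇒support nz) v₀◁v))

      expansion : P ≋ leading • ([ v ] ⊗ R⟨ w ⟩ [ T₀ ]) ⊕ Sum lower (λ v′ → [ v′ ] ⊗ block v′ P)
      expansion (v₀ , T) = sym (begin
        coeff (v₀ , T) (leadingTerm ⊕ blocks lower)       ≈⟨ coeff-pair v₀ T (leadingTerm ⊕ blocks lower) ⟩
        pair L (leadingTerm ⊕ blocks lower)               ≈⟨ pair-⊕ L leadingTerm (blocks lower) ⟩
        pair L leadingTerm + pair L (blocks lower)        ≈⟨ +-congʳ (pair-• L leading ([ v ] ⊗ R⟨ w ⟩ [ T₀ ])) ⟩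
        leading * pair L ([ v ] ⊗ R⟨ w ⟩ [ T₀ ]) + pair L (blocks lower)
                                                          ≈⟨ value (v₀ ≟ᵉ v) (v₀ ◁? v) ⟩
        coeff (v₀ , T) P                                  ∎)
        where
        open Coefficient v₀ T
        L : Exponent N × Tableau → Carrier
        L = lift (at v₀ f)

theorem4p2 : ∀ {c ℓ₁ ℓ₂ : Level} (K : RationalFunctionField c ℓ₁ ℓ₂) (n : ℕ) (κ : Partition (suc (suc n))) →
    let open VectorValuedMacdonald K κ in
    (T : Tableau) (v : Exponent N) (P : M) → IsMacdonald v T P →
    (w : Word (suc n)) → IsReducedWordOf (r v) w →
    Σ[ a ∈ Carrier ] Σ[ u ∈ (Exponent N → V) ] Σ[ vs ∈ List (Exponent N) ]
    (a # 0#) × All (_◁ v) vs × Unique vs ×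
    (P ≋ a • ([ v ] ⊗ R⟨ w ⟩ [ T ]) ⊕ Sum vs (λ v′ → [ v′ ] ⊗ u v′))
theorem4p2 K n κ T v P macdonald w reduced =
  leading v T P macdonald w reduced , (λ v′ → block v′ P) , lower v T P macdonald w reduced ,
  leading#0 v T P macdonald w reduced , lower-◁ v T P macdonald w reduced , lower-unique v T P macdonald w reduced ,
  expansion v T P macdonald w reduced
  where open Eigenfunction K κ
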